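{- For every integer $r \geqslant 1$, there exists a constant $d_r \geqslant 0$ such that for every integer $n \geqslant 1$, $$\mathsf{D}(C^r_n) \leqslant r(n-1) + 1 + d_r\left(\frac{n}{P(n)}-1\right).$$
   Context: For an integer $n \geqslant 1$, $C_n$ denotes the cyclic group of order $n$ and $C_n^r$ the direct sum of $r$ copies of $C_n$. For a finite Abelian group $G$, a sequence over $G$ is a finite (unordered, repetitions allowed) sequence of elements of $G$; it is zero-sum if the sum of its elements is $0$. The Davenport constant $\mathsf{D}(G)$ is the smallest integer $t \geqslant 1$ such that every sequence over $G$ of length at least $t$ contains a non-empty zero-sum subsequence. For an integer $n \geqslant 1$, $P(n)$ denotes the greatest prime power dividing $n$, with the convention $P(1)=1$. -}

module Defs where

open import Data.Nat using (ℕ; zero; suc; _+_; _*_; _∸_; _^_; _≤_; _<_)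
open import Data.Nat.Divisibility using (_∣_)
open import Data.Nat.Primality using (Prime)
open import Data.Fin using (Fin; toℕ)
open import Data.List using (List; []; map; length)
open import Data.Nat.ListAction using (sum)
open import Data.List.Relation.Binary.Sublist.Propositional using (_⊆_)
open import Data.Product using (Σ; ∃; _×_)
open import Relation.Binary.PropositionalEquality using (_≡_; _≢_)

-- The group C_n^r, elements are r-tuples of residues mod n (Fin n),
-- with componentwise addition modulo n.
Cnr : ℕ → ℕ → Set
Cnr n r = Fin r → Fin n

-- A sequence over C_n^r is a finite list (order irrelevant for all notions used).
-- It is zero-sum iff its sum in C_n^r is 0, i.e. in every coordinate the
-- sum of the representatives is divisible by n.
ZeroSum : {n r : ℕ} → List (Cnr n r) → Set
ZeroSum {n} {r} xs = (i : Fin r) → n ∣ sum (map (λ x → toℕ (x i)) xs)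

HasNonemptyZeroSumSubseq : {n r : ℕ} → List (Cnr n r) → Set
HasNonemptyZeroSumSubseq xs = Σ _ λ ys → (ys ⊆ xs) × (ys ≢ []) × ZeroSum ys

-- D(C_n^r) ≤ t  (for t ≥ 1): since D is the least t ≥ 1 with the property
-- below (a property monotone in t), D(C_n^r) ≤ t iff t has the property.
DavenportLE : ℕ → ℕ → ℕ → Set
DavenportLE n r t = (xs : List (Cnr n r)) → t ≤ length xs → HasNonemptyZeroSumSubseq xs

-- q is a prime power p^k (k ≥ 0, so 1 counts).
PrimePower : ℕ → Set
PrimePower q = ∃ λ p → ∃ λ k → Prime p × q ≡ p ^ k

-- q = P(n): the greatest prime power dividing n (P(1) = 1 automatically).
IsGreatestPrimePowerDivisor : ℕ → ℕ → Set
IsGreatestPrimePowerDivisor n q =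
  PrimePower q × q ∣ n × ((q′ : ℕ) → PrimePower q′ → q′ ∣ n → q′ ≤ q)

-- Write n = q m with q = p^k.  Every sequence over C_m^r of length at least C (m − 1) + 1 has a zero-sum subsequence of
-- length exactly m, where C depends only on r.  So from the given sequence one can split off r (q − 1) + 1 disjoint
-- blocks of length m whose sums are divisible by m; by Olson's theorem, some of these sums divided by m add up to zero
-- in C_q^r.
--
-- Olson's theorem: the product of the binomials C(x_i + q − 1, q − 1) is a polynomial of degree r (q − 1), so its
-- alternating sum over all subsequences of a longer sequence vanishes.  Modulo p it vanishes off the multiples of q and
-- equals 1 at 0, so the empty subsequence cannot be the only zero-sum one.
--
-- Blocks: the linear bound passes from m and m′ to m m′, so that m = p may be taken prime (theorem of Alon and Dubiner).
-- If many terms lie on an affine hyperplane of F_p^r, one coordinate can be dropped.  Otherwise start from Y = {0} and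
-- replace Y by (Y + s) ∪ (Y + a) for suitable unused terms s, a, until |Y| > p^r / 2; this takes at most p / 4 steps.
-- Two such sets, obtained from disjoint parts of the sequence, have all of F_p^r as their sumset, and filling up with
-- arbitrary terms gives a block of length p.  A step adds the number of points of Y moved out of Y by d = a − s, which is
-- subadditive in d.  While Y is small, averaging it over a box spanned by r independent differences shows that |Y| grows
-- like the r-th power of the number of steps.  Once Y has positive density, consider the marginals of Y, its counts on
-- the hyperplanes l · x = t: the mean square variation of the marginals under translation by l · d is proportional to
-- the growth by d, and for every l ≠ 0 two of the many values l · d without small linear relations have short multiples
-- covering F_p, so some d gives growth by a factor 1 + K / p with K as large as desired.
module Submission where


-- Finite sums in ℕ, indicators and enumerations.

module Summation where
  open import Data.Nat
  open import Data.Nat.Properties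
  open import Data.Nat.Tactic.RingSolver using (solve-∀)
  open import Data.List using (List; []; _∷_; _++_; map; length; concatMap; downFrom)
  open import Data.List.Membership.Propositional using (_∈_)
  open import Data.List.Relation.Unary.Any using (here; there)
  open import Data.List.Relation.Binary.Permutation.Propositional as Perm using (_↭_; prep; swap)
  open import Data.Product using (∃; _×_; _,_)
  open import Data.Empty using (⊥-elim)
  open import Function using (_∘_)
  open import Relation.Nullary
  open import Relation.Binary.PropositionalEquality
  open ≤-Reasoning

  private variable
    A B : Set
    P Q : Set

  ⟦_⟧ : Dec P → ℕ
  ⟦ yes _ ⟧ = 1
  ⟦ no _ ⟧ = 0

  ⟦⟧≤1 : (d : Dec P) → ⟦ d ⟧ ≤ 1
  ⟦⟧≤1 (yes _) = ≤-refl
  ⟦⟧≤1 (no _) = z≤n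

  ⟦⟧-mono : (P → Q) → (d : Dec P) (e : Dec Q) → ⟦ d ⟧ ≤ ⟦ e ⟧
  ⟦⟧-mono f (yes p) (yes q) = ≤-refl
  ⟦⟧-mono f (yes p) (no ¬q) = ⊥-elim (¬q (f p))
  ⟦⟧-mono f (no _) e = z≤n

  ⟦⟧-cong : (P → Q) → (Q → P) → (d : Dec P) (e : Dec Q) → ⟦ d ⟧ ≡ ⟦ e ⟧
  ⟦⟧-cong f g d e = ≤-antisym (⟦⟧-mono f d e) (⟦⟧-mono g e d)

  ⟦⟧-yes : P → (d : Dec P) → ⟦ d ⟧ ≡ 1
  ⟦⟧-yes p (yes _) = refl
  ⟦⟧-yes p (no ¬p) = ⊥-elim (¬p p)

  ⟦⟧-no : ¬ P → (d : Dec P) → ⟦ d ⟧ ≡ 0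
  ⟦⟧-no ¬p (yes p) = ⊥-elim (¬p p)
  ⟦⟧-no ¬p (no _) = refl

  ⟦⟧>0 : (d : Dec P) → 0 < ⟦ d ⟧ → P
  ⟦⟧>0 (yes p) _ = p

  -- Linear arithmetic without subtraction: a goal in ℕ follows from a known inequality `a ≤ b`
  -- through a semiring identity, which the ring solver can check. `e` is the slack.
  ≤-by : ∀ {a b l r} e → a ≤ b → l + b + e ≡ r + a → l ≤ r
  ≤-by {a} {b} {l} {r} e a≤b eq = +-cancelʳ-≤ b l r (begin
    l + b ≤⟨ m≤m+n _ e ⟩
    l + b + e ≡⟨ eq ⟩
    r + a ≤⟨ +-monoʳ-≤ r a≤b ⟩
    r + b ∎)

  ∑ : List A → (A → ℕ) → ℕ
  ∑ [] f = 0
  ∑ (x ∷ xs) f = f x + ∑ xs f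

  ∑-mono∈ : ∀ (xs : List A) {f g} → (∀ {x} → x ∈ xs → f x ≤ g x) → ∑ xs f ≤ ∑ xs g
  ∑-mono∈ [] h = z≤n
  ∑-mono∈ (x ∷ xs) h = +-mono-≤ (h (here refl)) (∑-mono∈ xs (h ∘ there))

  ∑-mono : ∀ (xs : List A) {f g} → (∀ x → f x ≤ g x) → ∑ xs f ≤ ∑ xs g
  ∑-mono xs h = ∑-mono∈ xs (λ _ → h _)

  ∑-cong : ∀ (xs : List A) {f g} → (∀ x → f x ≡ g x) → ∑ xs f ≡ ∑ xs g
  ∑-cong [] h = refl
  ∑-cong (x ∷ xs) h = cong₂ _+_ (h x) (∑-cong xs h)

  ∑-+ : ∀ (xs : List A) f g → ∑ xs (λ x → f x + g x) ≡ ∑ xs f + ∑ xs g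
  ∑-+ [] f g = refl
  ∑-+ (x ∷ xs) f g rewrite ∑-+ xs f g = lemma (f x) (g x) (∑ xs f) (∑ xs g)
    where
    lemma : ∀ a b c d → a + b + (c + d) ≡ a + c + (b + d)
    lemma = solve-∀

  ∑-* : ∀ (xs : List A) c f → ∑ xs (λ x → c * f x) ≡ c * ∑ xs f
  ∑-* [] c f = sym (*-zeroʳ c)
  ∑-* (x ∷ xs) c f rewrite ∑-* xs c f = sym (*-distribˡ-+ c (f x) _)

  ∑-const : ∀ (xs : List A) c → ∑ xs (λ _ → c) ≡ length xs * c
  ∑-const [] c = refl
  ∑-const (x ∷ xs) c = cong (c +_) (∑-const xs c)

  ∑-1 : ∀ (xs : List A) → ∑ xs (λ _ → 1) ≡ length xs
  ∑-1 xs = trans (∑-const xs 1) (*-identityʳ _)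

  ∑-zero : ∀ (xs : List A) → ∑ xs (λ _ → 0) ≡ 0
  ∑-zero xs = trans (∑-const xs 0) (*-zeroʳ (length xs))

  ∑-swap : ∀ (xs : List A) (ys : List B) (f : A → B → ℕ) → ∑ xs (λ x → ∑ ys (f x)) ≡ ∑ ys (λ y → ∑ xs (λ x → f x y))
  ∑-swap [] ys f = sym (∑-zero ys)
  ∑-swap (x ∷ xs) ys f rewrite ∑-swap xs ys f = sym (∑-+ ys (f x) _)

  ∑-++ : ∀ (xs ys : List A) f → ∑ (xs ++ ys) f ≡ ∑ xs f + ∑ ys f
  ∑-++ [] ys f = refl
  ∑-++ (x ∷ xs) ys f rewrite ∑-++ xs ys f = sym (+-assoc (f x) _ _)

  ∑-map : ∀ (h : A → B) xs f → ∑ (map h xs) f ≡ ∑ xs (f ∘ h)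
  ∑-map h [] f = refl
  ∑-map h (x ∷ xs) f = cong (f (h x) +_) (∑-map h xs f)

  ∑-concatMap : ∀ (h : A → List B) xs f → ∑ (concatMap h xs) f ≡ ∑ xs (λ x → ∑ (h x) f)
  ∑-concatMap h [] f = refl
  ∑-concatMap h (x ∷ xs) f = trans (∑-++ (h x) _ f) (cong (∑ (h x) f +_) (∑-concatMap h xs f))

  ∑-↭ : ∀ {xs ys : List A} f → xs ↭ ys → ∑ xs f ≡ ∑ ys f
  ∑-↭ f Perm.refl = refl
  ∑-↭ f (prep x p) = cong (f x +_) (∑-↭ f p)
  ∑-↭ f (swap x y p) rewrite ∑-↭ f p = lemma (f x) (f y) _
    where
    lemma : ∀ a b c → a + (b + c) ≡ b + (a + c)
    lemma = solve-∀
  ∑-↭ f (Perm.trans p q) = trans (∑-↭ f p) (∑-↭ f q)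

  ∑-<⇒∃ : ∀ (xs : List A) {f g} → ∑ xs f < ∑ xs g → ∃ λ x → x ∈ xs × f x < g x
  ∑-<⇒∃ (x ∷ xs) {f} {g} lt with f x <? g x
  ... | yes fx<gx = x , here refl , fx<gx
  ... | no fx≮gx with ∑-<⇒∃ xs (+-cancelˡ-< (f x) _ _ (<-≤-trans lt (+-monoˡ-≤ _ (≮⇒≥ fx≮gx))))
  ...   | y , y∈ , p = y , there y∈ , p

  ∑-≤⇒∃ : ∀ (xs : List A) {f g} → 0 < length xs → ∑ xs f ≤ ∑ xs g → ∃ λ x → x ∈ xs × f x ≤ g x
  -- Reduced to the strict version by adding 1 to every value on the right, which gains at least 1
  -- because the list is non-empty.
  ∑-≤⇒∃ xs {f} {g} 0< le with ∑-<⇒∃ xs {f} {λ x → 1 + g x} (≤-trans (s≤s le) (≤-trans (+-monoˡ-≤ _ 0<) (≤-reflexive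
    (sym (trans (∑-+ xs (λ _ → 1) g) (cong (_+ ∑ xs g) (trans (∑-const xs 1) (*-identityʳ _))))))))
  ... | x , x∈ , p = x , x∈ , ≤-pred p

  ∑-∈ : ∀ {xs : List A} {x} f → x ∈ xs → f x ≤ ∑ xs f
  ∑-∈ f (here refl) = m≤m+n _ _
  ∑-∈ f (there x∈) = ≤-trans (∑-∈ f x∈) (m≤n+m _ _)

  range : ℕ → List ℕ
  range = downFrom

  ∈-range⇒< : ∀ {n k} → k ∈ range n → k < n
  ∈-range⇒< {suc n} (here refl) = ≤-refl
  ∈-range⇒< {suc n} (there k∈) = m<n⇒m<1+n (∈-range⇒< k∈)

  <⇒∈-range : ∀ {n k} → k < n → k ∈ range n
  <⇒∈-range {suc n} {k} k<n with k ≟ n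
  ... | yes refl = here refl
  ... | no k≢n = there (<⇒∈-range (≤∧≢⇒< (≤-pred k<n) k≢n))

  length-range : ∀ n → length (range n) ≡ n
  length-range zero = refl
  length-range (suc n) = cong suc (length-range n)

  ∑-range-const : ∀ n c → ∑ (range n) (λ _ → c) ≡ n * c
  ∑-range-const n c = trans (∑-const (range n) c) (cong (_* c) (length-range n))

  ∑-range-+ : ∀ m n f → ∑ (range m) (λ k → f (k + n)) + ∑ (range n) f ≡ ∑ (range (m + n)) f
  ∑-range-+ zero n f = refl
  ∑-range-+ (suc m) n f = trans (+-assoc (f (m + n)) _ _) (cong (f (m + n) +_) (∑-range-+ m n f))

  ∑-range-mono : ∀ {m n} f → m ≤ n → ∑ (range m) f ≤ ∑ (range n) f
  ∑-range-mono {m} {n} f m≤n = begin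
    ∑ (range m) f ≤⟨ m≤n+m _ _ ⟩
    ∑ (range (n ∸ m)) (λ k → f (k + m)) + ∑ (range m) f ≡⟨ ∑-range-+ (n ∸ m) m f ⟩
    ∑ (range (n ∸ m + m)) f ≡⟨ cong (λ z → ∑ (range z) f) (m∸n+n≡m m≤n) ⟩
    ∑ (range n) f ∎

  -- `once` expresses at the same time completeness of the list and absence of repetitions. Being a
  -- statement about a sum, it combines directly with exchanges of summation.
  record Enumeration (A : Set) : Set where
    infix 4 _≈?_
    field
      _≈?_ : (x y : A) → Dec (x ≡ y)
      els : List A
      once : ∀ a → ∑ els (λ x → ⟦ x ≈? a ⟧) ≡ 1

    pick : ∀ a f → ∑ els (λ x → ⟦ x ≈? a ⟧ * f x) ≡ f a
    pick a f = trans (trans (∑-cong els lemma) (∑-* els (f a) _)) (trans (cong (f a *_) (once a)) (*-identityʳ (f a)))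
      where
      lemma : ∀ x → ⟦ x ≈? a ⟧ * f x ≡ f a * ⟦ x ≈? a ⟧
      lemma x with x ≈? a
      ... | yes refl = *-comm 1 (f x)
      ... | no _ = sym (*-zeroʳ (f a))

    -- Write `f (h x)` as a sum over y weighted by the indicator of y = h x, exchange the sums, and
    -- read the indicator as x = k y.
    reindex : (h k : A → A) → (∀ x → h (k x) ≡ x) → (∀ x → k (h x) ≡ x) → ∀ f → ∑ els (f ∘ h) ≡ ∑ els f
    reindex h k hk kh f = begin-equality
      ∑ els (f ∘ h) ≡⟨ ∑-cong els (λ x → pick (h x) f) ⟨
      ∑ els (λ x → ∑ els (λ y → ⟦ y ≈? h x ⟧ * f y)) ≡⟨ ∑-swap els els _ ⟩
      ∑ els (λ y → ∑ els (λ x → ⟦ y ≈? h x ⟧ * f y))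
        ≡⟨ ∑-cong els (λ y → ∑-cong els (λ x → cong (_* f y) (⟦⟧-cong
             (λ e → trans (sym (kh x)) (cong k (sym e))) (λ e → trans (sym (hk y)) (cong h (sym e))) (y ≈? h x) (x ≈? k y)))) ⟩
      ∑ els (λ y → ∑ els (λ x → ⟦ x ≈? k y ⟧ * f y)) ≡⟨ ∑-cong els (λ y → pick (k y) (λ _ → f y)) ⟩
      ∑ els f ∎

    ∑els-<⇒∃ : ∀ {f g} → ∑ els f < ∑ els g → ∃ λ x → f x < g x
    ∑els-<⇒∃ lt with ∑-<⇒∃ els lt
    ... | x , _ , p = x , p

    ∑els->0⇒∃ : ∀ {f} → 0 < ∑ els f → ∃ λ x → 0 < f x
    ∑els->0⇒∃ h = ∑els-<⇒∃ (≤-<-trans (≤-reflexive (∑-zero els)) h)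

    complete : ∀ a → a ∈ els
    complete a with ∑-<⇒∃ els {λ _ → 0} {λ x → ⟦ x ≈? a ⟧} (subst₂ _<_ (sym (∑-zero els)) (sym (once a)) ≤-refl)
    ... | x , x∈ , p = subst (_∈ els) (⟦⟧>0 (x ≈? a) p) x∈

-- The field with p elements.

module FiniteField where
  open Summation
  open import Data.Nat
  open import Data.Nat.Properties
  open import Data.Nat.DivMod using (_mod_; _%_; %-distribˡ-+; %-distribˡ-*; m<n⇒m%n≡m)
  open import Data.Nat.Divisibility using (_∣_; m%n≡0⇒n∣m; n∣m⇒m%n≡0; n∣n; n∣m*n)
  open import Data.Nat.GCD using (module Bézout)
  open import Data.Nat.Coprimality using (coprime-Bézout; prime⇒coprime) renaming (sym to coprime-sym)
  open import Data.Nat.Primality using (Prime; prime⇒nonZero)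
  open import Data.Fin using (Fin; toℕ) renaming (_≟_ to _≟ᶠ_)
  import Data.Fin as Fin
  open import Data.Fin.Properties using (toℕ-injective; toℕ-fromℕ<; toℕ<n) renaming (suc-injective to suc-injectiveᶠ)
  open import Data.List using (List; length; allFin)
  open import Data.List.Properties using (length-tabulate; map-tabulate)
  open import Data.Product using (∃; _×_; _,_)
  open import Data.Empty using (⊥-elim)
  open import Algebra.Structures using (IsCommutativeRing)
  open import Algebra.Bundles using (CommutativeRing)
  open import Level using (0ℓ)
  open import Function using (_∘_; id)
  open import Relation.Nullary
  open import Relation.Binary.PropositionalEquality
  open ≡-Reasoning

  finEnumeration : ∀ n → Enumeration (Fin n)
  finEnumeration n = record { _≈?_ = _≟ᶠ_ ; els = allFin n ; once = once n }
    where
    ∑-tabulate : ∀ n f → ∑ (Data.List.tabulate {n = n} Fin.suc) f ≡ ∑ (allFin n) (f ∘ Fin.suc)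
    ∑-tabulate n f = trans (cong (λ xs → ∑ xs f) (sym (map-tabulate id Fin.suc))) (∑-map Fin.suc (allFin n) f)
    once : ∀ n (a : Fin n) → ∑ (allFin n) (λ x → ⟦ x ≟ᶠ a ⟧) ≡ 1
    once (suc n) Fin.zero = cong suc (trans (∑-tabulate n _) (∑-zero (allFin n)))
    once (suc n) (Fin.suc a) = trans (∑-tabulate n _)
      (trans (∑-cong (allFin n) (λ x → ⟦⟧-cong suc-injectiveᶠ (cong Fin.suc) (Fin.suc x ≟ᶠ Fin.suc a) (x ≟ᶠ a))) (once n a))

  -- An interface, so that later arguments never see how residues are represented. `ι` is reduction
  -- modulo p.
  record PrimeField (p : ℕ) : Set₁ where
    infixl 6 _⊹_
    infixl 7 _·_
    field
      F : Set
      _⊹_ _·_ : F → F → F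
      ⊖_ : F → F
      0f 1f : F
      isCommutativeRing : IsCommutativeRing _≡_ _⊹_ _·_ ⊖_ 0f 1f
      enumeration : Enumeration F
      size : length (Enumeration.els enumeration) ≡ p
      ι : ℕ → F
      ι-0 : ι 0 ≡ 0f
      ι-1 : ι 1 ≡ 1f
      ι-+ : ∀ m n → ι (m + n) ≡ ι m ⊹ ι n
      ι-* : ∀ m n → ι (m * n) ≡ ι m · ι n
      ι-surjective : ∀ x → ∃ λ n → n < p × ι n ≡ x
      ι≡0⇒∣ : ∀ {n} → ι n ≡ 0f → p ∣ n
      ∣⇒ι≡0 : ∀ {n} → p ∣ n → ι n ≡ 0f
      inverse : ∀ {x} → x ≢ 0f → ∃ λ y → y · x ≡ 1f

    commutativeRing : CommutativeRing 0ℓ 0ℓ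
    commutativeRing = record { isCommutativeRing = isCommutativeRing }

  primeField : ∀ {p} → Prime p → PrimeField p
  primeField {p} pp = record
    { F = Fin p ; _⊹_ = _⊹_ ; _·_ = _·_ ; ⊖_ = ⊖_ ; 0f = ι 0 ; 1f = ι 1
    ; isCommutativeRing = record
      { isRing = record
        { +-isAbelianGroup = record
          { isGroup = record
            { isMonoid = record
              { isSemigroup = record
                { isMagma = record { isEquivalence = isEquivalence ; ∙-cong = cong₂ _⊹_ }
                ; assoc = ⊹-assoc }
              ; identity = (λ x → trans (⊹-comm (ι 0) x) (⊹-identityʳ x)) , ⊹-identityʳ }
            ; inverse = (λ x → trans (⊹-comm (⊖ x) x) (⊖-inverse x)) , ⊖-inverse
            ; ⁻¹-cong = cong ⊖_ }
          ; comm = ⊹-comm }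
        ; *-cong = cong₂ _·_
        ; *-assoc = ·-assoc
        ; *-identity = (λ x → trans (·-comm (ι 1) x) (·-identityʳ x)) , ·-identityʳ
        ; distrib = distribˡ , λ x y z → trans (·-comm (y ⊹ z) x) (trans (distribˡ x y z) (cong₂ _⊹_ (·-comm x y) (·-comm x z))) }
      ; *-comm = ·-comm }
    ; enumeration = finEnumeration p
    ; size = length-tabulate {n = p} id
    ; ι = ι ; ι-0 = refl ; ι-1 = refl ; ι-+ = ι-+ ; ι-* = ι-*
    ; ι-surjective = λ x → toℕ x , toℕ<n x , ι-toℕ x
    ; ι≡0⇒∣ = ι≡0⇒∣ _
    ; ∣⇒ι≡0 = ∣⇒ι≡0
    ; inverse = inv
    }
    where
    instance
      p≢0 : NonZero p
      p≢0 = prime⇒nonZero pp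
    ι : ℕ → Fin p
    ι n = n mod p
    infixl 6 _⊹_
    infixl 7 _·_
    _⊹_ _·_ : Fin p → Fin p → Fin p
    x ⊹ y = ι (toℕ x + toℕ y)
    x · y = ι (toℕ x * toℕ y)
    ⊖_ : Fin p → Fin p
    ⊖ x = ι (p ∸ toℕ x)
    toℕ-ι : ∀ n → toℕ (ι n) ≡ n % p
    toℕ-ι n = toℕ-fromℕ< _
    toℕ-ι0 : toℕ (ι 0) ≡ 0
    toℕ-ι0 = trans (toℕ-ι 0) (m<n⇒m%n≡m (>-nonZero⁻¹ p))
    ι-toℕ : ∀ x → ι (toℕ x) ≡ x
    ι-toℕ x = toℕ-injective (trans (toℕ-ι _) (m<n⇒m%n≡m (toℕ<n x)))
    ι-cong : ∀ {m n} → m % p ≡ n % p → ι m ≡ ι n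
    ι-cong {m} {n} eq = toℕ-injective (trans (toℕ-ι m) (trans eq (sym (toℕ-ι n))))
    ι-+ : ∀ m n → ι (m + n) ≡ ι m ⊹ ι n
    ι-+ m n = trans (ι-cong (trans (%-distribˡ-+ m n p) refl)) (cong ι (sym (cong₂ _+_ (toℕ-ι m) (toℕ-ι n))))
    ι-* : ∀ m n → ι (m * n) ≡ ι m · ι n
    ι-* m n = trans (ι-cong (trans (%-distribˡ-* m n p) refl)) (cong ι (sym (cong₂ _*_ (toℕ-ι m) (toℕ-ι n))))
    ι≡0⇒∣ : ∀ n → ι n ≡ ι 0 → p ∣ n
    ι≡0⇒∣ n eq = m%n≡0⇒n∣m n p (trans (sym (toℕ-ι n)) (trans (cong toℕ eq) toℕ-ι0))
    ∣⇒ι≡0 : ∀ {n} → p ∣ n → ι n ≡ ι 0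
    ∣⇒ι≡0 {n} p∣n = ι-cong (trans (n∣m⇒m%n≡0 n p p∣n) (sym (m<n⇒m%n≡m (>-nonZero⁻¹ p))))
    ⊹-comm : ∀ x y → x ⊹ y ≡ y ⊹ x
    ⊹-comm x y = cong ι (+-comm (toℕ x) (toℕ y))
    ·-comm : ∀ x y → x · y ≡ y · x
    ·-comm x y = cong ι (*-comm (toℕ x) (toℕ y))
    ⊹-identityʳ : ∀ x → x ⊹ ι 0 ≡ x
    ⊹-identityʳ x = trans (cong ι (trans (cong (toℕ x +_) toℕ-ι0) (+-identityʳ _))) (ι-toℕ x)
    ·-identityʳ : ∀ x → x · ι 1 ≡ x
    ·-identityʳ x = trans (cong (_· ι 1) (sym (ι-toℕ x))) (trans (sym (ι-* _ 1)) (trans (cong ι (*-identityʳ _)) (ι-toℕ x)))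
    ⊹-assoc : ∀ x y z → (x ⊹ y) ⊹ z ≡ x ⊹ (y ⊹ z)
    ⊹-assoc x y z = begin
      (x ⊹ y) ⊹ z ≡⟨ cong ((x ⊹ y) ⊹_) (ι-toℕ z) ⟨
      ι (toℕ x + toℕ y) ⊹ ι (toℕ z) ≡⟨ ι-+ _ _ ⟨
      ι (toℕ x + toℕ y + toℕ z) ≡⟨ cong ι (+-assoc (toℕ x) _ _) ⟩
      ι (toℕ x + (toℕ y + toℕ z)) ≡⟨ ι-+ _ _ ⟩
      ι (toℕ x) ⊹ (y ⊹ z) ≡⟨ cong (_⊹ (y ⊹ z)) (ι-toℕ x) ⟩
      x ⊹ (y ⊹ z) ∎
    ·-assoc : ∀ x y z → (x · y) · z ≡ x · (y · z)
    ·-assoc x y z = begin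
      (x · y) · z ≡⟨ cong ((x · y) ·_) (ι-toℕ z) ⟨
      ι (toℕ x * toℕ y) · ι (toℕ z) ≡⟨ ι-* _ _ ⟨
      ι (toℕ x * toℕ y * toℕ z) ≡⟨ cong ι (*-assoc (toℕ x) _ _) ⟩
      ι (toℕ x * (toℕ y * toℕ z)) ≡⟨ ι-* _ _ ⟩
      ι (toℕ x) · (y · z) ≡⟨ cong (_· (y · z)) (ι-toℕ x) ⟩
      x · (y · z) ∎
    distribˡ : ∀ x y z → x · (y ⊹ z) ≡ x · y ⊹ x · z
    distribˡ x y z = begin
      x · (y ⊹ z) ≡⟨ cong (_· (y ⊹ z)) (ι-toℕ x) ⟨
      ι (toℕ x) · (y ⊹ z) ≡⟨ ι-* _ _ ⟨
      ι (toℕ x * (toℕ y + toℕ z)) ≡⟨ cong ι (*-distribˡ-+ (toℕ x) _ _) ⟩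
      ι (toℕ x * toℕ y + toℕ x * toℕ z) ≡⟨ ι-+ _ _ ⟩
      x · y ⊹ x · z ∎
    ⊖-inverse : ∀ x → x ⊹ ⊖ x ≡ ι 0
    ⊖-inverse x = begin
      x ⊹ ⊖ x ≡⟨ cong (_⊹ ⊖ x) (ι-toℕ x) ⟨
      ι (toℕ x) ⊹ ⊖ x ≡⟨ ι-+ _ _ ⟨
      ι (toℕ x + (p ∸ toℕ x)) ≡⟨ cong ι (m+[n∸m]≡n (<⇒≤ (toℕ<n x))) ⟩
      ι p ≡⟨ ∣⇒ι≡0 n∣n ⟩
      ι 0 ∎
    -- Bézout's identity for the representative and p. Over ℕ it has two forms, depending on which
    -- side carries the 1; accordingly the inverse is `ι u` or `⊖ ι u`.
    inv′ : ∀ x a → toℕ x ≡ a → x ≢ ι 0 → ∃ λ y → y · x ≡ ι 1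
    inv : ∀ {x} → x ≢ ι 0 → ∃ λ y → y · x ≡ ι 1
    inv {x} x≢0 = inv′ x (toℕ x) refl x≢0

    inv′ x zero eq x≢0 = ⊥-elim (x≢0 (trans (sym (ι-toℕ x)) (cong ι eq)))
    inv′ x (suc a) eq x≢0 with coprime-Bézout (coprime-sym (prime⇒coprime {n = suc a} pp (subst (_< p) eq (toℕ<n x))))
    ... | Bézout.+- u v e = ι u , (begin
      ι u · x ≡⟨ cong (ι u ·_) (trans (sym (ι-toℕ x)) (cong ι eq)) ⟩
      ι u · ι (suc a) ≡⟨ ι-* u (suc a) ⟨
      ι (u * suc a) ≡⟨ cong ι e ⟨
      ι (1 + v * p) ≡⟨ ι-+ 1 (v * p) ⟩
      ι 1 ⊹ ι (v * p) ≡⟨ cong (ι 1 ⊹_) (∣⇒ι≡0 (n∣m*n v)) ⟩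
      ι 1 ⊹ ι 0 ≡⟨ ⊹-identityʳ (ι 1) ⟩
      ι 1 ∎)
    ... | Bézout.-+ u v e = ⊖ ι u , (begin
      ⊖ ι u · x ≡⟨ ⊹-identityʳ _ ⟨
      ⊖ ι u · x ⊹ ι 0 ≡⟨ cong (⊖ ι u · x ⊹_) (∣⇒ι≡0 (n∣m*n v)) ⟨
      ⊖ ι u · x ⊹ ι (v * p) ≡⟨ cong (λ z → ⊖ ι u · x ⊹ ι z) e ⟨
      ⊖ ι u · x ⊹ ι (1 + u * suc a) ≡⟨ cong (⊖ ι u · x ⊹_) (trans (cong ι (+-comm 1 (u * suc a))) (ι-+ (u * suc a) 1)) ⟩
      ⊖ ι u · x ⊹ (ι (u * suc a) ⊹ ι 1) ≡⟨ cong (λ z → ⊖ ι u · x ⊹ (z ⊹ ι 1)) (trans (ι-* u (suc a)) (cong (ι u ·_) (trans (cong ι (sym eq)) (ι-toℕ x)))) ⟩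
      ⊖ ι u · x ⊹ (ι u · x ⊹ ι 1) ≡⟨ ⊹-assoc _ _ _ ⟨
      ⊖ ι u · x ⊹ ι u · x ⊹ ι 1 ≡⟨ cong (_⊹ ι 1) (cong₂ _⊹_ (·-comm (⊖ ι u) x) (·-comm (ι u) x)) ⟩
      x · ⊖ ι u ⊹ x · ι u ⊹ ι 1 ≡⟨ cong (_⊹ ι 1) (distribˡ x _ _) ⟨
      x · (⊖ ι u ⊹ ι u) ⊹ ι 1 ≡⟨ cong (λ z → x · z ⊹ ι 1) (trans (⊹-comm (⊖ ι u) (ι u)) (⊖-inverse (ι u))) ⟩
      x · ι 0 ⊹ ι 1 ≡⟨ cong (_⊹ ι 1) (cong ι (trans (cong (toℕ x *_) toℕ-ι0) (*-zeroʳ (toℕ x)))) ⟩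
      ι 0 ⊹ ι 1 ≡⟨ ⊹-comm (ι 0) (ι 1) ⟩
      ι 1 ⊹ ι 0 ≡⟨ ⊹-identityʳ (ι 1) ⟩
      ι 1 ∎)

-- Vectors and linear functionals over the prime field.

module LinearAlgebra where
  open Summation
  open FiniteField
  open import Data.Nat
  open import Data.Nat.Properties
  open import Data.List using (List; []; _∷_; map; concatMap)
  open import Data.Vec as Vec using (Vec; []; _∷_)
  open import Data.Vec.Properties as Vecₚ using (∷-injective; ∷-injectiveˡ; ∷-injectiveʳ)
  open import Data.Product using (∃; _×_; _,_)
  open import Data.Empty using (⊥-elim)
  open import Algebra.Bundles using (CommutativeRing)
  open import Relation.Nullary
  open import Relation.Binary.PropositionalEquality
  open ≡-Reasoning

  module Vectors {p : ℕ} (𝔽 : PrimeField p) where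
    open PrimeField 𝔽 public
    open Enumeration enumeration public using () renaming (_≈?_ to infix 4 _≟ᶠ_; els to scalars; once to scalars-once; reindex to scalars-reindex)
    open CommutativeRing commutativeRing using (ring) renaming
      ( +-assoc to ⊹-assoc; +-comm to ⊹-comm; +-identityˡ to ⊹-identityˡ; +-identityʳ to ⊹-identityʳ
      ; -‿inverseˡ to ⊖-inverseˡ; -‿inverseʳ to ⊖-inverseʳ
      ; *-assoc to ·-assoc; *-comm to ·-comm; *-identityˡ to ·-identityˡ
      ; distribˡ to ·-distribˡ; distribʳ to ·-distribʳ; zeroˡ to ·-zeroˡ; zeroʳ to ·-zeroʳ) public
    open import Algebra.Properties.Ring ring public using () renaming
      ( -‿distribˡ-* to ⊖-distribˡ-·; -‿distribʳ-* to ⊖-distribʳ-·; -‿involutive to ⊖-involutive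
      ; -‿+-comm to ⊖-⊹-comm; -0#≈0# to ⊖-0f; x∙y⁻¹≈ε⇒x≈y to ⊹⊖≡0⇒≡)

    ·-cancelˡ-0 : ∀ {x y} → x ≢ 0f → x · y ≡ 0f → y ≡ 0f
    ·-cancelˡ-0 {x} {y} x≢0 xy≡0 with inverse x≢0
    ... | x⁻¹ , e = begin
      y ≡⟨ ·-identityˡ y ⟨
      1f · y ≡⟨ cong (_· y) e ⟨
      x⁻¹ · x · y ≡⟨ ·-assoc x⁻¹ x y ⟩
      x⁻¹ · (x · y) ≡⟨ cong (x⁻¹ ·_) xy≡0 ⟩
      x⁻¹ · 0f ≡⟨ ·-zeroʳ x⁻¹ ⟩
      0f ∎

    ⊹-interchange : ∀ a b c d → a ⊹ b ⊹ (c ⊹ d) ≡ a ⊹ c ⊹ (b ⊹ d)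
    ⊹-interchange a b c d = begin
      a ⊹ b ⊹ (c ⊹ d) ≡⟨ ⊹-assoc a b _ ⟩
      a ⊹ (b ⊹ (c ⊹ d)) ≡⟨ cong (a ⊹_) (⊹-assoc b c d) ⟨
      a ⊹ (b ⊹ c ⊹ d) ≡⟨ cong (λ z → a ⊹ (z ⊹ d)) (⊹-comm b c) ⟩
      a ⊹ (c ⊹ b ⊹ d) ≡⟨ cong (a ⊹_) (⊹-assoc c b d) ⟩
      a ⊹ (c ⊹ (b ⊹ d)) ≡⟨ ⊹-assoc a c _ ⟨
      a ⊹ c ⊹ (b ⊹ d) ∎

    V : ℕ → Set
    V r = Vec F r

    private variable r : ℕ

    infix 4 _≟ᵛ_
    infixl 6 _⊕_
    infixl 7 _∙_
    infix 8 ⊝_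

    _⊕_ : V r → V r → V r
    _⊕_ = Vec.zipWith _⊹_

    ⊝_ : V r → V r
    ⊝_ = Vec.map ⊖_

    𝟎 : V r
    𝟎 = Vec.replicate _ 0f

    ⊕-assoc : (x y z : V r) → x ⊕ y ⊕ z ≡ x ⊕ (y ⊕ z)
    ⊕-assoc = Vecₚ.zipWith-assoc ⊹-assoc

    ⊕-comm : (x y : V r) → x ⊕ y ≡ y ⊕ x
    ⊕-comm = Vecₚ.zipWith-comm ⊹-comm

    ⊕-identityʳ : (x : V r) → x ⊕ 𝟎 ≡ x
    ⊕-identityʳ = Vecₚ.zipWith-identityʳ ⊹-identityʳ

    ⊕-identityˡ : (x : V r) → 𝟎 ⊕ x ≡ x
    ⊕-identityˡ = Vecₚ.zipWith-identityˡ ⊹-identityˡ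

    ⊕-inverseʳ : (x : V r) → x ⊕ ⊝ x ≡ 𝟎
    ⊕-inverseʳ = Vecₚ.zipWith-inverseʳ {⁻¹ = ⊖_} ⊖-inverseʳ

    x⊕d⊝d : (x d : V r) → x ⊕ d ⊕ ⊝ d ≡ x
    x⊕d⊝d x d = trans (⊕-assoc x d _) (trans (cong (x ⊕_) (⊕-inverseʳ d)) (⊕-identityʳ x))

    x⊝d⊕d : (x d : V r) → x ⊕ ⊝ d ⊕ d ≡ x
    x⊝d⊕d x d = trans (⊕-assoc x _ d) (trans (cong (x ⊕_) (trans (⊕-comm _ d) (⊕-inverseʳ d))) (⊕-identityʳ x))

    _∙_ : V r → V r → F
    [] ∙ [] = 0f
    (a ∷ l) ∙ (b ∷ x) = a · b ⊹ l ∙ x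

    ∙-⊕ : (l x y : V r) → l ∙ (x ⊕ y) ≡ l ∙ x ⊹ l ∙ y
    ∙-⊕ [] [] [] = sym (⊹-identityˡ 0f)
    ∙-⊕ (a ∷ l) (b ∷ x) (c ∷ y) = trans (cong₂ _⊹_ (·-distribˡ a b c) (∙-⊕ l x y)) (⊹-interchange _ _ _ _)

    ∙-⊝ : (l x : V r) → l ∙ (⊝ x) ≡ ⊖ (l ∙ x)
    ∙-⊝ [] [] = sym ⊖-0f
    ∙-⊝ (a ∷ l) (b ∷ x) = trans (cong₂ _⊹_ (sym (⊖-distribʳ-· a b)) (∙-⊝ l x)) (⊖-⊹-comm _ _)

    ∙-𝟎 : (l : V r) → l ∙ 𝟎 ≡ 0f
    ∙-𝟎 [] = refl
    ∙-𝟎 (a ∷ l) = trans (cong₂ _⊹_ (·-zeroʳ a) (∙-𝟎 l)) (⊹-identityˡ 0f)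

    𝟎-∙ : (x : V r) → 𝟎 ∙ x ≡ 0f
    𝟎-∙ [] = refl
    𝟎-∙ (b ∷ x) = trans (cong₂ _⊹_ (·-zeroˡ b) (𝟎-∙ x)) (⊹-identityˡ 0f)

    ⊕-∙ : (k l x : V r) → (k ⊕ l) ∙ x ≡ k ∙ x ⊹ l ∙ x
    ⊕-∙ [] [] [] = sym (⊹-identityˡ 0f)
    ⊕-∙ (a ∷ k) (b ∷ l) (c ∷ x) = trans (cong₂ _⊹_ (·-distribʳ c a b) (⊕-∙ k l x)) (⊹-interchange _ _ _ _)

    ⊝-∙ : (l x : V r) → (⊝ l) ∙ x ≡ ⊖ (l ∙ x)
    ⊝-∙ [] [] = sym ⊖-0f
    ⊝-∙ (a ∷ l) (b ∷ x) = trans (cong₂ _⊹_ (sym (⊖-distribˡ-· a b)) (⊝-∙ l x)) (⊖-⊹-comm _ _)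

    scale : F → V r → V r
    scale c = Vec.map (c ·_)

    scale-∙ : ∀ c (l x : V r) → scale c l ∙ x ≡ c · (l ∙ x)
    scale-∙ c [] [] = sym (·-zeroʳ c)
    scale-∙ c (a ∷ l) (b ∷ x) = trans (cong₂ _⊹_ (·-assoc c a b) (scale-∙ c l x)) (sym (·-distribˡ c _ _))

    scale-≢𝟎 : ∀ {c} {l : V r} → c ≢ 0f → l ≢ 𝟎 → scale c l ≢ 𝟎
    scale-≢𝟎 c≢0 l≢0 e = l≢0 (go _ e)
      where
      go : ∀ {r} (l : V r) → scale _ l ≡ 𝟎 → l ≡ 𝟎
      go [] e = refl
      go (a ∷ l) e = cong₂ _∷_ (·-cancelˡ-0 c≢0 (∷-injectiveˡ e)) (go l (∷-injectiveʳ e))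

    infixr 8 _⋆_
    _⋆_ : ℕ → V r → V r
    zero ⋆ x = 𝟎
    suc n ⋆ x = x ⊕ n ⋆ x

    ∙-⋆ : (l : V r) (n : ℕ) (x : V r) → l ∙ (n ⋆ x) ≡ ι n · (l ∙ x)
    ∙-⋆ l zero x = trans (∙-𝟎 l) (sym (trans (cong (_· (l ∙ x)) ι-0) (·-zeroˡ _)))
    ∙-⋆ l (suc n) x = begin
      l ∙ (x ⊕ n ⋆ x) ≡⟨ ∙-⊕ l x _ ⟩
      l ∙ x ⊹ l ∙ (n ⋆ x) ≡⟨ cong₂ _⊹_ (sym (trans (cong (_· (l ∙ x)) ι-1) (·-identityˡ _))) (∙-⋆ l n x) ⟩
      ι 1 · (l ∙ x) ⊹ ι n · (l ∙ x) ≡⟨ ·-distribʳ (l ∙ x) (ι 1) (ι n) ⟨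
      (ι 1 ⊹ ι n) · (l ∙ x) ≡⟨ cong (_· (l ∙ x)) (ι-+ 1 n) ⟨
      ι (suc n) · (l ∙ x) ∎

    _≟ᵛ_ : (x y : V r) → Dec (x ≡ y)
    _≟ᵛ_ = Vecₚ.≡-dec _≟ᶠ_

    vectors : ∀ r → List (V r)
    vectors zero = [] ∷ []
    vectors (suc r) = concatMap (λ a → map (a ∷_) (vectors r)) scalars

    ∑-vectors : ∀ r (f : V (suc r) → ℕ) → ∑ (vectors (suc r)) f ≡ ∑ scalars (λ a → ∑ (vectors r) (λ v → f (a ∷ v)))
    ∑-vectors r f = trans (∑-concatMap _ scalars f) (∑-cong scalars (λ a → ∑-map (a ∷_) (vectors r) f))

    ⟦∷⟧ : ∀ a b (x y : V r) → ⟦ (a ∷ x) ≟ᵛ (b ∷ y) ⟧ ≡ ⟦ a ≟ᶠ b ⟧ * ⟦ x ≟ᵛ y ⟧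
    ⟦∷⟧ a b x y with a ≟ᶠ b | x ≟ᵛ y | (a ∷ x) ≟ᵛ (b ∷ y)
    ... | yes refl | yes refl | yes _ = refl
    ... | yes refl | yes refl | no ¬e = ⊥-elim (¬e refl)
    ... | no ¬e | _ | yes refl = ⊥-elim (¬e refl)
    ... | yes _ | no ¬e | yes refl = ⊥-elim (¬e refl)
    ... | no _ | _ | no _ = refl
    ... | yes _ | no _ | no _ = refl

    vectors-once : ∀ r (a : V r) → ∑ (vectors r) (λ x → ⟦ x ≟ᵛ a ⟧) ≡ 1
    vectors-once zero [] = refl
    vectors-once (suc r) (a ∷ v) = begin
      ∑ (vectors (suc r)) (λ x → ⟦ x ≟ᵛ (a ∷ v) ⟧) ≡⟨ ∑-vectors r _ ⟩
      ∑ scalars (λ b → ∑ (vectors r) (λ x → ⟦ (b ∷ x) ≟ᵛ (a ∷ v) ⟧))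
        ≡⟨ ∑-cong scalars (λ b → trans (∑-cong (vectors r) (λ x → ⟦∷⟧ b a x v)) (∑-* (vectors r) ⟦ b ≟ᶠ a ⟧ _)) ⟩
      ∑ scalars (λ b → ⟦ b ≟ᶠ a ⟧ * ∑ (vectors r) (λ x → ⟦ x ≟ᵛ v ⟧)) ≡⟨ Enumeration.pick enumeration a _ ⟩
      ∑ (vectors r) (λ x → ⟦ x ≟ᵛ v ⟧) ≡⟨ vectors-once r v ⟩
      1 ∎

    vectorEnumeration : ∀ r → Enumeration (V r)
    vectorEnumeration r = record { _≈?_ = _≟ᵛ_ ; els = vectors r ; once = vectors-once r }

    ∑-scalars-const : ∀ c → ∑ scalars (λ _ → c) ≡ p * c
    ∑-scalars-const c = trans (∑-const scalars c) (cong (_* c) size)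

    ∑-vectors-const : ∀ r c → ∑ (vectors r) (λ _ → c) ≡ p ^ r * c
    ∑-vectors-const zero c = refl
    ∑-vectors-const (suc r) c = begin
      ∑ (vectors (suc r)) (λ _ → c) ≡⟨ ∑-vectors r _ ⟩
      ∑ scalars (λ _ → ∑ (vectors r) (λ _ → c)) ≡⟨ ∑-cong scalars (λ _ → ∑-vectors-const r c) ⟩
      ∑ scalars (λ _ → p ^ r * c) ≡⟨ ∑-scalars-const _ ⟩
      p * (p ^ r * c) ≡⟨ *-assoc p _ c ⟨
      p ^ suc r * c ∎

    ∑-vectors-1 : ∀ r → ∑ (vectors r) (λ _ → 1) ≡ p ^ r
    ∑-vectors-1 r = trans (∑-vectors-const r 1) (*-identityʳ _)

    ∑-shift : (f : V r → ℕ) (d : V r) → ∑ (vectors r) (λ x → f (x ⊕ d)) ≡ ∑ (vectors r) f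
    ∑-shift f d = Enumeration.reindex (vectorEnumeration _) (_⊕ d) (_⊕ ⊝ d) (λ x → x⊝d⊕d x d) (λ x → x⊕d⊝d x d) f

    affine-once : ∀ {a} → a ≢ 0f → ∀ c → ∑ scalars (λ x → ⟦ x · a ⊹ c ≟ᶠ 0f ⟧) ≡ 1
    affine-once {a} a≢0 c with inverse a≢0
    ... | a⁻¹ , e = trans (scalars-reindex (λ x → x · a ⊹ c) (λ y → (y ⊹ ⊖ c) · a⁻¹) hk kh (λ x → ⟦ x ≟ᶠ 0f ⟧)) (scalars-once 0f)
      where
      hk : ∀ y → (y ⊹ ⊖ c) · a⁻¹ · a ⊹ c ≡ y
      hk y = begin
        (y ⊹ ⊖ c) · a⁻¹ · a ⊹ c ≡⟨ cong (_⊹ c) (trans (·-assoc _ a⁻¹ a) (trans (cong ((y ⊹ ⊖ c) ·_) e) (trans (·-comm _ 1f) (·-identityˡ _)))) ⟩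
        y ⊹ ⊖ c ⊹ c ≡⟨ ⊹-assoc y _ c ⟩
        y ⊹ (⊖ c ⊹ c) ≡⟨ cong (y ⊹_) (⊖-inverseˡ c) ⟩
        y ⊹ 0f ≡⟨ ⊹-identityʳ y ⟩
        y ∎
      kh : ∀ x → (x · a ⊹ c ⊹ ⊖ c) · a⁻¹ ≡ x
      kh x = begin
        (x · a ⊹ c ⊹ ⊖ c) · a⁻¹ ≡⟨ cong (_· a⁻¹) (trans (⊹-assoc _ c _) (trans (cong (x · a ⊹_) (⊖-inverseʳ c)) (⊹-identityʳ _))) ⟩
        x · a · a⁻¹ ≡⟨ ·-assoc x a a⁻¹ ⟩
        x · (a · a⁻¹) ≡⟨ cong (x ·_) (trans (·-comm a a⁻¹) e) ⟩
        x · 1f ≡⟨ trans (·-comm x 1f) (·-identityˡ x) ⟩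
        x ∎

    -- Induction on the coordinates: a nonzero head of z determines the head of l from its tail,
    -- while a zero head leaves the head of l free.
    orthogonal-count : (z : V r) → z ≢ 𝟎 → p * ∑ (vectors r) (λ l → ⟦ l ∙ z ≟ᶠ 0f ⟧) ≡ p ^ r
    orthogonal-count [] z≢𝟎 = ⊥-elim (z≢𝟎 refl)
    orthogonal-count {suc r} (a ∷ z) z≢𝟎 = cong (p *_) (trans (∑-vectors r _) (main (a ≟ᶠ 0f)))
      where
      main : Dec (a ≡ 0f) → ∑ scalars (λ b → ∑ (vectors r) (λ l → ⟦ b · a ⊹ l ∙ z ≟ᶠ 0f ⟧)) ≡ p ^ r
      main (no a≢0) = begin
        ∑ scalars (λ b → ∑ (vectors r) (λ l → ⟦ b · a ⊹ l ∙ z ≟ᶠ 0f ⟧)) ≡⟨ ∑-swap scalars (vectors r) _ ⟩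
        ∑ (vectors r) (λ l → ∑ scalars (λ b → ⟦ b · a ⊹ l ∙ z ≟ᶠ 0f ⟧)) ≡⟨ ∑-cong (vectors r) (λ l → affine-once a≢0 (l ∙ z)) ⟩
        ∑ (vectors r) (λ l → 1) ≡⟨ ∑-vectors-const r 1 ⟩
        p ^ r * 1 ≡⟨ *-identityʳ _ ⟩
        p ^ r ∎
      main (yes refl) = begin
        ∑ scalars (λ b → ∑ (vectors r) (λ l → ⟦ b · 0f ⊹ l ∙ z ≟ᶠ 0f ⟧))
          ≡⟨ ∑-cong scalars (λ b → ∑-cong (vectors r) (λ l → cong (λ t → ⟦ t ≟ᶠ 0f ⟧) (trans (cong (_⊹ l ∙ z) (·-zeroʳ b)) (⊹-identityˡ _)))) ⟩
        ∑ scalars (λ b → ∑ (vectors r) (λ l → ⟦ l ∙ z ≟ᶠ 0f ⟧)) ≡⟨ ∑-scalars-const _ ⟩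
        p * ∑ (vectors r) (λ l → ⟦ l ∙ z ≟ᶠ 0f ⟧) ≡⟨ orthogonal-count z (λ e → z≢𝟎 (cong (0f ∷_) e)) ⟩
        p ^ r ∎

    -- π forgets a coordinate at which l has a nonzero entry; on the kernel of l the forgotten
    -- coordinate can be recovered. This drives the induction on the dimension.
    hyperplane-projection : (l : V (suc r)) → l ≢ 𝟎 → ∃ λ (π : V (suc r) → V r) →
      (∀ x y → π (x ⊕ y) ≡ π x ⊕ π y) × (∀ x → l ∙ x ≡ 0f → π x ≡ 𝟎 → x ≡ 𝟎)
    hyperplane-projection (a ∷ l) l≢𝟎 with a ≟ᶠ 0f
    ... | no a≢0 = Vec.tail , (λ { (_ ∷ _) (_ ∷ _) → refl }) ,
          λ { (b ∷ x) e refl → cong (_∷ 𝟎) (·-cancelˡ-0 a≢0 (trans (sym (trans (cong (a · b ⊹_) (∙-𝟎 l)) (⊹-identityʳ _))) e)) }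
    hyperplane-projection {zero} (a ∷ []) l≢𝟎 | yes refl = ⊥-elim (l≢𝟎 refl)
    hyperplane-projection {suc r} (a ∷ l) l≢𝟎 | yes refl with hyperplane-projection l (λ e → l≢𝟎 (cong (0f ∷_) e))
    ... | π , π-⊕ , ker = (λ { (b ∷ x) → b ∷ π x }) , (λ { (b ∷ x) (c ∷ y) → cong (b ⊹ c ∷_) (π-⊕ x y) }) ,
          λ { (b ∷ x) e πx≡𝟎 → cong₂ _∷_ (∷-injectiveˡ πx≡𝟎)
                (ker x (trans (sym (trans (cong (_⊹ l ∙ x) (·-zeroˡ b)) (⊹-identityˡ _))) e) (∷-injectiveʳ πx≡𝟎)) }

    ∙-translate : (l x d : V r) {a b : ℕ} → l ∙ d ≢ 0f → l ∙ (x ⊕ a ⋆ d) ≡ l ∙ (x ⊕ b ⋆ d) → ι a ≡ ι b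
    ∙-translate l x d {a} {b} l∙d≢0 e = ⊹⊖≡0⇒≡ _ _ (·-cancelˡ-0 l∙d≢0 (begin
      l ∙ d · (ι a ⊹ ⊖ ι b) ≡⟨ ·-distribˡ _ _ _ ⟩
      l ∙ d · ι a ⊹ l ∙ d · ⊖ ι b ≡⟨ cong (l ∙ d · ι a ⊹_) (⊖-distribʳ-· _ _) ⟨
      l ∙ d · ι a ⊹ ⊖ (l ∙ d · ι b) ≡⟨ cong₂ (λ s t → s ⊹ ⊖ t) (expand a) (expand b) ⟨
      (⊖ (l ∙ x) ⊹ l ∙ (x ⊕ a ⋆ d)) ⊹ ⊖ (⊖ (l ∙ x) ⊹ l ∙ (x ⊕ b ⋆ d)) ≡⟨ cong (λ s → (⊖ (l ∙ x) ⊹ l ∙ (x ⊕ a ⋆ d)) ⊹ ⊖ (⊖ (l ∙ x) ⊹ s)) e ⟨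
      (⊖ (l ∙ x) ⊹ l ∙ (x ⊕ a ⋆ d)) ⊹ ⊖ (⊖ (l ∙ x) ⊹ l ∙ (x ⊕ a ⋆ d)) ≡⟨ ⊖-inverseʳ _ ⟩
      0f ∎))
      where
      expand : ∀ a → ⊖ (l ∙ x) ⊹ l ∙ (x ⊕ a ⋆ d) ≡ l ∙ d · ι a
      expand a = begin
        ⊖ (l ∙ x) ⊹ l ∙ (x ⊕ a ⋆ d) ≡⟨ cong (⊖ (l ∙ x) ⊹_) (∙-⊕ l x _) ⟩
        ⊖ (l ∙ x) ⊹ (l ∙ x ⊹ l ∙ (a ⋆ d)) ≡⟨ ⊹-assoc _ _ _ ⟨
        ⊖ (l ∙ x) ⊹ l ∙ x ⊹ l ∙ (a ⋆ d) ≡⟨ cong (_⊹ l ∙ (a ⋆ d)) (⊖-inverseˡ _) ⟩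
        0f ⊹ l ∙ (a ⋆ d) ≡⟨ ⊹-identityˡ _ ⟩
        l ∙ (a ⋆ d) ≡⟨ ∙-⋆ l a d ⟩
        ι a · (l ∙ d) ≡⟨ ·-comm _ _ ⟩
        l ∙ d · ι a ∎

-- Growth of small sets under translation, by averaging over boxes.

module BoxGrowth where
  open Summation
  open FiniteField
  open LinearAlgebra
  open import Data.Bool using (Bool; true; false; _∧_; not)
  open import Data.Nat
  open import Data.Nat.Properties
  open import Data.Nat.Divisibility using (∣⇒≤)
  open import Data.Nat.Tactic.RingSolver using (solve-∀)
  open import Data.List using (List; []; _∷_; length)
  open import Data.List.Membership.Propositional using (_∈_)
  open import Data.List.Relation.Unary.All as All using (All; []; _∷_)
  open import Data.Vec using ([]; _∷_)
  open import Data.Vec.Properties using (∷-injective)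
  open import Data.Product using (∃; _×_; _,_; proj₁; proj₂)
  open import Data.Empty using (⊥-elim)
  open import Function using (_∘_)
  open import Relation.Nullary
  open import Relation.Binary.PropositionalEquality
  open ≤-Reasoning

  𝟙 : Bool → ℕ
  𝟙 true = 1
  𝟙 false = 0

  𝟙-≤1 : ∀ b → 𝟙 b ≤ 1
  𝟙-≤1 true = ≤-refl
  𝟙-≤1 false = z≤n

  ∑-range-≤1 : ∀ m {P : ℕ → Set} (P? : ∀ c → Dec (P c)) →
    (∀ {a b} → a < m → b < m → P a → P b → a ≡ b) → ∑ (range m) (λ c → ⟦ P? c ⟧) ≤ 1
  ∑-range-≤1 zero P? inj = z≤n
  ∑-range-≤1 (suc m) P? inj with P? m
  ... | no _ = ∑-range-≤1 m P? (λ a< b< → inj (m<n⇒m<1+n a<) (m<n⇒m<1+n b<))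
  ... | yes pm = s≤s (≤-trans (∑-mono∈ (range m) {g = λ _ → 0} (λ c∈ → ≤-reflexive (⟦⟧-no (λ pc →
          <-irrefl (inj (m<n⇒m<1+n (∈-range⇒< c∈)) ≤-refl pc pm) (∈-range⇒< c∈)) (P? _)))) (≤-reflexive (∑-zero (range m))))

  module Translates {p : ℕ} (1<p : 1 < p) (𝔽 : PrimeField p) where
    open Vectors 𝔽 public

    private variable r : ℕ

    instance
      p-nonZero : NonZero p
      p-nonZero = >-nonZero (<⇒≤ 1<p)

    ι-injective-< : ∀ {a b} → a < p → b < p → ι a ≡ ι b → a ≡ b
    ι-injective-< {a} {b} a<p b<p e = ≤-antisym (below a<p b<p e) (below b<p a<p (sym e))
      where
      below : ∀ {a b} → a < p → b < p → ι a ≡ ι b → a ≤ b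
      below {a} {b} a<p b<p e with a ≤? b
      ... | yes a≤b = a≤b
      ... | no a≰b = ⊥-elim (<⇒≱ (≤-<-trans (m∸n≤m a b) a<p) (∣⇒≤ ⦃ >-nonZero (m<n⇒0<n∸m (≰⇒> a≰b)) ⦄ (ι≡0⇒∣ (trans
            (sym (⊹-identityˡ _)) (trans (cong (_⊹ ι (a ∸ b)) (sym (⊖-inverseˡ (ι b)))) (trans (⊹-assoc _ _ _) (trans
            (cong (⊖ ι b ⊹_) (trans (sym (ι-+ b (a ∸ b))) (trans (cong ι (m+[n∸m]≡n (<⇒≤ (≰⇒> a≰b)))) e))) (⊖-inverseˡ (ι b)))))))))

    card : (V r → Bool) → ℕ
    card {r} Y = ∑ (vectors r) (𝟙 ∘ Y)

    -- `common Y d` is the size of Y ∩ (Y - d). `gain Y d` counts the points of Y that d moves out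
    -- of Y, which is also the growth of Y when it is replaced by Y ∪ (Y + d).
    common gain : (V r → Bool) → V r → ℕ
    common {r} Y d = ∑ (vectors r) (λ x → 𝟙 (Y x) * 𝟙 (Y (x ⊕ d)))
    gain {r} Y d = ∑ (vectors r) (λ x → 𝟙 (Y x ∧ not (Y (x ⊕ d))))

    common+gain : (Y : V r → Bool) (d : V r) → common Y d + gain Y d ≡ card Y
    common+gain {r} Y d = trans (sym (∑-+ (vectors r) _ _)) (∑-cong (vectors r) (λ x → lemma (Y x) (Y (x ⊕ d))))
      where
      lemma : ∀ a b → 𝟙 a * 𝟙 b + 𝟙 (a ∧ not b) ≡ 𝟙 a
      lemma true true = refl
      lemma true false = refl
      lemma false b = refl

    -- If x lies in Y and x + d + e does not, then Y is left either on the way from x to x + d or on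
    -- the way from x + d to x + d + e.
    gain-⊕ : (Y : V r → Bool) (d e : V r) → gain Y (d ⊕ e) ≤ gain Y d + gain Y e
    gain-⊕ {r} Y d e = begin
      gain Y (d ⊕ e) ≤⟨ ∑-mono (vectors r) (λ x → lemma (Y x) (Y (x ⊕ d)) (⊕-assoc x d e)) ⟩
      ∑ (vectors r) (λ x → 𝟙 (Y x ∧ not (Y (x ⊕ d))) + 𝟙 (Y (x ⊕ d) ∧ not (Y (x ⊕ d ⊕ e)))) ≡⟨ ∑-+ (vectors r) _ _ ⟩
      gain Y d + ∑ (vectors r) (λ x → 𝟙 (Y (x ⊕ d) ∧ not (Y (x ⊕ d ⊕ e))))
        ≡⟨ cong (gain Y d +_) (∑-shift (λ x → 𝟙 (Y x ∧ not (Y (x ⊕ e)))) d) ⟩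
      gain Y d + gain Y e ∎
      where
      lemma : ∀ {x y} a b → x ≡ y → 𝟙 (a ∧ not (Y y)) ≤ 𝟙 (a ∧ not b) + 𝟙 (b ∧ not (Y x))
      lemma false b refl = z≤n
      lemma true true refl = ≤-refl
      lemma true false refl = ≤-trans (𝟙-≤1 _) (m≤m+n _ _)

    gain-𝟎 : (Y : V r → Bool) → gain Y 𝟎 ≡ 0
    gain-𝟎 {r} Y = trans (∑-cong (vectors r) (λ x → lemma x)) (∑-zero (vectors r))
      where
      lemma : ∀ x → 𝟙 (Y x ∧ not (Y (x ⊕ 𝟎))) ≡ 0
      lemma x rewrite ⊕-identityʳ x with Y x
      ... | true = refl
      ... | false = refl

    gain-⋆ : (Y : V r → Bool) (n : ℕ) (d : V r) → gain Y (n ⋆ d) ≤ n * gain Y d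
    gain-⋆ Y zero d = ≤-reflexive (gain-𝟎 Y)
    gain-⋆ Y (suc n) d = ≤-trans (gain-⊕ Y d (n ⋆ d)) (+-monoʳ-≤ (gain Y d) (gain-⋆ Y n d))

    -- Every ordered pair of points of Y is counted exactly once, at its difference.
    ∑-common : (Y : V r → Bool) → ∑ (vectors r) (common Y) ≡ card Y * card Y
    ∑-common {r} Y = begin-equality
      ∑ (vectors r) (λ d → ∑ (vectors r) (λ x → 𝟙 (Y x) * 𝟙 (Y (x ⊕ d)))) ≡⟨ ∑-swap (vectors r) (vectors r) _ ⟩
      ∑ (vectors r) (λ x → ∑ (vectors r) (λ d → 𝟙 (Y x) * 𝟙 (Y (x ⊕ d))))
        ≡⟨ ∑-cong (vectors r) (λ x → trans (∑-* (vectors r) (𝟙 (Y x)) _) (trans (cong (𝟙 (Y x) *_) (trans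
             (∑-cong (vectors r) (λ d → cong (𝟙 ∘ Y) (⊕-comm x d))) (∑-shift (𝟙 ∘ Y) x))) (*-comm (𝟙 (Y x)) _))) ⟩
      ∑ (vectors r) (λ x → card Y * 𝟙 (Y x)) ≡⟨ ∑-* (vectors r) (card Y) _ ⟩
      card Y * card Y ∎

    Spread : ℕ → List (V r) → Set
    Spread N D = ∀ l → l ≢ 𝟎 → ∀ c → ∑ D (λ a → ⟦ l ∙ a ≟ᶠ c ⟧) ≤ N

    -- Linear independence in triangular form: each direction d comes with a functional that is
    -- nonzero on d and vanishes on all directions after it in the list.
    data Frame {r} : List (V r × V r) → Set where
      [] : Frame []
      _∷_ : ∀ {d l ps} → l ∙ d ≢ 0f × All (λ dl → l ∙ proj₁ dl ≡ 0f) ps → Frame ps → Frame ((d , l) ∷ ps)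

    -- The sum of f over all points `x` + c₁ d₁ + ... with 0 ≤ cᵢ < m, counted with multiplicity.
    box : ℕ → List (V r × V r) → (V r → ℕ) → V r → ℕ
    box m [] f x = f x
    box m ((d , _) ∷ ps) f x = ∑ (range m) (λ c → box m ps f (x ⊕ c ⋆ d))

    -- The functional l is constant on the box because it vanishes on all of its directions, so
    -- weighting f by that hyperplane changes nothing.
    box-restrict : ∀ m (ps : List (V r × V r)) f l x → All (λ dl → l ∙ proj₁ dl ≡ 0f) ps →
      box m ps f x ≡ box m ps (λ z → ⟦ l ∙ z ≟ᶠ l ∙ x ⟧ * f z) x
    box-restrict m [] f l x [] = sym (trans (cong (_* f x) (⟦⟧-yes refl (l ∙ x ≟ᶠ l ∙ x))) (*-identityˡ _))
    box-restrict m ((d , _) ∷ ps) f l x (l∙d≡0 ∷ vanish) = ∑-cong (range m) λ c →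
      trans (box-restrict m ps f l (x ⊕ c ⋆ d) vanish)
        (cong (λ t → box m ps (λ z → ⟦ l ∙ z ≟ᶠ t ⟧ * f z) (x ⊕ c ⋆ d)) (trans (∙-⊕ l x _) (trans (cong (l ∙ x ⊹_) (trans (∙-⋆ l c d)
          (trans (cong (ι c ·_) l∙d≡0) (·-zeroʳ (ι c))))) (⊹-identityʳ _))))

    -- By triangularity the slices for different c lie on different parallel hyperplanes as long as
    -- m ≤ p. Hence no point is hit twice.
    box-≤ : ∀ {m} → m ≤ p → ∀ {ps : List (V r × V r)} → Frame ps → ∀ f x → box m ps f x ≤ ∑ (vectors r) f
    box-≤ {r} m≤p [] f x = ∑-∈ f (Enumeration.complete (vectorEnumeration r) x)
    box-≤ {r} {m} m≤p {(d , l) ∷ ps} ((l∙d≢0 , vanish) ∷ fr) f x = begin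
      ∑ (range m) (λ c → box m ps f (x ⊕ c ⋆ d)) ≡⟨ ∑-cong (range m) (λ c → box-restrict m ps f l (x ⊕ c ⋆ d) vanish) ⟩
      ∑ (range m) (λ c → box m ps (λ z → ⟦ l ∙ z ≟ᶠ l ∙ (x ⊕ c ⋆ d) ⟧ * f z) (x ⊕ c ⋆ d))
        ≤⟨ ∑-mono (range m) (λ c → box-≤ m≤p fr _ (x ⊕ c ⋆ d)) ⟩
      ∑ (range m) (λ c → ∑ (vectors r) (λ z → ⟦ l ∙ z ≟ᶠ l ∙ (x ⊕ c ⋆ d) ⟧ * f z)) ≡⟨ ∑-swap (range m) (vectors r) _ ⟩
      ∑ (vectors r) (λ z → ∑ (range m) (λ c → ⟦ l ∙ z ≟ᶠ l ∙ (x ⊕ c ⋆ d) ⟧ * f z))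
        ≡⟨ ∑-cong (vectors r) (λ z → trans (∑-cong (range m) (λ c → *-comm _ (f z))) (∑-* (range m) (f z) _)) ⟩
      ∑ (vectors r) (λ z → f z * ∑ (range m) (λ c → ⟦ l ∙ z ≟ᶠ l ∙ (x ⊕ c ⋆ d) ⟧))
        ≤⟨ ∑-mono (vectors r) (λ z → ≤-trans (*-monoʳ-≤ (f z) (∑-range-≤1 m (λ c → l ∙ z ≟ᶠ l ∙ (x ⊕ c ⋆ d))
             (λ a< b< pa pb → distinct (<-≤-trans a< m≤p) (<-≤-trans b< m≤p) (trans (sym pa) pb)))) (≤-reflexive (*-identityʳ _))) ⟩
      ∑ (vectors r) f ∎
      where
      distinct : ∀ {a b} → a < p → b < p → l ∙ (x ⊕ a ⋆ d) ≡ l ∙ (x ⊕ b ⋆ d) → a ≡ b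
      distinct a<p b<p e = ι-injective-< a<p b<p (∙-translate l x d l∙d≢0 e)

    box-+ : ∀ m (ps : List (V r × V r)) f g x → box m ps (λ z → f z + g z) x ≡ box m ps f x + box m ps g x
    box-+ m [] f g x = refl
    box-+ m ((d , _) ∷ ps) f g x = trans (∑-cong (range m) (λ c → box-+ m ps f g (x ⊕ c ⋆ d)))
      (∑-+ (range m) (λ c → box m ps f (x ⊕ c ⋆ d)) (λ c → box m ps g (x ⊕ c ⋆ d)))

    box-const : ∀ m (ps : List (V r × V r)) f k x → (∀ z → f z ≡ k) → box m ps f x ≡ m ^ length ps * k
    box-const m [] f k x h = trans (h x) (sym (*-identityˡ k))
    box-const m ((d , _) ∷ ps) f k x h = trans (∑-cong (range m) (λ c → box-const m ps f k (x ⊕ c ⋆ d) h))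
      (trans (∑-range-const m _) (sym (*-assoc m _ k)))

    -- Subadditivity, with each coefficient estimated by m.
    box-gain : ∀ m (ps : List (V r × V r)) (Y : V r → Bool) x →
      box m ps (gain Y) x ≤ m ^ length ps * (gain Y x + m * ∑ ps (gain Y ∘ proj₁))
    box-gain m [] Y x = ≤-reflexive (lemma (gain Y x) m)
      where
      lemma : ∀ a m → a ≡ 1 * (a + m * 0)
      lemma = solve-∀
    box-gain m ((d , _) ∷ ps) Y x = begin
      ∑ (range m) (λ c → box m ps (gain Y) (x ⊕ c ⋆ d)) ≤⟨ ∑-mono (range m) (λ c → box-gain m ps Y (x ⊕ c ⋆ d)) ⟩
      ∑ (range m) (λ c → M * (gain Y (x ⊕ c ⋆ d) + m * S))
        ≤⟨ ∑-mono∈ (range m) (λ {c} c∈ → *-monoʳ-≤ M (+-monoˡ-≤ (m * S) (≤-trans (gain-⊕ Y x (c ⋆ d))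
             (+-monoʳ-≤ (gain Y x) (≤-trans (gain-⋆ Y c d) (*-monoˡ-≤ (gain Y d) (<⇒≤ (∈-range⇒< c∈)))))))) ⟩
      ∑ (range m) (λ c → M * (gain Y x + m * gain Y d + m * S)) ≡⟨ ∑-range-const m _ ⟩
      m * (M * (gain Y x + m * gain Y d + m * S)) ≡⟨ lemma m M (gain Y x) (gain Y d) S ⟩
      m * M * (gain Y x + m * (gain Y d + S)) ∎
      where
      M = m ^ length ps
      S = ∑ ps (gain Y ∘ proj₁)
      lemma : ∀ m M a b s → m * (M * (a + m * b + m * s)) ≡ m * M * (a + m * (b + s))
      lemma = solve-∀

    evaluations : (ds : List (V r × V r)) → V r → V (length ds)
    evaluations [] l = []
    evaluations ((d , _) ∷ ds) l = l ∙ d ∷ evaluations ds l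

    -- Pigeonhole: there are more functionals than vectors of values on the directions, so two
    -- functionals `l₀` and `l₁` have the same values, and their difference vanishes on all
    -- directions.
    annihilator : (ds : List (V r × V r)) → length ds < r → ∃ λ l → l ≢ 𝟎 × All (λ d → l ∙ proj₁ d ≡ 0f) ds
    annihilator {r} ds lt with Enumeration.∑els-<⇒∃ (vectorEnumeration (length ds)) {λ _ → 1} {λ w → ∑ (vectors r) (λ l → ⟦ w ≟ᵛ evaluations ds l ⟧)} (begin-strict
        ∑ (vectors (length ds)) (λ _ → 1) ≡⟨ ∑-vectors-1 (length ds) ⟩
        p ^ length ds <⟨ ^-monoʳ-< p 1<p lt ⟩
        p ^ r ≡⟨ ∑-vectors-1 r ⟨
        ∑ (vectors r) (λ _ → 1) ≡⟨ ∑-cong (vectors r) (λ l → vectors-once (length ds) (evaluations ds l)) ⟨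
        ∑ (vectors r) (λ l → ∑ (vectors (length ds)) (λ w → ⟦ w ≟ᵛ evaluations ds l ⟧)) ≡⟨ ∑-swap (vectors r) (vectors (length ds)) _ ⟩
        ∑ (vectors (length ds)) (λ w → ∑ (vectors r) (λ l → ⟦ w ≟ᵛ evaluations ds l ⟧)) ∎)
    ... | w , two with Enumeration.∑els->0⇒∃ (vectorEnumeration r) (<-trans z<s two)
    ...   | l₀ , h₀ with Enumeration.∑els-<⇒∃ (vectorEnumeration r) {λ l → ⟦ l ≟ᵛ l₀ ⟧} (≤-<-trans (≤-reflexive (vectors-once r l₀)) two)
    ...     | l₁ , h₁ = l₁ ⊕ ⊝ l₀ , nonzero , vanish ds (trans (sym (⟦⟧>0 (w ≟ᵛ _) (≤-<-trans z≤n h₁))) (⟦⟧>0 (w ≟ᵛ _) h₀))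
      where
      nonzero : l₁ ⊕ ⊝ l₀ ≢ 𝟎
      nonzero e = <⇒≱ h₁ (≤-trans (⟦⟧≤1 (w ≟ᵛ _)) (≤-reflexive (sym (⟦⟧-yes (trans (sym (x⊝d⊕d l₁ l₀)) (trans (cong (_⊕ l₀) e) (⊕-identityˡ l₀))) (l₁ ≟ᵛ l₀)))))
      vanish : (ds : List (V r × V r)) → evaluations ds l₁ ≡ evaluations ds l₀ → All (λ d → (l₁ ⊕ ⊝ l₀) ∙ proj₁ d ≡ 0f) ds
      vanish [] e = []
      vanish ((d , _) ∷ ds) e with ∷-injective e
      ... | e₁ , e₂ = trans (⊕-∙ l₁ (⊝ l₀) d) (trans (cong₂ _⊹_ e₁ (⊝-∙ l₀ d)) (⊖-inverseʳ _)) ∷ vanish ds e₂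

    -- The kernel of the annihilator contains at most N terms of D, so some term lies outside it.
    frame-extend : ∀ {N} {D : List (V r)} → Spread N D → N < length D → (ps : List (V r × V r)) → length ps < r →
      ∃ λ dl → proj₁ dl ∈ D × proj₂ dl ∙ proj₁ dl ≢ 0f × All (λ dl′ → proj₂ dl ∙ proj₁ dl′ ≡ 0f) ps
    frame-extend {N = N} {D} sp N<D ps len<r =
      let l , l≢𝟎 , vanish = annihilator ps len<r
          d , d∈D , lt = ∑-<⇒∃ D {λ a → ⟦ l ∙ a ≟ᶠ 0f ⟧} {λ _ → 1} (≤-<-trans (sp l l≢𝟎 0f) (<-≤-trans N<D (≤-reflexive (sym (∑-1 D)))))
      in (d , l) , d∈D , (λ e → <-irrefl (⟦⟧-yes e (l ∙ d ≟ᶠ 0f)) lt) , vanish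

    frame : ∀ {N} {D : List (V r)} → Spread N D → N < length D → ∀ k → k ≤ r →
      ∃ λ ps → Frame ps × length ps ≡ k × All (λ dl → proj₁ dl ∈ D) ps
    frame sp N<D zero k≤r = [] , [] , refl , []
    frame sp N<D (suc k) k≤r =
      let ps , fr , len , in-D = frame sp N<D k (<⇒≤ k≤r)
          dl , d∈D , l∙d≢0 , vanish = frame-extend sp N<D ps (≤-<-trans (≤-reflexive len) k≤r)
      in dl ∷ ps , (l∙d≢0 , vanish) ∷ fr , cong suc len , d∈D ∷ in-D

    -- Sum |Y| = `common` + `gain` over the box based at 0. Since box points are distinct, the
    -- common parts add up to at most |Y|², which is at most half of the total. The gains must
    -- supply the other half.
    box-average : ∀ {m} → 0 < m → m ≤ p → {ps : List (V r × V r)} → Frame ps → length ps ≡ r →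
      (Y : V r → Bool) → 2 * card Y ≤ m ^ r → card Y ≤ 2 * m * ∑ ps (gain Y ∘ proj₁)
    box-average {r} {m} 0<m m≤p {ps} fr len Y small = *-cancelˡ-≤ M ⦃ m^n≢0 m r ⦃ >-nonZero 0<m ⦄ ⦄
        (≤-by 0 (+-mono-≤ (*-monoʳ-≤ 2 average) (*-monoʳ-≤ y small)) (combine M y m S))
      where
      y = card Y
      S = ∑ ps (gain Y ∘ proj₁)
      M = m ^ r
      average : M * y ≤ y * y + M * (m * S)
      average = begin
        M * y ≡⟨ cong (λ k → m ^ k * y) len ⟨
        m ^ length ps * y ≡⟨ box-const m ps _ y 𝟎 (common+gain Y) ⟨
        box m ps (λ z → common Y z + gain Y z) 𝟎 ≡⟨ box-+ m ps (common Y) (gain Y) 𝟎 ⟩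
        box m ps (common Y) 𝟎 + box m ps (gain Y) 𝟎 ≤⟨ +-mono-≤ (box-≤ m≤p fr (common Y) 𝟎) (box-gain m ps Y 𝟎) ⟩
        ∑ (vectors r) (common Y) + m ^ length ps * (gain Y 𝟎 + m * S)
          ≡⟨ cong₂ _+_ (∑-common Y) (cong₂ (λ k g → m ^ k * (g + m * S)) len (gain-𝟎 Y)) ⟩
        y * y + M * (m * S) ∎
      combine : ∀ M y m S → M * y + (2 * (y * y + M * (m * S)) + y * M) + 0 ≡ M * (2 * m * S) + (2 * (M * y) + y * (2 * y))
      combine = solve-∀

    -- One of the `suc r` directions of a frame taken from D has at least the average gain.
    box-growth : ∀ {N m} {D : List (V (suc r))} → Spread N D → N < length D → 0 < m → m ≤ p →
      (Y : V (suc r) → Bool) → 2 * card Y ≤ m ^ suc r → ∃ λ a → a ∈ D × card Y ≤ 2 * suc r * m * gain Y a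
    box-growth {r} {N} {m} {D} sp N<D 0<m m≤p Y small =
      let ps , fr , len , in-D = frame sp N<D (suc r) ≤-refl
          S = ∑ ps (gain Y ∘ proj₁)
          dl , dl∈ , le = ∑-≤⇒∃ ps {λ _ → card Y} {λ dl → 2 * suc r * m * gain Y (proj₁ dl)} (≤-trans z<s (≤-reflexive (sym len))) (begin
            ∑ ps (λ _ → card Y) ≡⟨ trans (∑-const ps (card Y)) (cong (_* card Y) len) ⟩
            suc r * card Y ≤⟨ *-monoʳ-≤ (suc r) (box-average 0<m m≤p fr len Y small) ⟩
            suc r * (2 * m * S) ≡⟨ rearrange (suc r) m S ⟩
            2 * suc r * m * S ≡⟨ ∑-* ps (2 * suc r * m) _ ⟨
            ∑ ps (λ dl → 2 * suc r * m * gain Y (proj₁ dl)) ∎)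
      in proj₁ dl , All.lookup in-D dl∈ , le
      where
      rearrange : ∀ r m s → r * (2 * m * s) ≡ 2 * r * m * s
      rearrange = solve-∀

-- Covering the field by short multiples of two elements.

module PairCover where
  open Summation
  open FiniteField
  open LinearAlgebra
  open BoxGrowth
  open import Data.Nat
  open import Data.Nat.Properties
  open import Data.Nat.DivMod using (_/_; _%_; m≡m%n+[m/n]*n; m%n<n; m<n*o⇒m/o<n)
  open import Data.Nat.Tactic.RingSolver using (solve-∀)
  open import Data.Fin using (Fin; toℕ; fromℕ<)
  open import Data.Fin.Properties using (pigeonhole; toℕ<n; fromℕ<-injective)
  open import Data.Product using (∃; _×_; _,_; proj₁; proj₂)
  open import Data.Sum using (_⊎_; inj₁; inj₂)
  open import Relation.Nullary
  open import Relation.Binary.PropositionalEquality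
  open ≤-Reasoning

  sameQuotient : ∀ {a b n} .⦃ _ : NonZero n ⦄ → a / n ≡ b / n → a ≤ b → b ∸ a < n
  sameQuotient {a} {b} {n} e a≤b = +-cancelʳ-< a (b ∸ a) n (begin-strict
    b ∸ a + a ≡⟨ m∸n+n≡m a≤b ⟩
    b ≡⟨ m≡m%n+[m/n]*n b n ⟩
    b % n + b / n * n <⟨ +-monoˡ-< _ (m%n<n b n) ⟩
    n + b / n * n ≡⟨ cong (λ q → n + q * n) e ⟨
    n + a / n * n ≤⟨ +-monoʳ-≤ n (m≤n+m _ (a % n)) ⟩
    n + (a % n + a / n * n) ≡⟨ cong (n +_) (m≡m%n+[m/n]*n a n) ⟨
    n + a ∎)

  module Line {p : ℕ} (1<p : 1 < p) (𝔽 : PrimeField p) where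
    open Translates 1<p 𝔽

    multiple : ∀ {u} → u ≢ 0f → ∀ x → ∃ λ n → n < p × ι n · u ≡ x
    multiple {u} u≢0 x =
      let u⁻¹ , e = inverse u≢0
          n , n<p , ιn = ι-surjective (x · u⁻¹)
      in n , n<p , trans (cong (_· u) ιn) (trans (·-assoc x u⁻¹ u) (trans (cong (x ·_) e) (trans (·-comm x 1f) (·-identityˡ x))))

    ι-∸ : ∀ {m n} → n ≤ m → ι (m ∸ n) ≡ ι m ⊹ ⊖ ι n
    ι-∸ {m} {n} n≤m = sym (trans (cong (λ k → ι k ⊹ ⊖ ι n) (sym (m∸n+n≡m n≤m))) (trans (cong (_⊹ ⊖ ι n) (ι-+ (m ∸ n) n))
      (trans (⊹-assoc _ _ _) (trans (cong (ι (m ∸ n) ⊹_) (⊖-inverseʳ (ι n))) (⊹-identityʳ _)))))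

    ι-∸-· : ∀ {m n} → n ≤ m → ∀ u → ι (m ∸ n) · u ≡ ι m · u ⊹ ⊖ (ι n · u)
    ι-∸-· {m} {n} n≤m u = trans (cong (_· u) (ι-∸ n≤m)) (trans (·-distribʳ u (ι m) (⊖ ι n)) (cong (ι m · u ⊹_) (sym (⊖-distribˡ-· (ι n) u))))

    -- Dirichlet's approximation theorem for u / u′ modulo p.
    dirichlet : ∀ {K} → 0 < K → ∀ u {u′} → u′ ≢ 0f → ∃ λ w → ∃ λ s → w < K × s * K ≤ p ×
      (ι (suc w) · u ≡ ι s · u′ ⊎ ι (suc w) · u ≡ ⊖ (ι s · u′))
    dirichlet {K} 0<K u {u′} u′≢0 =
      let i , j , i<j , same = pigeonhole (n<1+n K) bucket
      in go (toℕ i) (toℕ j) i<j (toℕ<n j) (fromℕ<-injective _ _ _ _ same)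
      where
      c : ℕ → ℕ
      c i = proj₁ (multiple u′≢0 (ι i · u))
      c<p : ∀ i → c i < p
      c<p i = proj₁ (proj₂ (multiple u′≢0 (ι i · u)))
      ιc : ∀ i → ι (c i) · u′ ≡ ι i · u
      ιc i = proj₂ (proj₂ (multiple u′≢0 (ι i · u)))
      bucket< : ∀ i → c i * K / p < K
      bucket< i = m<n*o⇒m/o<n (begin-strict
        c i * K <⟨ *-monoˡ-< K ⦃ >-nonZero 0<K ⦄ (c<p i) ⟩
        p * K ≡⟨ *-comm p K ⟩
        K * p ∎)
      -- The residues of 0 · u, ..., K · u, measured in multiples of u′, are K + 1 numbers below p;
      -- they fall into K intervals of length p / K.
      bucket : Fin (suc K) → Fin K
      bucket i = fromℕ< (bucket< (toℕ i))
      close : ∀ {i j} → c i * K / p ≡ c j * K / p → c i ≤ c j → (c j ∸ c i) * K ≤ p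
      close {i} {j} e le = <⇒≤ (begin-strict
        (c j ∸ c i) * K ≡⟨ *-distribʳ-∸ K (c j) (c i) ⟩
        c j * K ∸ c i * K <⟨ sameQuotient e (*-monoˡ-≤ K le) ⟩
        p ∎)
      go : ∀ i j → i < j → j < suc K → c i * K / p ≡ c j * K / p → ∃ λ w → ∃ λ s → w < K × s * K ≤ p ×
        (ι (suc w) · u ≡ ι s · u′ ⊎ ι (suc w) · u ≡ ⊖ (ι s · u′))
      -- The multiplier `suc w` is the difference of the two indices, so w itself stays below K. The
      -- sign records which of the two residues is larger.
      go i (suc j) i<j j<K e with ≤-total (c i) (c (suc j))
      ... | inj₁ le = j ∸ i , c (suc j) ∸ c i , ≤-<-trans (m∸n≤m j i) (≤-pred j<K) , close {i} {suc j} e le , inj₁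
            (trans (cong (λ k → ι k · u) (sym (+-∸-assoc 1 (≤-pred i<j)))) (trans (ι-∸-· (<⇒≤ i<j) u)
              (trans (cong₂ (λ s t → s ⊹ ⊖ t) (sym (ιc (suc j))) (sym (ιc i))) (sym (ι-∸-· le u′)))))
      ... | inj₂ ge = j ∸ i , c i ∸ c (suc j) , ≤-<-trans (m∸n≤m j i) (≤-pred j<K) , close {suc j} {i} (sym e) ge , inj₂
            (trans (cong (λ k → ι k · u) (sym (+-∸-assoc 1 (≤-pred i<j)))) (trans (ι-∸-· (<⇒≤ i<j) u)
              (trans (cong₂ (λ s t → s ⊹ ⊖ t) (sym (ιc (suc j))) (sym (ιc i))) (trans (sym (flip-⊖ _ _)) (cong ⊖_ (sym (ι-∸-· ge u′)))))))
        where
        flip-⊖ : ∀ x y → ⊖ (x ⊹ ⊖ y) ≡ y ⊹ ⊖ x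
        flip-⊖ x y = trans (sym (⊖-⊹-comm x (⊖ y))) (trans (cong (⊖ x ⊹_) (⊖-involutive y)) (⊹-comm (⊖ x) y))

    -- Multiples of w u advance in steps of s u′ with K² ≤ s ≤ J, so fewer than p / K² of them go once around F, and
    -- multiples of u′ fill the gaps.
    cover : ∀ {K J} → 0 < K → p ≤ J * K → ∀ {u u′} → u′ ≢ 0f → ∀ w s → w < K → s * K ≤ p → K * K ≤ s →
      (ι (suc w) · u ≡ ι s · u′ ⊎ ι (suc w) · u ≡ ⊖ (ι s · u′)) → ∀ x →
      ∃ λ i → ∃ λ j → i ≤ J × j ≤ J × (x ≡ ι i · u ⊹ ι j · u′ ⊎ x ≡ ⊖ (ι i · u) ⊹ ι j · u′)
    cover {K} {J} 0<K p≤JK {u} {u′} u′≢0 w s w<K sK≤p KK≤s rel x =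
      t * suc w , n % s , tw≤J , ≤-trans (<⇒≤ (m%n<n n s)) s≤J , combine rel
      where
      instance
        K-nonZero : NonZero K
        K-nonZero = >-nonZero 0<K
        s-nonZero : NonZero s
        s-nonZero = >-nonZero (≤-trans (*-mono-≤ 0<K 0<K) KK≤s)
      n = proj₁ (multiple u′≢0 x)
      t = n / s
      n≡ : n ≡ n % s + t * s
      n≡ = m≡m%n+[m/n]*n n s
      s≤J : s ≤ J
      s≤J = *-cancelʳ-≤ s J K (≤-trans sK≤p p≤JK)
      tw≤J : t * suc w ≤ J
      tw≤J = *-cancelʳ-≤ (t * suc w) J K (begin
        t * suc w * K ≡⟨ *-assoc t (suc w) K ⟩
        t * (suc w * K) ≤⟨ *-monoʳ-≤ t (≤-trans (*-monoˡ-≤ K w<K) KK≤s) ⟩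
        t * s ≤⟨ m≤n+m _ (n % s) ⟩
        n % s + t * s ≡⟨ n≡ ⟨
        n ≤⟨ <⇒≤ (proj₁ (proj₂ (multiple u′≢0 x))) ⟩
        p ≤⟨ p≤JK ⟩
        J * K ∎)
      x≡ : x ≡ ι t · (ι s · u′) ⊹ ι (n % s) · u′
      x≡ = trans (sym (proj₂ (proj₂ (multiple u′≢0 x)))) (trans (cong (λ k → ι k · u′) (trans n≡ (+-comm (n % s) (t * s))))
        (trans (cong (_· u′) (ι-+ (t * s) (n % s))) (trans (·-distribʳ u′ _ _) (cong (_⊹ ι (n % s) · u′)
          (trans (cong (_· u′) (ι-* t s)) (·-assoc _ _ u′))))))
      tw : ι t · (ι (suc w) · u) ≡ ι (t * suc w) · u
      tw = trans (sym (·-assoc _ _ u)) (cong (_· u) (sym (ι-* t (suc w))))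
      combine : (ι (suc w) · u ≡ ι s · u′ ⊎ ι (suc w) · u ≡ ⊖ (ι s · u′)) →
        x ≡ ι (t * suc w) · u ⊹ ι (n % s) · u′ ⊎ x ≡ ⊖ (ι (t * suc w) · u) ⊹ ι (n % s) · u′
      combine (inj₁ e) = inj₁ (trans x≡ (cong (_⊹ ι (n % s) · u′) (trans (cong (ι t ·_) (sym e)) tw)))
      combine (inj₂ e) = inj₂ (trans x≡ (cong (_⊹ ι (n % s) · u′) (trans (cong (ι t ·_) (trans (sym (⊖-involutive _)) (cong ⊖_ (sym e))))
        (trans (sym (⊖-distribʳ-· (ι t) _)) (cong ⊖_ tw)))))

    -- The number of small linear relations between u and u′: without any, the multiples of u and u′ up to J cover F.
    relations : ℕ → F → F → ℕ
    relations K u u′ = ⟦ u′ ≟ᶠ 0f ⟧ + ∑ (range K) (λ w → ∑ (range (K * K)) (λ s →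
      ⟦ ι (suc w) · u ≟ᶠ ι s · u′ ⟧ + ⟦ ι (suc w) · u ≟ᶠ ⊖ (ι s · u′) ⟧))

    -- ψ should be thought of as the square of a seminorm on F.
    module _ (ψ : F → ℕ) (ψ-⊖ : ∀ u → ψ (⊖ u) ≡ ψ u) (ψ-⊹ : ∀ u v → ψ (u ⊹ v) ≤ 2 * (ψ u + ψ v)) (J : ℕ) where

      orbit : F → ℕ
      orbit u = ∑ (range (J + J)) (λ k → ψ (ι k · u))

      -- Write j u = (k + j) u - k u for each k < J and average over k. Both multiples occur in the
      -- orbit because k + j < 2 J.
      multiple-bound : ∀ {j} → j ≤ J → ∀ u → J * ψ (ι j · u) ≤ 4 * orbit u
      multiple-bound {j} j≤J u = begin
        J * ψ (ι j · u) ≡⟨ ∑-range-const J _ ⟨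
        ∑ (range J) (λ k → ψ (ι j · u)) ≤⟨ ∑-mono (range J) pointwise ⟩
        ∑ (range J) (λ k → 2 * (ψ (ι (k + j) · u) + ψ (ι k · u))) ≡⟨ ∑-* (range J) 2 _ ⟩
        2 * ∑ (range J) (λ k → ψ (ι (k + j) · u) + ψ (ι k · u)) ≡⟨ cong (2 *_) (∑-+ (range J) (λ k → ψ (ι (k + j) · u)) f) ⟩
        2 * (∑ (range J) (λ k → ψ (ι (k + j) · u)) + ∑ (range J) f)
          ≤⟨ *-monoʳ-≤ 2 (+-mono-≤ (≤-trans (m≤m+n (∑ (range J) (λ k → ψ (ι (k + j) · u))) _) (≤-trans (≤-reflexive (∑-range-+ J j f)) (∑-range-mono f (+-monoʳ-≤ J j≤J)))) (∑-range-mono f (m≤m+n J J))) ⟩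
        2 * (orbit u + orbit u) ≡⟨ lemma (orbit u) ⟩
        4 * orbit u ∎
        where
        f = λ k → ψ (ι k · u)
        lemma : ∀ a → 2 * (a + a) ≡ 4 * a
        lemma = solve-∀
        pointwise : ∀ k → ψ (ι j · u) ≤ 2 * (ψ (ι (k + j) · u) + ψ (ι k · u))
        pointwise k = begin
          ψ (ι j · u) ≡⟨ cong (λ m → ψ (ι m · u)) (m+n∸m≡n k j) ⟨
          ψ (ι (k + j ∸ k) · u) ≡⟨ cong ψ (ι-∸-· (m≤m+n k j) u) ⟩
          ψ (ι (k + j) · u ⊹ ⊖ (ι k · u)) ≤⟨ ψ-⊹ _ _ ⟩
          2 * (ψ (ι (k + j) · u) + ψ (⊖ (ι k · u))) ≡⟨ cong (λ z → 2 * (ψ (ι (k + j) · u) + z)) (ψ-⊖ _) ⟩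
          2 * (ψ (ι (k + j) · u) + ψ (ι k · u)) ∎

      -- By `cover`, every x is the sum of a short multiple of u, up to sign, and a short multiple
      -- of u′. Thus `ψ x` is controlled by the two orbits, and x ranges over p elements.
      no-relations : ∀ {K} → 0 < K → p ≤ J * K → ∀ u u′ → relations K u u′ ≡ 0 →
        J * ∑ scalars ψ ≤ 8 * p * (orbit u + orbit u′)
      no-relations {K} 0<K p≤JK u u′ ≡0 = begin
        J * ∑ scalars ψ ≡⟨ ∑-* scalars J ψ ⟨
        ∑ scalars (λ x → J * ψ x) ≤⟨ ∑-mono scalars pointwise ⟩
        ∑ scalars (λ x → 8 * (orbit u + orbit u′)) ≡⟨ ∑-scalars-const _ ⟩
        p * (8 * (orbit u + orbit u′)) ≡⟨ lemma₁ p (orbit u + orbit u′) ⟩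
        8 * p * (orbit u + orbit u′) ∎
        where
        lemma₁ : ∀ p a → p * (8 * a) ≡ 8 * p * a
        lemma₁ = solve-∀
        lemma₂ : ∀ J a b → J * (2 * (a + b)) ≡ 2 * (J * a + J * b)
        lemma₂ = solve-∀
        lemma₃ : ∀ a b → 2 * (4 * a + 4 * b) ≡ 8 * (a + b)
        lemma₃ = solve-∀
        u′≢0 : u′ ≢ 0f
        u′≢0 e = <⇒≢ (<-≤-trans (≤-reflexive (sym (⟦⟧-yes e (u′ ≟ᶠ 0f)))) (m≤m+n _ _)) (sym ≡0)
        dir = dirichlet 0<K u u′≢0
        w = proj₁ dir
        s = proj₁ (proj₂ dir)
        w<K = proj₁ (proj₂ (proj₂ dir))
        related = proj₂ (proj₂ (proj₂ (proj₂ dir)))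
        -- A pair from `dirichlet` with s below K² would be counted by `relations`.
        large : K * K ≤ s
        large = ≮⇒≥ λ s<KK → <⇒≢ (begin-strict
          0 <⟨ one related ⟩
          ⟦ ι (suc w) · u ≟ᶠ ι s · u′ ⟧ + ⟦ ι (suc w) · u ≟ᶠ ⊖ (ι s · u′) ⟧
            ≤⟨ ∑-∈ (λ s → ⟦ ι (suc w) · u ≟ᶠ ι s · u′ ⟧ + ⟦ ι (suc w) · u ≟ᶠ ⊖ (ι s · u′) ⟧) (<⇒∈-range s<KK) ⟩
          ∑ (range (K * K)) (λ s → ⟦ ι (suc w) · u ≟ᶠ ι s · u′ ⟧ + ⟦ ι (suc w) · u ≟ᶠ ⊖ (ι s · u′) ⟧)
            ≤⟨ ∑-∈ (λ w → ∑ (range (K * K)) (λ s → ⟦ ι (suc w) · u ≟ᶠ ι s · u′ ⟧ + ⟦ ι (suc w) · u ≟ᶠ ⊖ (ι s · u′) ⟧)) (<⇒∈-range w<K) ⟩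
          ∑ (range K) (λ w → ∑ (range (K * K)) (λ s → ⟦ ι (suc w) · u ≟ᶠ ι s · u′ ⟧ + ⟦ ι (suc w) · u ≟ᶠ ⊖ (ι s · u′) ⟧))
            ≤⟨ m≤n+m _ ⟦ u′ ≟ᶠ 0f ⟧ ⟩
          relations K u u′ ∎) (sym ≡0)
          where
          one : (ι (suc w) · u ≡ ι s · u′ ⊎ ι (suc w) · u ≡ ⊖ (ι s · u′)) →
            0 < ⟦ ι (suc w) · u ≟ᶠ ι s · u′ ⟧ + ⟦ ι (suc w) · u ≟ᶠ ⊖ (ι s · u′) ⟧
          one (inj₁ e) = ≤-trans (≤-reflexive (sym (⟦⟧-yes e (_ ≟ᶠ _)))) (m≤m+n _ _)
          one (inj₂ e) = ≤-trans (≤-reflexive (sym (⟦⟧-yes e (_ ≟ᶠ _)))) (m≤n+m _ _)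
        split : ∀ x a b → x ≡ a ⊹ b → J * ψ a ≤ 4 * orbit u → J * ψ b ≤ 4 * orbit u′ → J * ψ x ≤ 8 * (orbit u + orbit u′)
        split x a b refl ha hb = begin
          J * ψ (a ⊹ b) ≤⟨ *-monoʳ-≤ J (ψ-⊹ a b) ⟩
          J * (2 * (ψ a + ψ b)) ≡⟨ lemma₂ J (ψ a) (ψ b) ⟩
          2 * (J * ψ a + J * ψ b) ≤⟨ *-monoʳ-≤ 2 (+-mono-≤ ha hb) ⟩
          2 * (4 * orbit u + 4 * orbit u′) ≡⟨ lemma₃ (orbit u) (orbit u′) ⟩
          8 * (orbit u + orbit u′) ∎
        pointwise : ∀ x → J * ψ x ≤ 8 * (orbit u + orbit u′)
        pointwise x = from-cover (cover 0<K p≤JK u′≢0 w s w<K (proj₁ (proj₂ (proj₂ (proj₂ dir)))) large related x)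
          where
          from-cover : (∃ λ i → ∃ λ j → i ≤ J × j ≤ J × (x ≡ ι i · u ⊹ ι j · u′ ⊎ x ≡ ⊖ (ι i · u) ⊹ ι j · u′)) → J * ψ x ≤ 8 * (orbit u + orbit u′)
          from-cover (i , j , i≤J , j≤J , inj₁ e) = split x _ _ e (multiple-bound i≤J u) (multiple-bound j≤J u′)
          from-cover (i , j , i≤J , j≤J , inj₂ e) = split x _ _ e (≤-trans (≤-reflexive (cong (J *_) (ψ-⊖ _))) (multiple-bound i≤J u)) (multiple-bound j≤J u′)

      -- If there is a relation, the last summand alone exceeds the left side. In this form the
      -- bound holds for all pairs and can be averaged.
      pair-bound : ∀ {K} → 0 < K → p ≤ J * K → ∀ u u′ →
        J * ∑ scalars ψ ≤ 8 * p * (orbit u + orbit u′) + J * ∑ scalars ψ * relations K u u′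
      pair-bound {K} 0<K p≤JK u u′ = by-cases (relations K u u′ ≟ 0)
        where
        by-cases : Dec (relations K u u′ ≡ 0) →
          J * ∑ scalars ψ ≤ 8 * p * (orbit u + orbit u′) + J * ∑ scalars ψ * relations K u u′
        by-cases (no ≢0) = ≤-trans (≤-trans (≤-reflexive (sym (*-identityʳ _))) (*-monoʳ-≤ (J * ∑ scalars ψ) (n≢0⇒n>0 ≢0))) (m≤n+m _ _)
        by-cases (yes ≡0) = ≤-trans (no-relations 0<K p≤JK u u′ ≡0) (m≤m+n _ _)

-- Growth of dense sets, by the marginals along all functionals.

module Radon where
  open Summation
  open FiniteField
  open LinearAlgebra
  open BoxGrowth
  open PairCover
  open import Data.Bool using (Bool)
  open import Data.Nat
  open import Data.Nat.Properties
  open import Data.Nat.Divisibility using (_∣_; ∣⇒≤)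
  open import Data.Nat.Tactic.RingSolver using (solve-∀)
  open import Data.List using (List; length)
  open import Data.List.Membership.Propositional using (_∈_)
  open import Data.Product using (∃; _×_; _,_)
  open import Data.Sum using (inj₁; inj₂)
  open import Function using (_∘_)
  open import Relation.Nullary
  open import Relation.Binary.PropositionalEquality
  open ≤-Reasoning

  sqdist : ℕ → ℕ → ℕ
  sqdist a b = ∣ a - b ∣ * ∣ a - b ∣

  sqdist-comm : ∀ a b → sqdist a b ≡ sqdist b a
  sqdist-comm a b rewrite ∣-∣-comm a b = refl

  -- This factor 2 is the one required of `ψ`, for which `variation` will be used.
  sqdist-triangle : ∀ a b c → sqdist a c ≤ 2 * (sqdist a b + sqdist b c)
  sqdist-triangle a b c = ≤-trans (*-mono-≤ (∣-∣-triangle a b c) (∣-∣-triangle a b c)) (square ∣ a - b ∣ ∣ b - c ∣)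
    where
    wlog : ∀ x y → x ≤ y → (x + y) * (x + y) ≤ 2 * (x * x + y * y)
    wlog x y x≤y with m≤n⇒∃[o]m+o≡n x≤y
    ... | o , refl = ≤-by (o * o) (≤-refl {0}) (lemma x o)
      where
      lemma : ∀ x o → (x + (x + o)) * (x + (x + o)) + 0 + o * o ≡ 2 * (x * x + (x + o) * (x + o)) + 0
      lemma = solve-∀
    square : ∀ x y → (x + y) * (x + y) ≤ 2 * (x * x + y * y)
    square x y with ≤-total x y
    ... | inj₁ x≤y = wlog x y x≤y
    ... | inj₂ y≤x = subst₂ (λ s t → s * s ≤ 2 * t) (+-comm y x) (+-comm (y * y) (x * x)) (wlog y x y≤x)

  sqdist-expand : ∀ a b → sqdist a b + 2 * (a * b) ≡ a * a + b * b
  sqdist-expand a b with ≤-total a b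
  ... | inj₁ a≤b with m≤n⇒∃[o]m+o≡n a≤b
  ...   | o , refl rewrite ∣m-m+n∣≡n a o = lemma a o
    where
    lemma : ∀ a o → o * o + 2 * (a * (a + o)) ≡ a * a + (a + o) * (a + o)
    lemma = solve-∀
  sqdist-expand a b | inj₂ b≤a with m≤n⇒∃[o]m+o≡n b≤a
  ...   | o , refl rewrite ∣-∣-comm (b + o) b | ∣m-m+n∣≡n b o = lemma b o
    where
    lemma : ∀ b o → o * o + 2 * ((b + o) * b) ≡ (b + o) * (b + o) + b * b
    lemma = solve-∀

  -- Averages over all functionals l recover correlations of Y from those of its marginals (a finite Radon transform).
  module Marginals {P : ℕ} (1<p : 1 < suc P) (𝔽 : PrimeField (suc P)) {r : ℕ} (Y : Translates.V 1<p 𝔽 r → Bool) where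
    p = suc P
    open Translates 1<p 𝔽
    open Line 1<p 𝔽

    y : ℕ
    y = card Y

    marginal : V r → F → ℕ
    marginal l t = ∑ (vectors r) (λ x → ⟦ t ≟ᶠ l ∙ x ⟧ * 𝟙 (Y x))

    -- The autocorrelation of the marginal at shift u, and the squared Euclidean distance between
    -- the marginal and its shift.
    correlation variation : V r → F → ℕ
    correlation l u = ∑ scalars (λ t → marginal l t * marginal l (t ⊹ u))
    variation l u = ∑ scalars (λ t → sqdist (marginal l t) (marginal l (t ⊹ u)))

    ∑-shiftᶠ : ∀ u (f : F → ℕ) → ∑ scalars (λ t → f (t ⊹ u)) ≡ ∑ scalars f
    ∑-shiftᶠ u f = scalars-reindex (_⊹ u) (_⊹ ⊖ u)
      (λ t → trans (⊹-assoc t _ u) (trans (cong (t ⊹_) (⊖-inverseˡ u)) (⊹-identityʳ t)))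
      (λ t → trans (⊹-assoc t u _) (trans (cong (t ⊹_) (⊖-inverseʳ u)) (⊹-identityʳ t))) f

    variation-⊖ : ∀ l u → variation l (⊖ u) ≡ variation l u
    variation-⊖ l u = begin-equality
      ∑ scalars (λ t → sqdist (g t) (g (t ⊹ ⊖ u))) ≡⟨ ∑-shiftᶠ u (λ t → sqdist (g t) (g (t ⊹ ⊖ u))) ⟨
      ∑ scalars (λ t → sqdist (g (t ⊹ u)) (g (t ⊹ u ⊹ ⊖ u)))
        ≡⟨ ∑-cong scalars (λ t → trans (cong (λ s → sqdist (g (t ⊹ u)) (g s)) (trans (⊹-assoc t u _) (trans (cong (t ⊹_) (⊖-inverseʳ u)) (⊹-identityʳ t))))
             (sqdist-comm (g (t ⊹ u)) (g t))) ⟩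
      ∑ scalars (λ t → sqdist (g t) (g (t ⊹ u))) ∎
      where g = marginal l

    variation-⊹ : ∀ l u v → variation l (u ⊹ v) ≤ 2 * (variation l u + variation l v)
    variation-⊹ l u v = begin
      ∑ scalars (λ t → sqdist (g t) (g (t ⊹ (u ⊹ v)))) ≡⟨ ∑-cong scalars (λ t → cong (λ s → sqdist (g t) (g s)) (⊹-assoc t u v)) ⟨
      ∑ scalars (λ t → sqdist (g t) (g (t ⊹ u ⊹ v))) ≤⟨ ∑-mono scalars (λ t → sqdist-triangle (g t) (g (t ⊹ u)) (g (t ⊹ u ⊹ v))) ⟩
      ∑ scalars (λ t → 2 * (sqdist (g t) (g (t ⊹ u)) + sqdist (g (t ⊹ u)) (g (t ⊹ u ⊹ v)))) ≡⟨ ∑-* scalars 2 _ ⟩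
      2 * ∑ scalars (λ t → sqdist (g t) (g (t ⊹ u)) + sqdist (g (t ⊹ u)) (g (t ⊹ u ⊹ v)))
        ≡⟨ cong (2 *_) (∑-+ scalars (λ t → sqdist (g t) (g (t ⊹ u))) (λ t → sqdist (g (t ⊹ u)) (g (t ⊹ u ⊹ v)))) ⟩
      2 * (variation l u + ∑ scalars (λ t → sqdist (g (t ⊹ u)) (g (t ⊹ u ⊹ v))))
        ≡⟨ cong (λ s → 2 * (variation l u + s)) (∑-shiftᶠ u (λ t → sqdist (g t) (g (t ⊹ v)))) ⟩
      2 * (variation l u + variation l v) ∎
      where g = marginal l

    -- Polarisation: |g - g′|² + 2 ⟨g, g′⟩ = |g|² + |g′|², where the shift g′ of g has the same norm
    -- and `correlation l 0f` is |g|².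
    variation+correlation : ∀ l u → variation l u + 2 * correlation l u ≡ 2 * correlation l 0f
    variation+correlation l u = begin-equality
      variation l u + 2 * correlation l u ≡⟨ cong (variation l u +_) (∑-* scalars 2 _) ⟨
      variation l u + ∑ scalars (λ t → 2 * (g t * g (t ⊹ u))) ≡⟨ ∑-+ scalars (λ t → sqdist (g t) (g (t ⊹ u))) (λ t → 2 * (g t * g (t ⊹ u))) ⟨
      ∑ scalars (λ t → sqdist (g t) (g (t ⊹ u)) + 2 * (g t * g (t ⊹ u))) ≡⟨ ∑-cong scalars (λ t → sqdist-expand (g t) (g (t ⊹ u))) ⟩
      ∑ scalars (λ t → g t * g t + g (t ⊹ u) * g (t ⊹ u)) ≡⟨ ∑-+ scalars (λ t → g t * g t) (λ t → g (t ⊹ u) * g (t ⊹ u)) ⟩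
      E + ∑ scalars (λ t → g (t ⊹ u) * g (t ⊹ u)) ≡⟨ cong (E +_) (∑-shiftᶠ u (λ t → g t * g t)) ⟩
      E + E ≡⟨ cong (E +_) (+-identityʳ E) ⟨
      2 * E ≡⟨ cong (2 *_) (∑-cong scalars (λ t → cong (λ s → g t * g s) (⊹-identityʳ t))) ⟨
      2 * correlation l 0f ∎
      where
      g = marginal l
      E = ∑ scalars (λ t → g t * g t)

    -- The points of Y sorted by their value under l.
    ∑-marginal : ∀ l (h : F → ℕ) → ∑ scalars (λ t → marginal l t * h t) ≡ ∑ (vectors r) (λ x → 𝟙 (Y x) * h (l ∙ x))
    ∑-marginal l h = begin-equality
      ∑ scalars (λ t → marginal l t * h t) ≡⟨ ∑-cong scalars (λ t → trans (*-comm (marginal l t) (h t)) (sym (∑-* (vectors r) (h t) _))) ⟩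
      ∑ scalars (λ t → ∑ (vectors r) (λ x → h t * (⟦ t ≟ᶠ l ∙ x ⟧ * 𝟙 (Y x)))) ≡⟨ ∑-swap scalars (vectors r) _ ⟩
      ∑ (vectors r) (λ x → ∑ scalars (λ t → h t * (⟦ t ≟ᶠ l ∙ x ⟧ * 𝟙 (Y x))))
        ≡⟨ ∑-cong (vectors r) (λ x → trans (∑-cong scalars (λ t → rearrange (h t) ⟦ t ≟ᶠ l ∙ x ⟧ (𝟙 (Y x)))) (Enumeration.pick enumeration (l ∙ x) (λ t → 𝟙 (Y x) * h t))) ⟩
      ∑ (vectors r) (λ x → 𝟙 (Y x) * h (l ∙ x)) ∎
      where
      rearrange : ∀ a b c → a * (b * c) ≡ b * (c * a)
      rearrange = solve-∀

    marginal-total : ∀ l → ∑ scalars (marginal l) ≡ y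
    marginal-total l = trans (∑-cong scalars (λ t → sym (*-identityʳ (marginal l t)))) (trans (∑-marginal l (λ _ → 1)) (∑-cong (vectors r) (λ x → *-identityʳ (𝟙 (Y x)))))

    ∑-correlation : ∀ l → ∑ scalars (correlation l) ≡ y * y
    ∑-correlation l = begin-equality
      ∑ scalars (λ u → ∑ scalars (λ t → g t * g (t ⊹ u))) ≡⟨ ∑-swap scalars scalars _ ⟩
      ∑ scalars (λ t → ∑ scalars (λ u → g t * g (t ⊹ u)))
        ≡⟨ ∑-cong scalars (λ t → trans (∑-* scalars (g t) _) (trans (cong (g t *_) (trans (trans (∑-cong scalars (λ u → cong g (⊹-comm t u))) (∑-shiftᶠ t g)) (marginal-total l))) (*-comm (g t) y))) ⟩
      ∑ scalars (λ t → y * g t) ≡⟨ trans (∑-* scalars y g) (cong (y *_) (marginal-total l)) ⟩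
      y * y ∎
      where g = marginal l

    zeros : V r → ℕ
    zeros z = ∑ (vectors r) (λ l → ⟦ l ∙ z ≟ᶠ 0f ⟧)

    -- The inversion kernel: apart from a constant, the number of functionals vanishing at z detects
    -- whether z = 0.
    zeros-count : ∀ z → p * zeros z ≡ p ^ r + P * p ^ r * ⟦ z ≟ᵛ 𝟎 ⟧
    zeros-count z = by-cases (z ≟ᵛ 𝟎)
      where
      by-cases : (d : Dec (z ≡ 𝟎)) → p * zeros z ≡ p ^ r + P * p ^ r * ⟦ d ⟧
      by-cases (yes refl) = trans (cong (p *_) (trans (∑-cong (vectors r) (λ l → ⟦⟧-yes (∙-𝟎 l) (l ∙ 𝟎 ≟ᶠ 0f))) (∑-vectors-1 r)))
        (cong (p ^ r +_) (sym (*-identityʳ _)))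
      by-cases (no z≢𝟎) = trans (orthogonal-count z z≢𝟎) (sym (trans (cong (p ^ r +_) (*-zeroʳ (P * p ^ r))) (+-identityʳ _)))

    correlation-expand : ∀ l d → correlation l (l ∙ d) ≡ ∑ (vectors r) (λ x → ∑ (vectors r) (λ x′ → 𝟙 (Y x) * 𝟙 (Y x′) * ⟦ l ∙ (x ⊕ d ⊕ ⊝ x′) ≟ᶠ 0f ⟧))
    correlation-expand l d = trans (∑-marginal l (λ t → marginal l (t ⊹ l ∙ d))) (∑-cong (vectors r) (λ x → trans (sym (∑-* (vectors r) (𝟙 (Y x)) _))
      (∑-cong (vectors r) (λ x′ → trans (cong (λ k → 𝟙 (Y x) * (k * 𝟙 (Y x′))) (same x x′)) (rearrange (𝟙 (Y x)) _ (𝟙 (Y x′)))))))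
      where
      rearrange : ∀ a b c → a * (b * c) ≡ a * c * b
      rearrange = solve-∀
      expand : ∀ x x′ → l ∙ (x ⊕ d ⊕ ⊝ x′) ≡ l ∙ x ⊹ l ∙ d ⊹ ⊖ (l ∙ x′)
      expand x x′ = trans (∙-⊕ l _ _) (cong₂ _⊹_ (∙-⊕ l x d) (∙-⊝ l x′))
      same : ∀ x x′ → ⟦ l ∙ x ⊹ l ∙ d ≟ᶠ l ∙ x′ ⟧ ≡ ⟦ l ∙ (x ⊕ d ⊕ ⊝ x′) ≟ᶠ 0f ⟧
      same x x′ = ⟦⟧-cong (λ e → trans (expand x x′) (trans (cong (_⊹ ⊖ (l ∙ x′)) e) (⊖-inverseʳ _)))
        (λ e → ⊹⊖≡0⇒≡ _ _ (trans (sym (expand x x′)) e)) (_ ≟ᶠ _) (_ ≟ᶠ _)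

    -- Points x, x′ of Y contribute the number of l vanishing at x + d - x′. By `zeros-count`, p
    -- times this number is p^r, with an excess of P p^r when x′ = x + d; the excess occurs for
    -- `common Y d` pairs.
    correlation-average : ∀ d → p * ∑ (vectors r) (λ l → correlation l (l ∙ d)) ≡ p ^ r * (y * y) + P * p ^ r * common Y d
    correlation-average d = begin-equality
      p * ∑ vs (λ l → correlation l (l ∙ d)) ≡⟨ cong (p *_) (∑-cong vs (λ l → correlation-expand l d)) ⟩
      p * ∑ vs (λ l → ∑ vs (λ x → ∑ vs (λ x′ → w x x′ * ⟦ l ∙ (x ⊕ d ⊕ ⊝ x′) ≟ᶠ 0f ⟧))) ≡⟨ cong (p *_) (∑-swap vs vs _) ⟩
      p * ∑ vs (λ x → ∑ vs (λ l → ∑ vs (λ x′ → w x x′ * ⟦ l ∙ (x ⊕ d ⊕ ⊝ x′) ≟ᶠ 0f ⟧)))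
        ≡⟨ cong (p *_) (∑-cong vs (λ x → trans (∑-swap vs vs _) (∑-cong vs (λ x′ → ∑-* vs (w x x′) _)))) ⟩
      p * ∑ vs (λ x → ∑ vs (λ x′ → w x x′ * zeros (x ⊕ d ⊕ ⊝ x′))) ≡⟨ trans (sym (∑-* vs p _)) (∑-cong vs (λ x → sym (∑-* vs p _))) ⟩
      ∑ vs (λ x → ∑ vs (λ x′ → p * (w x x′ * zeros (x ⊕ d ⊕ ⊝ x′)))) ≡⟨ ∑-cong vs (λ x → ∑-cong vs (λ x′ → pointwise x x′)) ⟩
      ∑ vs (λ x → ∑ vs (λ x′ → p ^ r * w x x′ + P * p ^ r * (⟦ x′ ≟ᵛ x ⊕ d ⟧ * w x x′)))
        ≡⟨ ∑-cong vs (λ x → trans (∑-+ vs (λ x′ → p ^ r * w x x′) (λ x′ → P * p ^ r * (⟦ x′ ≟ᵛ x ⊕ d ⟧ * w x x′)))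
             (cong₂ _+_ (∑-* vs (p ^ r) (w x)) (trans (∑-* vs (P * p ^ r) _) (cong (P * p ^ r *_) (Enumeration.pick (vectorEnumeration r) (x ⊕ d) (w x)))))) ⟩
      ∑ vs (λ x → p ^ r * ∑ vs (w x) + P * p ^ r * (𝟙 (Y x) * 𝟙 (Y (x ⊕ d))))
        ≡⟨ trans (∑-+ vs (λ x → p ^ r * ∑ vs (w x)) (λ x → P * p ^ r * (𝟙 (Y x) * 𝟙 (Y (x ⊕ d))))) (cong₂ _+_ (∑-* vs (p ^ r) _) (∑-* vs (P * p ^ r) _)) ⟩
      p ^ r * ∑ vs (λ x → ∑ vs (w x)) + P * p ^ r * common Y d
        ≡⟨ cong (λ s → p ^ r * s + P * p ^ r * common Y d) (trans (∑-cong vs (λ x → trans (∑-* vs (𝟙 (Y x)) (𝟙 ∘ Y)) (*-comm (𝟙 (Y x)) y))) (∑-* vs y (𝟙 ∘ Y))) ⟩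
      p ^ r * (y * y) + P * p ^ r * common Y d ∎
      where
      vs = vectors r
      w = λ x x′ → 𝟙 (Y x) * 𝟙 (Y x′)
      rearrange : ∀ p w z → p * (w * z) ≡ w * (p * z)
      rearrange = solve-∀
      distribute : ∀ a b w i → w * (a + b * i) ≡ a * w + b * (i * w)
      distribute = solve-∀
      same : ∀ x x′ → ⟦ x ⊕ d ⊕ ⊝ x′ ≟ᵛ 𝟎 ⟧ ≡ ⟦ x′ ≟ᵛ x ⊕ d ⟧
      same x x′ = ⟦⟧-cong (λ e → trans (sym (⊕-identityˡ x′)) (trans (cong (_⊕ x′) (sym e)) (x⊝d⊕d (x ⊕ d) x′)))
        (λ e → trans (cong (_⊕ ⊝ x′) (sym e)) (⊕-inverseʳ x′)) (_ ≟ᵛ _) (_ ≟ᵛ _)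
      pointwise : ∀ x x′ → p * (w x x′ * zeros (x ⊕ d ⊕ ⊝ x′)) ≡ p ^ r * w x x′ + P * p ^ r * (⟦ x′ ≟ᵛ x ⊕ d ⟧ * w x x′)
      pointwise x x′ = trans (rearrange p (w x x′) (zeros (x ⊕ d ⊕ ⊝ x′))) (trans (cong (w x x′ *_) (trans (zeros-count _) (cong (λ i → p ^ r + P * p ^ r * i) (same x x′))))
        (distribute (p ^ r) (P * p ^ r) (w x x′) _))

    common-𝟎 : common Y 𝟎 ≡ y
    common-𝟎 = trans (sym (+-identityʳ _)) (trans (cong (common Y 𝟎 +_) (sym (gain-𝟎 Y))) (common+gain Y 𝟎))

    correlation-average-0 : p * ∑ (vectors r) (λ l → correlation l 0f) ≡ p ^ r * (y * y) + P * p ^ r * y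
    correlation-average-0 = trans (cong (p *_) (∑-cong (vectors r) (λ l → cong (correlation l) (sym (∙-𝟎 l)))))
      (trans (correlation-average 𝟎) (cong (λ s → p ^ r * (y * y) + P * p ^ r * s) common-𝟎))

    -- By polarisation this is twice the difference of the correlation averages at 0 and at d. The
    -- terms in y² cancel, and y minus `common Y d` is the gain.
    variation-average : ∀ d → p * ∑ (vectors r) (λ l → variation l (l ∙ d)) ≡ 2 * (P * p ^ r * gain Y d)
    variation-average d = +-cancelʳ-≡ (2 * (A + B * R)) _ _ (begin-equality
      p * Ψ + 2 * (A + B * R) ≡⟨ cong (λ s → p * Ψ + 2 * s) (correlation-average d) ⟨
      p * Ψ + 2 * (p * C) ≡⟨ rearrange p Ψ C ⟩
      p * (Ψ + 2 * C) ≡⟨ cong (p *_) (trans (cong (Ψ +_) (sym (∑-* (vectors r) 2 _))) (trans (sym (∑-+ (vectors r) (λ l → variation l (l ∙ d)) _))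
                          (trans (∑-cong (vectors r) (λ l → variation+correlation l (l ∙ d))) (∑-* (vectors r) 2 _)))) ⟩
      p * (2 * ∑ (vectors r) (λ l → correlation l 0f)) ≡⟨ swap p 2 (∑ (vectors r) (λ l → correlation l 0f)) ⟩
      2 * (p * ∑ (vectors r) (λ l → correlation l 0f)) ≡⟨ cong (2 *_) correlation-average-0 ⟩
      2 * (A + B * y) ≡⟨ cong (λ s → 2 * (A + B * s)) (common+gain Y d) ⟨
      2 * (A + B * (R + gain Y d)) ≡⟨ final A B R (gain Y d) ⟩
      2 * (B * gain Y d) + 2 * (A + B * R) ∎)
      where
      Ψ = ∑ (vectors r) (λ l → variation l (l ∙ d))
      C = ∑ (vectors r) (λ l → correlation l (l ∙ d))
      A = p ^ r * (y * y)
      B = P * p ^ r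
      R = common Y d
      rearrange : ∀ p a c → p * a + 2 * (p * c) ≡ p * (a + 2 * c)
      rearrange = solve-∀
      swap : ∀ a b c → a * (b * c) ≡ b * (a * c)
      swap = solve-∀
      final : ∀ a b r g → 2 * (a + b * (r + g)) ≡ 2 * (b * g) + 2 * (a + b * r)
      final = solve-∀

    total : V r → ℕ
    total l = ∑ scalars (variation l)

    -- Polarisation summed over all p shifts u.
    total+ : ∀ l → total l + 2 * (y * y) ≡ 2 * (p * correlation l 0f)
    total+ l = begin-equality
      total l + 2 * (y * y) ≡⟨ cong (λ s → total l + 2 * s) (∑-correlation l) ⟨
      total l + 2 * ∑ scalars (correlation l) ≡⟨ cong (total l +_) (∑-* scalars 2 _) ⟨
      total l + ∑ scalars (λ u → 2 * correlation l u) ≡⟨ ∑-+ scalars (variation l) _ ⟨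
      ∑ scalars (λ u → variation l u + 2 * correlation l u) ≡⟨ ∑-cong scalars (variation+correlation l) ⟩
      ∑ scalars (λ u → 2 * correlation l 0f) ≡⟨ ∑-scalars-const _ ⟩
      p * (2 * correlation l 0f) ≡⟨ swap p 2 (correlation l 0f) ⟩
      2 * (p * correlation l 0f) ∎
      where
      swap : ∀ a b c → a * (b * c) ≡ b * (a * c)
      swap = solve-∀

    -- The zero functional sends all of Y to a single value, so its marginal is y at 0. Its exact
    -- contribution is needed because spread says nothing about it.
    total-𝟎 : total 𝟎 ≡ 2 * (P * (y * y))
    total-𝟎 = +-cancelʳ-≡ (2 * (y * y)) _ _ (begin-equality
      total 𝟎 + 2 * (y * y) ≡⟨ total+ 𝟎 ⟩
      2 * (p * correlation 𝟎 0f) ≡⟨ cong (λ s → 2 * (p * s)) correlation-𝟎 ⟩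
      2 * (p * (y * y)) ≡⟨ lemma P (y * y) ⟩
      2 * (P * (y * y)) + 2 * (y * y) ∎)
      where
      lemma : ∀ P a → 2 * (a + P * a) ≡ 2 * (P * a) + 2 * a
      lemma = solve-∀
      marginal-𝟎 : marginal 𝟎 0f ≡ y
      marginal-𝟎 = ∑-cong (vectors r) (λ x → trans (cong (_* 𝟙 (Y x)) (⟦⟧-yes (sym (𝟎-∙ x)) (0f ≟ᶠ 𝟎 ∙ x))) (*-identityˡ _))
      correlation-𝟎 : correlation 𝟎 0f ≡ y * y
      correlation-𝟎 = trans (∑-marginal 𝟎 (λ t → marginal 𝟎 (t ⊹ 0f))) (trans (∑-cong (vectors r) (λ x → trans (cong (λ s → 𝟙 (Y x) * marginal 𝟎 s)
        (trans (⊹-identityʳ _) (𝟎-∙ x))) (trans (cong (𝟙 (Y x) *_) marginal-𝟎) (*-comm (𝟙 (Y x)) y)))) (∑-* (vectors r) y (𝟙 ∘ Y)))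

    ∑-total : ∑ (vectors r) total ≡ 2 * (P * p ^ r * y)
    ∑-total = +-cancelʳ-≡ (2 * A) _ _ (begin-equality
      ∑ (vectors r) total + 2 * A ≡⟨ cong (∑ (vectors r) total +_) (trans (swap 2 (p ^ r) (y * y)) (sym (∑-vectors-const r _))) ⟩
      ∑ (vectors r) total + ∑ (vectors r) (λ _ → 2 * (y * y)) ≡⟨ ∑-+ (vectors r) total _ ⟨
      ∑ (vectors r) (λ l → total l + 2 * (y * y)) ≡⟨ ∑-cong (vectors r) total+ ⟩
      ∑ (vectors r) (λ l → 2 * (p * correlation l 0f)) ≡⟨ trans (∑-* (vectors r) 2 _) (cong (2 *_) (∑-* (vectors r) p _)) ⟩
      2 * (p * ∑ (vectors r) (λ l → correlation l 0f)) ≡⟨ cong (2 *_) correlation-average-0 ⟩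
      2 * (A + P * p ^ r * y) ≡⟨ lemma A (P * p ^ r * y) ⟩
      2 * (P * p ^ r * y) + 2 * A ∎)
      where
      A = p ^ r * (y * y)
      swap : ∀ a b c → a * (b * c) ≡ b * (a * c)
      swap = solve-∀
      lemma : ∀ a b → 2 * (a + b) ≡ 2 * b + 2 * a
      lemma = solve-∀

    module _ {K N J : ℕ} {D : List (V r)} (0<K : 0 < K) (K<p : K < p) (p≤JK : p ≤ J * K)
      (spread : Spread N D) (nonempty : 0 < length D)
      (large : 2 * (N + K * (K * K * (N + N))) ≤ length D) where

      orbits : V r → V r → ℕ
      orbits l a = orbit (variation l) (variation-⊖ l) (variation-⊹ l) J (l ∙ a)

      -- For fixed a₀, w and s, each relation confines a to an affine hyperplane.
      relations-bound : ∀ l → l ≢ 𝟎 → ∑ D (λ a₀ → ∑ D (λ a → relations K (l ∙ a) (l ∙ a₀))) ≤ length D * (N + K * (K * K * (N + N)))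
      relations-bound l l≢𝟎 = begin
        ∑ D (λ a₀ → ∑ D (λ a → ⟦ l ∙ a₀ ≟ᶠ 0f ⟧ + pairs a₀ a)) ≡⟨ ∑-cong D (λ a₀ → ∑-+ D (λ a → ⟦ l ∙ a₀ ≟ᶠ 0f ⟧) (pairs a₀)) ⟩
        ∑ D (λ a₀ → ∑ D (λ a → ⟦ l ∙ a₀ ≟ᶠ 0f ⟧) + ∑ D (pairs a₀)) ≡⟨ ∑-+ D (λ a₀ → ∑ D (λ a → ⟦ l ∙ a₀ ≟ᶠ 0f ⟧)) (λ a₀ → ∑ D (pairs a₀)) ⟩
        ∑ D (λ a₀ → ∑ D (λ a → ⟦ l ∙ a₀ ≟ᶠ 0f ⟧)) + ∑ D (λ a₀ → ∑ D (pairs a₀)) ≤⟨ +-mono-≤ on-kernel (≤-trans (∑-mono D off-kernel) (≤-reflexive (∑-const D _))) ⟩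
        length D * N + length D * (K * (K * K * (N + N))) ≡⟨ *-distribˡ-+ (length D) N _ ⟨
        length D * (N + K * (K * K * (N + N))) ∎
        where
        related : V r → V r → ℕ → ℕ → ℕ
        related a₀ a w s = ⟦ ι (suc w) · (l ∙ a) ≟ᶠ ι s · (l ∙ a₀) ⟧ + ⟦ ι (suc w) · (l ∙ a) ≟ᶠ ⊖ (ι s · (l ∙ a₀)) ⟧
        pairs : V r → V r → ℕ
        pairs a₀ a = ∑ (range K) (λ w → ∑ (range (K * K)) (related a₀ a w))
        on-kernel : ∑ D (λ a₀ → ∑ D (λ a → ⟦ l ∙ a₀ ≟ᶠ 0f ⟧)) ≤ length D * N
        on-kernel = begin
          ∑ D (λ a₀ → ∑ D (λ a → ⟦ l ∙ a₀ ≟ᶠ 0f ⟧)) ≡⟨ ∑-cong D (λ a₀ → ∑-const D ⟦ l ∙ a₀ ≟ᶠ 0f ⟧) ⟩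
          ∑ D (λ a₀ → length D * ⟦ l ∙ a₀ ≟ᶠ 0f ⟧) ≡⟨ ∑-* D (length D) _ ⟩
          length D * ∑ D (λ a₀ → ⟦ l ∙ a₀ ≟ᶠ 0f ⟧) ≤⟨ *-monoʳ-≤ (length D) (spread l l≢𝟎 0f) ⟩
          length D * N ∎
        -- As 0 < `suc w` ≤ K < p, the multiple of l by `suc w` is again a nonzero functional, so
        -- the spread of D applies to it.
        scaled : ∀ w → w < K → ∀ c → ∑ D (λ a → ⟦ ι (suc w) · (l ∙ a) ≟ᶠ c ⟧) ≤ N
        scaled w w<K c = ≤-trans (≤-reflexive (∑-cong D (λ a → cong (λ t → ⟦ t ≟ᶠ c ⟧) (sym (scale-∙ (ι (suc w)) l a)))))
          (spread (scale (ι (suc w)) l) (scale-≢𝟎 (λ e → <⇒≱ (≤-<-trans w<K K<p) (∣⇒≤ (ι≡0⇒∣ e))) l≢𝟎) c)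
        off-kernel : ∀ a₀ → ∑ D (pairs a₀) ≤ K * (K * K * (N + N))
        off-kernel a₀ = begin
          ∑ D (λ a → ∑ (range K) (λ w → ∑ (range (K * K)) (related a₀ a w))) ≡⟨ ∑-swap D (range K) _ ⟩
          ∑ (range K) (λ w → ∑ D (λ a → ∑ (range (K * K)) (related a₀ a w))) ≡⟨ ∑-cong (range K) (λ w → ∑-swap D (range (K * K)) (λ a → related a₀ a w)) ⟩
          ∑ (range K) (λ w → ∑ (range (K * K)) (λ s → ∑ D (λ a → related a₀ a w s)))
            ≤⟨ ∑-mono∈ (range K) {g = λ _ → K * K * (N + N)} (λ {w} w∈ → ≤-trans (∑-mono (range (K * K)) {g = λ _ → N + N} (λ s → ≤-trans (≤-reflexive (∑-+ D (λ a → ⟦ ι (suc w) · (l ∙ a) ≟ᶠ ι s · (l ∙ a₀) ⟧) (λ a → ⟦ ι (suc w) · (l ∙ a) ≟ᶠ ⊖ (ι s · (l ∙ a₀)) ⟧)))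
                 (+-mono-≤ (scaled w (∈-range⇒< w∈) _) (scaled w (∈-range⇒< w∈) _)))) (≤-reflexive (∑-range-const (K * K) (N + N)))) ⟩
          ∑ (range K) (λ w → K * K * (N + N)) ≡⟨ ∑-range-const K _ ⟩
          K * (K * K * (N + N)) ∎

      -- `pair-bound` summed over all pairs from D. By `large` the term from pairs with relations is
      -- at most half of the left side and is absorbed there.
      total-bound : ∀ l → l ≢ 𝟎 → length D * (J * total l) ≤ 32 * p * ∑ D (orbits l)
      total-bound l l≢𝟎 = *-cancelˡ-≤ n ⦃ >-nonZero nonempty ⦄ (≤-by 0 (+-mono-≤ (*-monoʳ-≤ 2 pairs-sum) (*-monoʳ-≤ (n * T) large)) (combine n T p A M))
        where
        n = length D
        T = J * total l
        A = ∑ D (orbits l)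
        M = N + K * (K * K * (N + N))
        pairs-sum : n * (n * T) ≤ 16 * (p * (n * A)) + T * (n * M)
        pairs-sum = begin
          n * (n * T) ≡⟨ trans (∑-cong D (λ a₀ → ∑-const D T)) (∑-const D _) ⟨
          ∑ D (λ a₀ → ∑ D (λ a → T))
            ≤⟨ ∑-mono D (λ a₀ → ∑-mono D (λ a → pair-bound (variation l) (variation-⊖ l) (variation-⊹ l) J 0<K p≤JK (l ∙ a) (l ∙ a₀))) ⟩
          ∑ D (λ a₀ → ∑ D (λ a → 8 * p * (orbits l a + orbits l a₀) + T * relations K (l ∙ a) (l ∙ a₀)))
            ≡⟨ ∑-cong D (λ a₀ → trans (∑-+ D (λ a → 8 * p * (orbits l a + orbits l a₀)) (λ a → T * relations K (l ∙ a) (l ∙ a₀)))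
                 (cong₂ _+_ (trans (∑-* D (8 * p) _) (cong (8 * p *_) (trans (∑-+ D (orbits l) (λ a → orbits l a₀)) (cong (A +_) (∑-const D (orbits l a₀)))))) (∑-* D T (λ a → relations K (l ∙ a) (l ∙ a₀))))) ⟩
          ∑ D (λ a₀ → 8 * p * (A + n * orbits l a₀) + T * ∑ D (λ a → relations K (l ∙ a) (l ∙ a₀)))
            ≡⟨ trans (∑-+ D (λ a₀ → 8 * p * (A + n * orbits l a₀)) (λ a₀ → T * ∑ D (λ a → relations K (l ∙ a) (l ∙ a₀))))
                 (cong₂ _+_ (trans (∑-* D (8 * p) _) (cong (8 * p *_) (trans (∑-+ D (λ a₀ → A) (λ a₀ → n * orbits l a₀)) (cong₂ _+_ (∑-const D A) (∑-* D n (orbits l)))))) (∑-* D T _)) ⟩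
          8 * p * (n * A + n * A) + T * ∑ D (λ a₀ → ∑ D (λ a → relations K (l ∙ a) (l ∙ a₀))) ≤⟨ +-mono-≤ (≤-reflexive (double p (n * A))) (*-monoʳ-≤ T (relations-bound l l≢𝟎)) ⟩
          16 * (p * (n * A)) + T * (n * M) ∎
          where
          double : ∀ p a → 8 * p * (a + a) ≡ 16 * (p * a)
          double = solve-∀
        combine : ∀ n T p A M → n * (n * T) + (2 * (16 * (p * (n * A)) + T * (n * M)) + n * T * n) + 0 ≡
          n * (32 * p * A) + (2 * (n * (n * T)) + n * T * (2 * M))
        combine = solve-∀

      -- Exchange the sums, so that `variation-average` applies to each multiple k a with k < 2 J;
      -- its gain is at most 2 J times that of a.
      orbits-average : p * ∑ (vectors r) (λ l → ∑ D (orbits l)) ≤ (J + J) * (2 * (P * p ^ r * ((J + J) * ∑ D (gain Y))))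
      orbits-average = begin
        p * ∑ vs (λ l → ∑ D (orbits l)) ≡⟨ cong (p *_) (trans (∑-swap vs D _) (∑-cong D (λ a → ∑-swap vs (range (J + J)) (λ l k → variation l (ι k · (l ∙ a)))))) ⟩
        p * ∑ D (λ a → ∑ (range (J + J)) (λ k → ∑ vs (λ l → variation l (ι k · (l ∙ a)))))
          ≡⟨ trans (sym (∑-* D p _)) (∑-cong D (λ a → trans (sym (∑-* (range (J + J)) p _)) (∑-cong (range (J + J)) (λ k → average a k)))) ⟩
        ∑ D (λ a → ∑ (range (J + J)) (λ k → 2 * (B * gain Y (k ⋆ a)))) ≤⟨ ∑-mono D (λ a → ∑-mono∈ (range (J + J)) (λ {k} k∈ → *-monoʳ-≤ 2 (*-monoʳ-≤ B
             (≤-trans (gain-⋆ Y k a) (*-monoˡ-≤ (gain Y a) (<⇒≤ (∈-range⇒< k∈))))))) ⟩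
        ∑ D (λ a → ∑ (range (J + J)) (λ k → 2 * (B * ((J + J) * gain Y a)))) ≡⟨ ∑-cong D (λ a → trans (∑-range-const (J + J) _) (rearrange (J + J) B (gain Y a))) ⟩
        ∑ D (λ a → (J + J) * (2 * (B * (J + J))) * gain Y a) ≡⟨ ∑-* D ((J + J) * (2 * (B * (J + J)))) (gain Y) ⟩
        (J + J) * (2 * (B * (J + J))) * ∑ D (gain Y) ≡⟨ rearrange (J + J) B _ ⟨
        (J + J) * (2 * (B * ((J + J) * ∑ D (gain Y)))) ∎
        where
        vs = vectors r
        B = P * p ^ r
        rearrange : ∀ j b g → j * (2 * (b * (j * g))) ≡ j * (2 * (b * j)) * g
        rearrange = solve-∀
        average : ∀ a k → p * ∑ vs (λ l → variation l (ι k · (l ∙ a))) ≡ 2 * (B * gain Y (k ⋆ a))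
        average a k = trans (cong (p *_) (∑-cong vs (λ l → cong (variation l) (sym (∙-⋆ l k a))))) (variation-average (k ⋆ a))

      -- Sum `total-bound` over l ≠ 0. The zero functional carries only 2 P y² out of 2 P p^r y, at
      -- most half because 2 y ≤ p^r. The constant is 256 J² = 32 · 2J · 2 · 2J, divided by the J on
      -- the left.
      radon-average : 2 * y ≤ p ^ r → length D * y ≤ 256 * J * ∑ D (gain Y)
      radon-average small = *-cancelˡ-≤ (J * (P * Q)) ⦃ m*n≢0 J (P * Q) ⦃ J≢0 ⦄ ⦃ m*n≢0 P Q ⦃ >-nonZero (≤-pred 1<p) ⦄ ⦃ m^n≢0 p r ⦄ ⦄ ⦄
        (≤-by 0 (+-mono-≤ summed (*-monoʳ-≤ (n * J * P * y) small)) (combine n J P Q y (∑ D (gain Y))))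
        where
        n = length D
        Q = p ^ r
        J≢0 : NonZero J
        J≢0 = ≢-nonZero λ { refl → <⇒≱ (<⇒≤ 1<p) p≤JK }
        every : ∀ l → (d : Dec (l ≡ 𝟎)) → n * (J * total l) ≤ 32 * p * ∑ D (orbits l) + ⟦ d ⟧ * (n * (J * total 𝟎))
        every l (yes refl) = ≤-trans (≤-reflexive (sym (*-identityˡ _))) (m≤n+m _ (32 * p * ∑ D (orbits 𝟎)))
        every l (no l≢𝟎) = ≤-trans (total-bound l l≢𝟎) (m≤m+n _ _)
        summed : n * (J * (2 * (P * Q * y))) ≤ 32 * ((J + J) * (2 * (P * Q * ((J + J) * ∑ D (gain Y))))) + n * (J * (2 * (P * (y * y))))
        summed = begin
          n * (J * (2 * (P * Q * y))) ≡⟨ cong (λ t → n * (J * t)) ∑-total ⟨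
          n * (J * ∑ (vectors r) total) ≡⟨ trans (∑-* (vectors r) n _) (cong (n *_) (∑-* (vectors r) J total)) ⟨
          ∑ (vectors r) (λ l → n * (J * total l)) ≤⟨ ∑-mono (vectors r) (λ l → every l (l ≟ᵛ 𝟎)) ⟩
          ∑ (vectors r) (λ l → 32 * p * ∑ D (orbits l) + ⟦ l ≟ᵛ 𝟎 ⟧ * (n * (J * total 𝟎)))
            ≡⟨ ∑-+ (vectors r) (λ l → 32 * p * ∑ D (orbits l)) (λ l → ⟦ l ≟ᵛ 𝟎 ⟧ * (n * (J * total 𝟎))) ⟩
          ∑ (vectors r) (λ l → 32 * p * ∑ D (orbits l)) + ∑ (vectors r) (λ l → ⟦ l ≟ᵛ 𝟎 ⟧ * (n * (J * total 𝟎)))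
            ≡⟨ cong₂ _+_ (trans (∑-* (vectors r) (32 * p) _) (*-assoc 32 p _)) (trans (Enumeration.pick (vectorEnumeration r) 𝟎 (λ _ → n * (J * total 𝟎))) (cong (λ t → n * (J * t)) total-𝟎)) ⟩
          32 * (p * ∑ (vectors r) (λ l → ∑ D (orbits l))) + n * (J * (2 * (P * (y * y)))) ≤⟨ +-monoˡ-≤ _ (*-monoʳ-≤ 32 orbits-average) ⟩
          32 * ((J + J) * (2 * (P * Q * ((J + J) * ∑ D (gain Y))))) + n * (J * (2 * (P * (y * y)))) ∎
        combine : ∀ n J P Q y G → J * (P * Q) * (n * y) + (32 * ((J + J) * (2 * (P * Q * ((J + J) * G)))) + n * (J * (2 * (P * (y * y)))) + n * J * P * y * Q) + 0 ≡
          J * (P * Q) * (256 * J * G) + (n * (J * (2 * (P * Q * y))) + n * J * P * y * (2 * y))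
        combine = solve-∀

      radon-growth : 2 * y ≤ p ^ r → ∃ λ a → a ∈ D × y ≤ 256 * J * gain Y a
      radon-growth small = ∑-≤⇒∃ D nonempty (≤-trans (≤-reflexive (∑-const D y)) (≤-trans (radon-average small) (≤-reflexive (sym (∑-* D (256 * J) (gain Y))))))

-- Sets of subsequence sums and their stepwise enlargement.

module SubsetSums where
  open Summation
  open FiniteField
  open LinearAlgebra
  open BoxGrowth
  open import Data.Bool using (Bool; true; false; _∧_; _∨_; not)
  open import Data.Nat
  open import Data.Nat.Properties
  open import Data.Nat.Tactic.RingSolver using (solve-∀)
  open import Data.List using (List; []; _∷_; _++_; map; length)
  open import Data.List.Properties using (length-++; length-map)
  open import Data.List.Membership.Propositional using (_∈_)
  open import Data.List.Membership.Propositional.Properties using (∈-∃++; ∈-map⁻)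
  open import Data.List.Relation.Binary.Permutation.Propositional using (_↭_; ↭-refl; ↭-trans; prep; swap; module PermutationReasoning)
  open import Data.List.Relation.Binary.Permutation.Propositional.Properties using (++⁺ˡ; shift; ↭-length)
  open import Data.Product using (∃; _×_; _,_)
  open import Data.Sum using (_⊎_; inj₁; inj₂)
  open import Data.Empty using (⊥-elim)
  open import Function using (_∘_)
  open import Relation.Nullary
  open import Relation.Binary.PropositionalEquality

  module Stages {p : ℕ} (1<p : 1 < p) (𝔽 : PrimeField p) where
    open Translates 1<p 𝔽 public
    open ≤-Reasoning

    private variable
      r : ℕ
      A : Set

    vsum : (A → V r) → List A → V r
    vsum f [] = 𝟎
    vsum f (x ∷ xs) = f x ⊕ vsum f xs

    vsum-++ : (f : A → V r) (xs ys : List A) → vsum f (xs ++ ys) ≡ vsum f xs ⊕ vsum f ys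
    vsum-++ f [] ys = sym (⊕-identityˡ _)
    vsum-++ f (x ∷ xs) ys = trans (cong (f x ⊕_) (vsum-++ f xs ys)) (sym (⊕-assoc (f x) _ _))

    -- Each step spends two terms, exactly one of which enters every sum; so all elements of Y are sums of the same
    -- number k of terms, which finally allows blocks of exactly p terms.
    record Stage (f : A → V r) (T : List A) : Set where
      field
        k : ℕ
        Y : V r → Bool
        rest used : List A
        perm : T ↭ used ++ rest
        used-length : length used ≡ k + k
        reach : ∀ x → Y x ≡ true → ∃ λ cs → ∃ λ os → T ↭ cs ++ os ++ rest × length cs ≡ k × vsum f cs ≡ x

      rest-length : length T ≡ k + k + length rest
      rest-length = trans (↭-length perm) (trans (length-++ used) (cong (_+ length rest) used-length))

    open Stage public

    reached : {f : A → V r} {T : List A} → Stage f T → ℕ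
    reached S = card (Y S)

    initial : (f : A → V r) (T : List A) → Stage f T
    initial f T = record
      { k = 0 ; Y = λ x → does (x ≟ᵛ 𝟎) ; rest = T ; used = [] ; perm = ↭-refl ; used-length = refl
      ; reach = λ x e → [] , [] , ↭-refl , refl , sym (from-does x (x ≟ᵛ 𝟎) e) }
      where
      from-does : ∀ x (d : Dec (x ≡ 𝟎)) → does d ≡ true → x ≡ 𝟎
      from-does x (yes e) _ = e

    reached-initial : (f : A → V r) (T : List A) → reached (initial f T) ≡ 1
    reached-initial {r = r} f T = trans (∑-cong (vectors r) (λ x → lemma (x ≟ᵛ 𝟎))) (vectors-once r 𝟎)
      where
      lemma : {P : Set} (d : Dec P) → 𝟙 (does d) ≡ ⟦ d ⟧
      lemma (yes _) = refl
      lemma (no _) = refl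

    move : ∀ {s a : A} {rest rest′} cs os → rest ↭ s ∷ a ∷ rest′ → cs ++ os ++ rest ↭ (s ∷ cs) ++ (a ∷ os) ++ rest′
    move {s = s} {a} {rest} {rest′} cs os ρ = ↭-trans (++⁺ˡ cs (↭-trans (++⁺ˡ os ρ) (↭-trans (shift s os (a ∷ rest′)) (prep s (shift a os rest′)))))
      (shift s cs (a ∷ os ++ rest′))

    extend : {f : A → V r} {T : List A} (S : Stage f T) (s a : A) (rest′ : List A) → rest S ↭ s ∷ a ∷ rest′ → Stage f T
    extend {f = f} {T} S s a rest′ ρ = record
      { k = suc (k S) ; Y = λ x → Y S (x ⊕ ⊝ f s) ∨ Y S (x ⊕ ⊝ f a) ; rest = rest′ ; used = s ∷ a ∷ used S
      ; perm = ↭-trans (perm S) (↭-trans (++⁺ˡ (used S) ρ) (↭-trans (shift s (used S) (a ∷ rest′)) (prep s (shift a (used S) rest′))))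
      ; used-length = cong suc (trans (cong suc (used-length S)) (sym (+-suc (k S) (k S))))
      ; reach = λ x e → choose x (Y S (x ⊕ ⊝ f s)) refl e }
      where
      choose : ∀ x b → Y S (x ⊕ ⊝ f s) ≡ b → b ∨ Y S (x ⊕ ⊝ f a) ≡ true →
        ∃ λ cs → ∃ λ os → T ↭ cs ++ os ++ rest′ × length cs ≡ suc (k S) × vsum f cs ≡ x
      choose x true e _ =
        let cs , os , π , len , sum = reach S (x ⊕ ⊝ f s) e
        in s ∷ cs , a ∷ os , ↭-trans π (move cs os ρ) , cong suc len , trans (cong (f s ⊕_) sum) (trans (⊕-comm (f s) _) (x⊝d⊕d x (f s)))
      choose x false _ e =
        let cs , os , π , len , sum = reach S (x ⊕ ⊝ f a) e
        in a ∷ cs , s ∷ os , ↭-trans π (move cs os (↭-trans ρ (swap s a ↭-refl))) , cong suc len , trans (cong (f a ⊕_) sum) (trans (⊕-comm (f a) _) (x⊝d⊕d x (f a)))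

    -- Translated by -`f a`, the new set becomes Y ∪ (Y - d) with d = `f a` - `f s`; outside Y - d,
    -- exactly the points counted by the gain remain.
    reached-extend : {f : A → V r} {T : List A} (S : Stage f T) (s a : A) (rest′ : List A) (ρ : rest S ↭ s ∷ a ∷ rest′) →
      reached (extend S s a rest′ ρ) ≡ reached S + gain (Y S) (f a ⊕ ⊝ f s)
    reached-extend {r = r} {f} S s a rest′ ρ = begin-equality
      ∑ (vectors r) (λ x → 𝟙 (Y S (x ⊕ ⊝ f s) ∨ Y S (x ⊕ ⊝ f a))) ≡⟨ ∑-shift (λ x → 𝟙 (Y S (x ⊕ ⊝ f s) ∨ Y S (x ⊕ ⊝ f a))) (f a) ⟨
      ∑ (vectors r) (λ x → 𝟙 (Y S (x ⊕ f a ⊕ ⊝ f s) ∨ Y S (x ⊕ f a ⊕ ⊝ f a)))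
        ≡⟨ ∑-cong (vectors r) (λ x → trans (cong₂ (λ u v → 𝟙 (Y S u ∨ Y S v)) (⊕-assoc x (f a) (⊝ f s)) (x⊕d⊝d x (f a))) (lemma (Y S (x ⊕ d)) (Y S x))) ⟩
      ∑ (vectors r) (λ x → 𝟙 (Y S (x ⊕ d)) + 𝟙 (Y S x ∧ not (Y S (x ⊕ d)))) ≡⟨ ∑-+ (vectors r) (λ x → 𝟙 (Y S (x ⊕ d))) (λ x → 𝟙 (Y S x ∧ not (Y S (x ⊕ d)))) ⟩
      ∑ (vectors r) (λ x → 𝟙 (Y S (x ⊕ d))) + gain (Y S) d ≡⟨ cong (_+ gain (Y S) d) (∑-shift (𝟙 ∘ Y S) d) ⟩
      reached S + gain (Y S) d ∎
      where
      d = f a ⊕ ⊝ f s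
      lemma : ∀ b c → 𝟙 (b ∨ c) ≡ 𝟙 b + 𝟙 (c ∧ not b)
      lemma true true = refl
      lemma true false = refl
      lemma false true = refl
      lemma false false = refl

    -- Some pair of unused terms enlarges Y by a factor 1 + 1/B.
    Growable : (f : A → V r) (T : List A) (Q L B : ℕ) → Set
    Growable {A} f T Q L B = (S : Stage f T) → L ≤ length (rest S) → 2 * reached S ≤ Q →
      ∃ λ s → ∃ λ a → ∃ λ rest′ → rest S ↭ s ∷ a ∷ rest′ × reached S ≤ B * gain (Y S) (f a ⊕ ⊝ f s)

    -- Y never shrinks, so each step adds at least y₀ / B points; multiplying by B avoids fractions.
    -- A step uses up two terms, hence `n + n`.
    boost : {f : A → V r} {T : List A} {Q L B : ℕ} → Growable f T Q L B → ∀ y₀ n (S : Stage f T) → y₀ ≤ reached S →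
      L + (n + n) ≤ length (rest S) →
      ∃ λ (S′ : Stage f T) → k S′ ≤ k S + n × (Q < 2 * reached S′ ⊎ n * y₀ + B * reached S ≤ B * reached S′)
    boost g y₀ zero S y₀≤ enough = S , m≤m+n _ 0 , inj₂ ≤-refl
    boost {f = f} {T} {Q} {L} {B} g y₀ (suc n) S y₀≤ enough = by-cases (2 * reached S ≤? Q)
      where
      by-cases : Dec (2 * reached S ≤ Q) → ∃ λ (S′ : Stage f T) → k S′ ≤ k S + suc n × (Q < 2 * reached S′ ⊎ suc n * y₀ + B * reached S ≤ B * reached S′)
      by-cases (no big) = S , m≤m+n _ _ , inj₁ (≰⇒> big)
      by-cases (yes small) =
        let s , a , rest′ , ρ , le = g S (≤-trans (m≤m+n L _) enough) small
            S₁ = extend S s a rest′ ρ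
            G = gain (Y S) (f a ⊕ ⊝ f s)
            reached₁ = reached-extend S s a rest′ ρ
            S′ , k≤ , result = boost {B = B} g y₀ n S₁ (≤-trans y₀≤ (≤-trans (m≤m+n (reached S) G) (≤-reflexive (sym reached₁))))
              (+-cancelˡ-≤ 2 _ _ (≤-trans (≤-reflexive (count L n)) (≤-trans enough (≤-reflexive (↭-length ρ)))))
        in S′ , ≤-trans k≤ (≤-reflexive (sym (+-suc (k S) n))) , conclude (reached S₁) (reached S′) reached₁ le result
        where
        count : ∀ L n → 2 + (L + (n + n)) ≡ L + (suc n + suc n)
        count = solve-∀
        rearrange : ∀ n y₀ B s g → n * y₀ + (B * (s + g)) ≡ n * y₀ + B * s + B * g
        rearrange = solve-∀
        final : ∀ n y₀ B s → (1 + n) * y₀ + B * s ≡ n * y₀ + B * s + y₀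
        final = solve-∀
        conclude : ∀ {G} s₁ s′ → s₁ ≡ reached S + G → reached S ≤ B * G → (Q < 2 * s′ ⊎ n * y₀ + B * s₁ ≤ B * s′) → Q < 2 * s′ ⊎ suc n * y₀ + B * reached S ≤ B * s′
        conclude s₁ s′ e le (inj₁ q) = inj₁ q
        conclude {G} s₁ s′ refl le (inj₂ h) = inj₂ (begin
          suc n * y₀ + B * reached S ≡⟨ final n y₀ B (reached S) ⟩
          n * y₀ + B * reached S + y₀ ≤⟨ +-monoʳ-≤ (n * y₀ + B * reached S) (≤-trans y₀≤ le) ⟩
          n * y₀ + B * reached S + B * G ≡⟨ rearrange n y₀ B (reached S) G ⟨
          n * y₀ + B * (reached S + G) ≤⟨ h ⟩
          B * s′ ∎)

    SpreadOut : ℕ → (A → V r) → List A → Set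
    SpreadOut N f T = ∀ l → l ≢ 𝟎 → ∀ c → ∑ T (λ a → ⟦ l ∙ f a ≟ᶠ c ⟧) ≤ N

    spread-suffix : ∀ {N} {f : A → V r} {T xs ys} → T ↭ xs ++ ys → SpreadOut N f T → SpreadOut N f ys
    spread-suffix {f = f} {T} {xs} {ys} π sp l l≢𝟎 c = ≤-trans (m≤n+m _ (∑ xs g)) (≤-trans (≤-reflexive (trans (sym (∑-++ xs ys g)) (sym (∑-↭ g π)))) (sp l l≢𝟎 c))
      where g = λ a → ⟦ l ∙ f a ≟ᶠ c ⟧

    differences : (A → V r) → A → List A → List (V r)
    differences f s T = map (λ a → f a ⊕ ⊝ f s) T

    spread-differences : ∀ {N} {f : A → V r} {s T} → SpreadOut N f (s ∷ T) → Spread N (differences f s T)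
    spread-differences {f = f} {s} {T} sp l l≢𝟎 c = ≤-trans (≤-reflexive (trans (∑-map _ T _) (∑-cong T same)))
      (≤-trans (m≤n+m _ _) (sp l l≢𝟎 (c ⊹ l ∙ f s)))
      where
      expand : ∀ a → l ∙ (f a ⊕ ⊝ f s) ≡ l ∙ f a ⊹ ⊖ (l ∙ f s)
      expand a = trans (∙-⊕ l _ _) (cong (l ∙ f a ⊹_) (∙-⊝ l (f s)))
      same : ∀ a → ⟦ l ∙ (f a ⊕ ⊝ f s) ≟ᶠ c ⟧ ≡ ⟦ l ∙ f a ≟ᶠ c ⊹ l ∙ f s ⟧
      same a = ⟦⟧-cong
        (λ e → trans (trans (sym (⊹-identityʳ _)) (trans (cong (l ∙ f a ⊹_) (sym (⊖-inverseˡ (l ∙ f s)))) (sym (⊹-assoc _ _ _)))) (cong (_⊹ l ∙ f s) (trans (sym (expand a)) e)))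
        (λ e → trans (expand a) (trans (cong (_⊹ ⊖ (l ∙ f s)) e) (trans (⊹-assoc c _ _) (trans (cong (c ⊹_) (⊖-inverseʳ _)) (⊹-identityʳ c))))) (_ ≟ᶠ _) (_ ≟ᶠ _)

    growable : ∀ {N Q L B} {f : A → V r} {T} → SpreadOut N f T →
      (∀ D (Y : V r → Bool) → Spread N D → L ≤ length D → 2 * card Y ≤ Q → ∃ λ d → d ∈ D × card Y ≤ B * gain Y d) →
      Growable f T Q (suc L) B
    growable {L = L} {B} {f} {T} sp h S enough small = from (rest S) refl
      where
      from : ∀ ts → rest S ≡ ts → ∃ λ s → ∃ λ a → ∃ λ rest′ → rest S ↭ s ∷ a ∷ rest′ × reached S ≤ B * gain (Y S) (f a ⊕ ⊝ f s)
      from [] e = ⊥-elim (<⇒≱ {0} {suc L} z<s (subst (λ ts → suc L ≤ length ts) e enough))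
      from (s ∷ ts) e =
        let d , d∈ , le = h (differences f s ts) (Y S) (spread-differences {f = f} {s} {ts} (spread-suffix {ys = s ∷ ts} (subst (λ z → T ↭ used S ++ z) e (perm S)) sp))
              (≤-trans (≤-pred (subst (λ ts → suc L ≤ length ts) e enough)) (≤-reflexive (sym (length-map _ ts)))) small
            a , a∈ , d≡ = ∈-map⁻ (λ a → f a ⊕ ⊝ f s) d∈
            us , vs , ts≡ = ∈-∃++ a∈
        in s , a , us ++ vs , subst (_↭ s ∷ a ∷ us ++ vs) (sym (trans e (cong (s ∷_) ts≡))) (prep s (shift a us vs)) , subst (λ d → reached S ≤ B * gain (Y S) d) d≡ le

-- Zero-sum blocks of length p in dimension r over the prime field.

module PrimeBlocks where
  open Summation
  open FiniteField
  open LinearAlgebra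
  open BoxGrowth
  open PairCover
  open Radon
  open SubsetSums
  open import Data.Bool using (Bool; true; false)
  open import Data.Nat
  open import Data.Nat.Properties
  open import Data.Nat.DivMod using (_/_; m≡m%n+[m/n]*n; m%n<n; m/n*n≤m)
  open import Data.Nat.Divisibility using (∣⇒≤; n∣n)
  open import Data.Nat.Tactic.RingSolver using (solve-∀)
  open import Data.List using (List; []; _∷_; _++_; length; take; drop)
  open import Data.List.Properties using (length-++; length-take; take++drop≡id; ++-assoc)
  open import Data.List.Relation.Unary.All as All using (All; []; _∷_)
  open import Data.List.Relation.Unary.All.Properties using (++⁻ˡ)
  open import Data.List.Relation.Unary.Any using (Any; any?; satisfied)
  open import Data.List.Membership.Propositional using (_∈_; lose)
  open import Data.List.Relation.Binary.Permutation.Propositional using (_↭_; ↭-refl; ↭-sym; ↭-trans; ↭-reflexive; prep)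
  open import Data.List.Relation.Binary.Permutation.Propositional.Properties using (++⁺ˡ; ++⁺ʳ; shift; shifts; All-resp-↭)
  open import Data.Vec using ([]; _∷_)
  open import Data.Vec.Properties using (∷-injectiveˡ)
  open import Data.Product using (∃; _×_; _,_; proj₁; proj₂)
  open import Data.Sum using (_⊎_; inj₁; inj₂)
  open import Data.Empty using (⊥-elim)
  open import Function using (_∘_)
  open import Relation.Nullary
  open import Relation.Nullary.Decidable using (¬?; _×-dec_)
  open import Relation.Binary.PropositionalEquality hiding (J)

  private module Arithmetic where
    open ≤-Reasoning

    -- Search for the last i that fits; p rounds suffice because p < 2^p.
    dyadic : ∀ a p → 0 < a → a ≤ p → ∃ λ i → a * 2 ^ i ≤ p × p < a * 2 ^ suc i
    dyadic a p 0<a a≤p = search p 0 (≤-trans (≤-reflexive (*-identityʳ a)) a≤p) (subst (λ j → p < a * 2 ^ j) (sym (+-identityʳ p)) (<-≤-trans (n<2^n p) (m≤n*m (2 ^ p) a ⦃ >-nonZero 0<a ⦄)))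
      where
      n<2^n : ∀ n → n < 2 ^ n
      n<2^n zero = ≤-refl
      n<2^n (suc n) = begin-strict
        suc n <⟨ s≤s (n<2^n n) ⟩
        1 + 2 ^ n ≤⟨ +-mono-≤ (m^n>0 2 n) (m≤m+n (2 ^ n) 0) ⟩
        2 ^ suc n ∎
      search : ∀ fuel i → a * 2 ^ i ≤ p → p < a * 2 ^ (fuel + i) → ∃ λ i → a * 2 ^ i ≤ p × p < a * 2 ^ suc i
      search zero i le gt = ⊥-elim (<⇒≱ gt le)
      search (suc fuel) i le gt with a * 2 ^ suc i ≤? p
      ... | yes le′ = search fuel (suc i) le′ (subst (λ j → p < a * 2 ^ j) (sym (+-suc fuel i)) gt)
      ... | no ≰ = i , le , ≰⇒> ≰

    ^-distribʳ-* : ∀ k m n → (m * n) ^ k ≡ m ^ k * n ^ k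
    ^-distribʳ-* zero m n = refl
    ^-distribʳ-* (suc k) m n rewrite ^-distribʳ-* k m n = lemma m n (m ^ k) (n ^ k)
      where
      lemma : ∀ m n a b → m * n * (a * b) ≡ m * a * (n * b)
      lemma = solve-∀

    -- At most stepRate R * 2^i steps bring |Y| to 2^(i R).  When these take about p / 8 steps, the density of Y is at
    -- least 1 / boostFactor R, and by the choice of spreadOrder R the remaining growth fits into p / 8 further steps.
    abstract
      stepRate boostFactor spreadOrder : ℕ → ℕ
      stepRate R = 2 ^ R * (8 * R)
      boostFactor R = (16 * stepRate R) ^ R
      spreadOrder R = 16 * (256 * boostFactor R)

      stepRate-def : ∀ R → stepRate R ≡ 2 ^ R * (8 * R)
      stepRate-def R = refl

      boostFactor-def : ∀ R → boostFactor R ≡ (16 * stepRate R) ^ R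
      boostFactor-def R = refl

      spreadOrder-def : ∀ R → spreadOrder R ≡ 16 * (256 * boostFactor R)
      spreadOrder-def R = refl

    stepRate>0 : ∀ r → 0 < stepRate (suc r)
    stepRate>0 r = subst (0 <_) (sym (stepRate-def (suc r))) (*-mono-≤ (m^n>0 2 (suc r)) (*-mono-≤ {1} {8} (s≤s z≤n) (s≤s (z≤n {r}))))

    stepRate≤spreadOrder : ∀ r → 8 * stepRate (suc r) ≤ spreadOrder (suc r)
    stepRate≤spreadOrder r = begin
      8 * c ≤⟨ *-monoˡ-≤ c (m≤m+n 8 8) ⟩
      16 * c ≤⟨ m≤m*n (16 * c) ((16 * c) ^ r) ⦃ m^n≢0 (16 * c) r ⦃ >-nonZero (*-mono-≤ {1} {16} (s≤s z≤n) (stepRate>0 r)) ⦄ ⦄ ⟩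
      (16 * c) ^ suc r ≡⟨ boostFactor-def (suc r) ⟨
      H ≤⟨ m≤n*m H 256 ⟩
      256 * H ≤⟨ m≤n*m (256 * H) 16 ⟩
      16 * (256 * H) ≡⟨ spreadOrder-def (suc r) ⟨
      spreadOrder (suc r) ∎
      where
      c = stepRate (suc r)
      H = boostFactor (suc r)

    -- With K = 16 · 256 · H the left side is (K + q K) / 2. It is applied with q = p / K, where 256
    -- (q + 1) H is the number of steps in the dense phase.
    steps-bound : ∀ {K} p q H → K ≡ 16 * (256 * H) → K ≤ p → q * K ≤ p → 8 * (256 * suc q * H) ≤ p
    steps-bound p q H refl K≤p qK≤p = *-cancelˡ-≤ 2 (≤-by 0 (+-mono-≤ K≤p qK≤p) (lemma p q H))
      where
      lemma : ∀ p q H → 2 * (8 * (256 * (1 + q) * H)) + (p + p) + 0 ≡ 2 * p + (16 * (256 * H) + q * (16 * (256 * H)))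
      lemma = solve-∀

    -- The number of terms that the hypothesis `large` in the Radon argument asks for.
    reserve : ℕ → ℕ → ℕ
    reserve K N = 2 * (N + K * (K * K * (N + N)))

  open Arithmetic

  -- The name refers to Erdős, Ginzburg and Ziv. `reserve` is linear in its second argument, so for
  -- the threshold `egzConstant r * p` it is a multiple of p; the summand 4 pays for p + p further
  -- terms and two spare ones.
  egzConstant : ℕ → ℕ
  egzConstant zero = 1
  egzConstant (suc r) = reserve (spreadOrder (suc r)) (egzConstant r) + 4

  module PrimeCase {P : ℕ} (1<p : 1 < suc P) (𝔽 : PrimeField (suc P)) where
    open Stages 1<p 𝔽
    open ≤-Reasoning

    private
      p = suc P
      variable
        r : ℕ
        A : Set

    -- Passing from i to i + 1 takes 2^R B steps of relative growth 1 / B, which multiply |Y| by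
    -- 2^R. B is proportional to 2^i, so the numbers of steps form a geometric series.
    phase₁ : ∀ {N} {f : A → V (suc r)} {T} → SpreadOut N f T → ∀ i → 2 ^ suc i ≤ p →
      suc (suc N) + (stepRate (suc r) * 2 ^ i + stepRate (suc r) * 2 ^ i) ≤ length T →
      ∃ λ (S : Stage f T) → k S ≤ stepRate (suc r) * 2 ^ i × (2 ^ i) ^ suc r ≤ reached S
    phase₁ {r = r} {f = f} {T} sp zero le enough = initial f T , z≤n , ≤-reflexive (trans (^-zeroˡ (suc r)) (sym (reached-initial f T)))
    phase₁ {r = r} {N} {f} {T} sp (suc i) le enough = S′ , k-bound , size-bound (proj₂ (proj₂ boosted))
      where
      R = suc r
      c = stepRate R
      -- Twice the side to be reached: if growth stops because |Y| exceeds m^R / 2, then |Y| is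
      -- already at least (2^(i+1))^R.
      m = 2 ^ suc (suc i)
      B = 2 * R * m
      n = 2 ^ R * B
      y₀ = (2 ^ i) ^ R
      n≡ : n ≡ c * 2 ^ i
      n≡ = trans (lemma (2 ^ R) R (2 ^ i)) (cong (_* 2 ^ i) (sym (stepRate-def R)))
        where
        lemma : ∀ t R x → t * (2 * R * (2 * (2 * x))) ≡ t * (8 * R) * x
        lemma = solve-∀
      double : c * 2 ^ suc i ≡ c * 2 ^ i + c * 2 ^ i
      double = lemma c (2 ^ i)
        where
        lemma : ∀ c x → c * (2 * x) ≡ c * x + c * x
        lemma = solve-∀
      previous = phase₁ sp i (≤-trans (^-monoʳ-≤ 2 (n≤1+n (suc i))) le)
        (≤-trans (+-monoʳ-≤ (suc (suc N)) (+-mono-≤ half half)) enough)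
        where
        half : c * 2 ^ i ≤ c * 2 ^ suc i
        half = *-monoʳ-≤ c (^-monoʳ-≤ 2 (n≤1+n i))
      S = proj₁ previous
      k≤ = proj₁ (proj₂ previous)
      y₀≤ = proj₂ (proj₂ previous)
      enough′ : suc (suc N) + (n + n) ≤ length (rest S)
      enough′ = +-cancelˡ-≤ (k S + k S) _ _ (begin
        k S + k S + (suc (suc N) + (n + n)) ≤⟨ +-monoˡ-≤ _ (+-mono-≤ k≤ k≤) ⟩
        a + a + (suc (suc N) + (n + n)) ≡⟨ cong (λ n → a + a + (suc (suc N) + (n + n))) n≡ ⟩
        a + a + (suc (suc N) + (a + a)) ≡⟨ lemma a N ⟩
        suc (suc N) + ((a + a) + (a + a)) ≡⟨ cong (λ z → suc (suc N) + (z + z)) double ⟨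
        suc (suc N) + (c * 2 ^ suc i + c * 2 ^ suc i) ≤⟨ enough ⟩
        length T ≡⟨ rest-length S ⟩
        k S + k S + length (rest S) ∎)
        where
        a = c * 2 ^ i
        lemma : ∀ a N → a + a + (2 + N + (a + a)) ≡ 2 + N + ((a + a) + (a + a))
        lemma = solve-∀
      boosted = boost {B = B} (growable {Q = m ^ R} {L = suc N} {B = B} sp (λ D Y spD N<D small → box-growth spD N<D (m^n>0 2 (suc (suc i))) le Y small)) y₀ n S y₀≤ enough′
      S′ = proj₁ boosted
      k-bound : k S′ ≤ c * 2 ^ suc i
      k-bound = ≤-trans (proj₁ (proj₂ boosted)) (≤-trans (+-mono-≤ k≤ (≤-reflexive n≡)) (≤-reflexive (sym double)))
      size-bound : (m ^ R < 2 * reached S′ ⊎ n * y₀ + B * reached S ≤ B * reached S′) → (2 ^ suc i) ^ R ≤ reached S′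
      size-bound (inj₁ lt) = *-cancelˡ-≤ 2 (begin
        2 * (2 ^ suc i) ^ R ≤⟨ *-monoˡ-≤ ((2 ^ suc i) ^ R) (m≤m*n 2 (2 ^ r) ⦃ m^n≢0 2 r ⦄) ⟩
        2 ^ R * (2 ^ suc i) ^ R ≡⟨ ^-distribʳ-* R 2 (2 ^ suc i) ⟨
        m ^ R ≤⟨ <⇒≤ lt ⟩
        2 * reached S′ ∎)
      size-bound (inj₂ h) = *-cancelˡ-≤ B ⦃ m*n≢0 (2 * R) m ⦃ _ ⦄ ⦃ m^n≢0 2 (suc (suc i)) ⦄ ⦄ (begin
        B * (2 * 2 ^ i) ^ R ≡⟨ cong (B *_) (^-distribʳ-* R 2 (2 ^ i)) ⟩
        B * (2 ^ R * y₀) ≡⟨ lemma B (2 ^ R) y₀ ⟩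
        n * y₀ ≤⟨ m≤m+n _ _ ⟩
        n * y₀ + B * reached S ≤⟨ h ⟩
        B * reached S′ ∎)
        where
        lemma : ∀ B t y → B * (t * y) ≡ t * B * y
        lemma = solve-∀

    -- Unless half of the space is exceeded before, B H steps add at least y₀ / B points each, hence
    -- H y₀ ≥ p^r in all.
    phase₂ : ∀ {N K J H} {f : A → V r} {T} → SpreadOut N f T → 0 < K → K < p → p ≤ J * K →
      (S₁ : Stage f T) → p ^ r ≤ H * reached S₁ → suc (suc (reserve K N)) + (256 * J * H + 256 * J * H) ≤ length (rest S₁) →
      ∃ λ (S₂ : Stage f T) → k S₂ ≤ k S₁ + 256 * J * H × p ^ r < 2 * reached S₂
    phase₂ {r = r} {N} {K} {J} {H} {f} {T} sp 0<K K<p p≤JK S₁ p^r≤ enough =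
      conclude (boost {B = B} (growable {Q = p ^ r} {L = suc (reserve K N)} {B = B} sp grow) (reached S₁) (B * H) S₁ ≤-refl enough)
      where
      B = 256 * J
      J≢0 : NonZero J
      J≢0 = ≢-nonZero λ { refl → <⇒≱ (<⇒≤ 1<p) p≤JK }
      grow : ∀ D (Y : V r → Bool) → Spread N D → suc (reserve K N) ≤ length D → 2 * card Y ≤ p ^ r → ∃ λ d → d ∈ D × card Y ≤ B * gain Y d
      grow D Y spD M<D small = Marginals.radon-growth 1<p 𝔽 Y {K = K} {J = J} 0<K K<p p≤JK spD (<-≤-trans z<s M<D) (<⇒≤ M<D) small
      size-bound : ∀ s → (p ^ r < 2 * s ⊎ B * H * reached S₁ + B * reached S₁ ≤ B * s) → p ^ r < 2 * s
      size-bound s (inj₁ lt) = lt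
      size-bound s (inj₂ h) = <-≤-trans (m<m+n (p ^ r) (m^n>0 p r)) (≤-trans (+-mono-≤ big big) (≤-reflexive (cong (s +_) (sym (+-identityʳ s)))))
        where
        big : p ^ r ≤ s
        big = ≤-trans p^r≤ (*-cancelˡ-≤ B ⦃ m*n≢0 256 J ⦃ _ ⦄ ⦃ J≢0 ⦄ ⦄ (≤-trans (≤-reflexive (sym (*-assoc B H (reached S₁)))) (≤-trans (m≤m+n _ _) h)))
      conclude : (∃ λ (S₂ : Stage f T) → k S₂ ≤ k S₁ + B * H × (p ^ r < 2 * reached S₂ ⊎ B * H * reached S₁ + B * reached S₁ ≤ B * reached S₂)) →
        ∃ λ (S₂ : Stage f T) → k S₂ ≤ k S₁ + 256 * J * H × p ^ r < 2 * reached S₂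
      conclude (S₂ , k≤ , result) = S₂ , k≤ , size-bound (reached S₂) result

    -- Each phase gets p / 8 steps. The largest i with 8 c 2^i ≤ p satisfies p < 16 c 2^i, so the
    -- first phase ends with density at least 1 / H for H = (16 c)^R.
    round : ∀ {N} {f : A → V (suc r)} {T} → SpreadOut N f T → spreadOrder (suc r) < p →
      suc (suc (reserve (spreadOrder (suc r)) N)) + p ≤ length T →
      ∃ λ (S : Stage f T) → 4 * k S ≤ p × p ^ suc r < 2 * reached S
    round {r = r} {N} {f} {T} sp K<p enough = proj₁ second , k-bound , proj₂ (proj₂ second)
      where
      R = suc r
      c = stepRate R
      H = boostFactor R
      K = spreadOrder R
      0<K : 0 < K
      0<K = <-≤-trans (*-mono-≤ {1} {8} (s≤s z≤n) (stepRate>0 r)) (stepRate≤spreadOrder r)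
      instance
        K≢0 : NonZero K
        K≢0 = >-nonZero 0<K
      -- The quotient rounded up, so that p ≤ J K.
      J = suc (p / K)
      p≤JK : p ≤ J * K
      p≤JK = ≤-trans (≤-reflexive (m≡m%n+[m/n]*n p K)) (+-monoˡ-≤ _ (<⇒≤ (m%n<n p K)))
      dy = dyadic (8 * c) p (*-mono-≤ {1} {8} (s≤s z≤n) (stepRate>0 r)) (≤-trans (stepRate≤spreadOrder r) (<⇒≤ K<p))
      i = proj₁ dy
      n₁ = c * 2 ^ i
      n₂ = 256 * J * H
      n₁≤ : 8 * n₁ ≤ p
      n₁≤ = ≤-trans (≤-reflexive (sym (*-assoc 8 c _))) (proj₁ (proj₂ dy))
      n₂≤ : 8 * n₂ ≤ p
      n₂≤ = steps-bound p (p / K) H (spreadOrder-def R) (<⇒≤ K<p) (m/n*n≤m p K)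
      four : ∀ {k} → k ≤ n₁ + n₂ → 4 * k ≤ p
      four {k} le = *-cancelˡ-≤ 2 (begin
        2 * (4 * k) ≤⟨ *-monoʳ-≤ 2 (*-monoʳ-≤ 4 le) ⟩
        2 * (4 * (n₁ + n₂)) ≡⟨ lemma n₁ n₂ ⟩
        8 * n₁ + 8 * n₂ ≤⟨ +-mono-≤ n₁≤ n₂≤ ⟩
        p + p ≡⟨ cong (p +_) (+-identityʳ p) ⟨
        2 * p ∎)
        where
        lemma : ∀ a b → 2 * (4 * (a + b)) ≡ 8 * a + 8 * b
        lemma = solve-∀
      within : n₁ + n₁ + (n₂ + n₂) ≤ p
      within = begin
        n₁ + n₁ + (n₂ + n₂) ≤⟨ m≤m+n _ _ ⟩
        n₁ + n₁ + (n₂ + n₂) + 2 * (n₁ + n₂) ≡⟨ lemma n₁ n₂ ⟩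
        4 * (n₁ + n₂) ≤⟨ four ≤-refl ⟩
        p ∎
        where
        lemma : ∀ a b → a + a + (b + b) + 2 * (a + b) ≡ 4 * (a + b)
        lemma = solve-∀
      M = reserve K N
      N≤M : N ≤ M
      N≤M = ≤-trans (m≤m+n N _) (m≤n*m (N + K * (K * K * (N + N))) 2)
      two≤p : 2 ^ suc i ≤ p
      two≤p = begin
        2 * 2 ^ i ≤⟨ *-monoˡ-≤ (2 ^ i) (≤-trans (m≤m+n 2 6) (m≤m*n 8 c ⦃ >-nonZero (stepRate>0 r) ⦄)) ⟩
        8 * c * 2 ^ i ≤⟨ proj₁ (proj₂ dy) ⟩
        p ∎
      first = phase₁ sp i two≤p (≤-trans (+-mono-≤ (s≤s (s≤s N≤M)) (≤-trans (m≤m+n (n₁ + n₁) _) within)) enough)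
      S₁ = proj₁ first
      k₁≤ = proj₁ (proj₂ first)
      y₀ = reached S₁
      p^R≤ : p ^ R ≤ H * y₀
      p^R≤ = begin
        p ^ R ≤⟨ ^-monoˡ-≤ R (≤-trans (<⇒≤ (proj₂ (proj₂ dy))) (≤-reflexive (lemma c (2 ^ i)))) ⟩
        (16 * c * 2 ^ i) ^ R ≡⟨ ^-distribʳ-* R (16 * c) (2 ^ i) ⟩
        (16 * c) ^ R * (2 ^ i) ^ R ≡⟨ cong (_* (2 ^ i) ^ R) (boostFactor-def R) ⟨
        H * (2 ^ i) ^ R ≤⟨ *-monoʳ-≤ H (proj₂ (proj₂ first)) ⟩
        H * y₀ ∎
        where
        lemma : ∀ c x → 8 * c * (2 * x) ≡ 16 * c * x
        lemma = solve-∀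
      enough′ : suc (suc M) + (n₂ + n₂) ≤ length (rest S₁)
      enough′ = +-cancelˡ-≤ (k S₁ + k S₁) _ _ (begin
        k S₁ + k S₁ + (suc (suc M) + (n₂ + n₂)) ≤⟨ +-monoˡ-≤ _ (+-mono-≤ k₁≤ k₁≤) ⟩
        n₁ + n₁ + (suc (suc M) + (n₂ + n₂)) ≡⟨ lemma n₁ n₂ M ⟩
        suc (suc M) + (n₁ + n₁ + (n₂ + n₂)) ≤⟨ +-monoʳ-≤ (suc (suc M)) within ⟩
        suc (suc M) + p ≤⟨ enough ⟩
        length T ≡⟨ rest-length S₁ ⟩
        k S₁ + k S₁ + length (rest S₁) ∎)
        where
        lemma : ∀ a b M → a + a + (2 + M + (b + b)) ≡ 2 + M + (a + a + (b + b))
        lemma = solve-∀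
      second = phase₂ {K = K} {J = J} {H = H} sp 0<K K<p p≤JK S₁ p^R≤ enough′
      k-bound : 4 * k (proj₁ second) ≤ p
      k-bound = four (≤-trans (proj₁ (proj₂ second)) (+-monoˡ-≤ n₂ k₁≤))

    reflect : V r → V r → V r
    reflect w x = ⊝ (x ⊕ w)

    reflect-sum : (w x : V r) → x ⊕ (reflect w x ⊕ w) ≡ 𝟎
    reflect-sum w x = trans (cong (x ⊕_) (⊕-comm _ w)) (trans (sym (⊕-assoc x w _)) (⊕-inverseʳ (x ⊕ w)))

    reflect-involutive : (w x : V r) → reflect w (reflect w x) ≡ x
    reflect-involutive w x = trans (sym (⊕-identityˡ _)) (trans (cong (_⊕ reflect w (reflect w x)) (sym (reflect-sum w x)))
      (trans (⊕-assoc x _ _) (trans (cong (x ⊕_) (⊕-inverseʳ _)) (⊕-identityʳ x))))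

    -- `Y₁` and the image of `Y₂` under the involution x ↦ -(x + w) each fill more than half of the
    -- space, so they intersect.
    meet : (Y₁ Y₂ : V r → Bool) → p ^ r < 2 * card Y₁ → p ^ r < 2 * card Y₂ → ∀ w → ∃ λ x → Y₁ x ≡ true × Y₂ (reflect w x) ≡ true
    meet {r} Y₁ Y₂ big₁ big₂ w = conclude (Enumeration.∑els-<⇒∃ (vectorEnumeration r) {λ _ → 1} {hits} crowded)
      where
      hits : V r → ℕ
      hits x = 𝟙 (Y₁ x) + 𝟙 (Y₂ (reflect w x))
      total : ∑ (vectors r) hits ≡ card Y₁ + card Y₂
      total = trans (∑-+ (vectors r) (𝟙 ∘ Y₁) (λ x → 𝟙 (Y₂ (reflect w x))))
        (cong (card Y₁ +_) (Enumeration.reindex (vectorEnumeration r) (reflect w) (reflect w) (reflect-involutive w) (reflect-involutive w) (𝟙 ∘ Y₂)))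
      average : ∀ Q a b → Q < 2 * a → Q < 2 * b → Q < a + b
      average Q a b lt₁ lt₂ = *-cancelˡ-< 2 Q (a + b) (<-≤-trans (≤-<-trans (≤-reflexive (cong (Q +_) (+-identityʳ Q))) (+-mono-< lt₁ lt₂))
        (≤-reflexive (sym (*-distribˡ-+ 2 a b))))
      crowded : ∑ (vectors r) (λ _ → 1) < ∑ (vectors r) hits
      crowded = ≤-<-trans (≤-reflexive (∑-vectors-1 r)) (<-≤-trans (average (p ^ r) (card Y₁) (card Y₂) big₁ big₂) (≤-reflexive (sym total)))
      both : ∀ a b → 1 < 𝟙 a + 𝟙 b → a ≡ true × b ≡ true
      both true true _ = refl , refl
      both true false (s≤s ())
      both false true (s≤s ())
      both false false ()
      conclude : (∃ λ x → 1 < hits x) → ∃ λ x → Y₁ x ≡ true × Y₂ (reflect w x) ≡ true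
      conclude (x , lt) = x , both (Y₁ x) (Y₂ (reflect w x)) lt

    ZeroSumBlock : (A → V r) → List A → Set
    ZeroSumBlock f T = ∃ λ ys → ∃ λ zs → T ↭ ys ++ zs × length ys ≡ p × vsum f ys ≡ 𝟎

    quarter : ∀ k → 4 * k ≤ p → (k + k) + (k + k) ≤ p
    quarter k le = ≤-trans (≤-reflexive (lemma k)) le
      where
      lemma : ∀ k → (k + k) + (k + k) ≡ 4 * k
      lemma = solve-∀

    join : {f : A → V r} {T : List A} (S₁ : Stage f T) (S₂ : Stage f (rest S₁)) → 4 * k S₁ ≤ p → 4 * k S₂ ≤ p →
      p ^ r < 2 * reached S₁ → p ^ r < 2 * reached S₂ → p + p ≤ length T → ZeroSumBlock f T
    join {A = A} {r = r} {f} {T} S₁ S₂ 4k₁≤ 4k₂≤ big₁ big₂ enough =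
      cs₁ ++ cs₂ ++ filler , os₁ ++ os₂ ++ leftover , arrangement , block-length , block-sum
      where
      k₁ = k S₁
      k₂ = k S₂
      2k₁≤ = quarter k₁ 4k₁≤
      2k₂≤ = quarter k₂ 4k₂≤
      k≤p : k₁ + k₂ ≤ p
      k≤p = *-cancelˡ-≤ 2 (begin
        2 * (k₁ + k₂) ≡⟨ lemma k₁ k₂ ⟩
        (k₁ + k₁) + (k₂ + k₂) ≤⟨ +-mono-≤ (≤-trans (m≤m+n (k₁ + k₁) _) 2k₁≤) (≤-trans (m≤m+n (k₂ + k₂) _) 2k₂≤) ⟩
        p + p ≡⟨ cong (p +_) (+-identityʳ p) ⟨
        2 * p ∎)
        where
        lemma : ∀ a b → 2 * (a + b) ≡ a + a + (b + b)
        lemma = solve-∀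
      j = p ∸ (k₁ + k₂)
      filler = take j (rest S₂)
      leftover = drop j (rest S₂)
      j≤ : j ≤ length (rest S₂)
      j≤ = m≤n+o⇒m∸n≤o p (k₁ + k₂) (+-cancelˡ-≤ (k₁ + k₂) _ _ (begin
        k₁ + k₂ + p ≤⟨ +-monoˡ-≤ p k≤p ⟩
        p + p ≤⟨ enough ⟩
        length T ≡⟨ trans (rest-length S₁) (cong (k₁ + k₁ +_) (rest-length S₂)) ⟩
        k₁ + k₁ + (k₂ + k₂ + length (rest S₂)) ≡⟨ lemma k₁ k₂ _ ⟩
        k₁ + k₂ + (k₁ + k₂ + length (rest S₂)) ∎))
        where
        lemma : ∀ a b c → a + a + (b + b + c) ≡ a + b + (a + b + c)
        lemma = solve-∀
      w = vsum f filler
      target = meet (Y S₁) (Y S₂) big₁ big₂ w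
      x = proj₁ target
      reach₁ = reach S₁ x (proj₁ (proj₂ target))
      reach₂ = reach S₂ (reflect w x) (proj₂ (proj₂ target))
      cs₁ = proj₁ reach₁
      os₁ = proj₁ (proj₂ reach₁)
      cs₂ = proj₁ reach₂
      os₂ = proj₁ (proj₂ reach₂)
      interleave : ∀ (as bs cs ds : List A) → as ++ bs ++ cs ++ ds ↭ (as ++ cs) ++ bs ++ ds
      interleave as bs cs ds = ↭-trans (++⁺ˡ as (shifts bs cs)) (↭-reflexive (sym (++-assoc as cs (bs ++ ds))))
      arrangement : T ↭ (cs₁ ++ cs₂ ++ filler) ++ os₁ ++ os₂ ++ leftover
      arrangement = ↭-trans (proj₁ (proj₂ (proj₂ reach₁))) (↭-trans (++⁺ˡ cs₁ (++⁺ˡ os₁ (↭-trans (proj₁ (proj₂ (proj₂ reach₂)))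
        (↭-trans (↭-reflexive (cong (λ z → cs₂ ++ os₂ ++ z) (sym (take++drop≡id j (rest S₂))))) (interleave cs₂ os₂ filler leftover)))))
        (interleave cs₁ os₁ (cs₂ ++ filler) (os₂ ++ leftover)))
      block-length : length (cs₁ ++ cs₂ ++ filler) ≡ p
      block-length = begin-equality
        length (cs₁ ++ cs₂ ++ filler) ≡⟨ trans (length-++ cs₁) (cong (length cs₁ +_) (length-++ cs₂)) ⟩
        length cs₁ + (length cs₂ + length filler)
          ≡⟨ cong₂ _+_ (proj₁ (proj₂ (proj₂ (proj₂ reach₁)))) (cong₂ _+_ (proj₁ (proj₂ (proj₂ (proj₂ reach₂)))) (trans (length-take j (rest S₂)) (m≤n⇒m⊓n≡m j≤))) ⟩
        k₁ + (k₂ + j) ≡⟨ +-assoc k₁ k₂ j ⟨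
        k₁ + k₂ + j ≡⟨ m+[n∸m]≡n k≤p ⟩
        p ∎
      block-sum : vsum f (cs₁ ++ cs₂ ++ filler) ≡ 𝟎
      block-sum = trans (trans (vsum-++ f cs₁ _) (cong₂ _⊕_ (proj₂ (proj₂ (proj₂ (proj₂ reach₁))))
        (trans (vsum-++ f cs₂ filler) (cong (_⊕ w) (proj₂ (proj₂ (proj₂ (proj₂ reach₂)))))))) (reflect-sum w x)

    -- A second round is run on the terms left over by the first, which uses at most p of them and
    -- leaves the spread intact.
    spread-block : ∀ {N} {f : A → V (suc r)} {T} → SpreadOut N f T → spreadOrder (suc r) < p →
      suc (suc (reserve (spreadOrder (suc r)) N)) + (p + p) ≤ length T → ZeroSumBlock f T
    spread-block {r = r} {N} {f} {T} sp K<p enough = continue (round sp K<p (≤-trans (+-monoʳ-≤ M (m≤m+n p p)) enough))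
      where
      M = suc (suc (reserve (spreadOrder (suc r)) N))
      finish : (S₁ : Stage f T) → 4 * k S₁ ≤ p → p ^ suc r < 2 * reached S₁ →
        (∃ λ (S₂ : Stage f (rest S₁)) → 4 * k S₂ ≤ p × p ^ suc r < 2 * reached S₂) → ZeroSumBlock f T
      finish S₁ 4k₁≤ big₁ (S₂ , 4k₂≤ , big₂) = join S₁ S₂ 4k₁≤ 4k₂≤ big₁ big₂ (≤-trans (m≤n+m (p + p) M) enough)
      continue : (∃ λ (S₁ : Stage f T) → 4 * k S₁ ≤ p × p ^ suc r < 2 * reached S₁) → ZeroSumBlock f T
      continue (S₁ , 4k₁≤ , big₁) = finish S₁ 4k₁≤ big₁ (round (spread-suffix {xs = used S₁} {ys = rest S₁} (perm S₁) sp) K<p (+-cancelˡ-≤ (k S₁ + k S₁) _ _ (begin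
        k S₁ + k S₁ + (M + p) ≡⟨ +-comm (k S₁ + k S₁) (M + p) ⟩
        M + p + (k S₁ + k S₁) ≤⟨ +-monoʳ-≤ (M + p) (≤-trans (m≤m+n (k S₁ + k S₁) _) (quarter (k S₁) 4k₁≤)) ⟩
        M + p + p ≡⟨ +-assoc M p p ⟩
        M + (p + p) ≤⟨ enough ⟩
        length T ≡⟨ rest-length S₁ ⟩
        k S₁ + k S₁ + length (rest S₁) ∎)))

    on-hyperplane : (l : V r) (c : F) (f : A → V r) (T : List A) →
      ∃ λ ins → ∃ λ outs → T ↭ ins ++ outs × All (λ a → l ∙ f a ≡ c) ins × length ins ≡ ∑ T (λ a → ⟦ l ∙ f a ≟ᶠ c ⟧)
    on-hyperplane l c f [] = [] , [] , ↭-refl , [] , refl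
    on-hyperplane {A = A} l c f (a ∷ T) = add (l ∙ f a ≟ᶠ c) (on-hyperplane l c f T)
      where
      add : (d : Dec (l ∙ f a ≡ c)) → (∃ λ ins → ∃ λ outs → T ↭ ins ++ outs × All (λ a → l ∙ f a ≡ c) ins × length ins ≡ ∑ T (λ a → ⟦ l ∙ f a ≟ᶠ c ⟧)) →
        ∃ λ ins → ∃ λ outs → a ∷ T ↭ ins ++ outs × All (λ a → l ∙ f a ≡ c) ins × length ins ≡ ⟦ d ⟧ + ∑ T (λ a → ⟦ l ∙ f a ≟ᶠ c ⟧)
      add (yes e) (ins , outs , π , all , len) = a ∷ ins , outs , prep a π , e ∷ all , cong suc len
      add (no _) (ins , outs , π , all , len) = ins , a ∷ outs , ↭-trans (prep a π) (↭-sym (shift a ins outs)) , all , len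

    ∙-vsum : (l : V r) (c : F) (f : A → V r) {ys : List A} → All (λ a → l ∙ f a ≡ c) ys → l ∙ vsum f ys ≡ ι (length ys) · c
    ∙-vsum l c f [] = trans (∙-𝟎 l) (sym (trans (cong (_· c) ι-0) (·-zeroˡ c)))
    ∙-vsum l c f {a ∷ ys} (e ∷ all) = trans (∙-⊕ l _ _) (trans (cong₂ _⊹_ (trans e (sym (trans (cong (_· c) ι-1) (·-identityˡ c)))) (∙-vsum l c f all))
      (trans (sym (·-distribʳ c (ι 1) _)) (cong (_· c) (sym (ι-+ 1 (length ys))))))

    vsum-additive : ∀ {s} (π : V r → V s) → (∀ x y → π (x ⊕ y) ≡ π x ⊕ π y) → (f : A → V r) (ys : List A) → π (vsum f ys) ≡ vsum (π ∘ f) ys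
    vsum-additive π π-⊕ f [] = trans (sym (x⊕d⊝d (π 𝟎) (π 𝟎))) (trans (cong (_⊕ ⊝ π 𝟎) (trans (sym (π-⊕ 𝟎 𝟎)) (cong π (⊕-identityˡ 𝟎)))) (⊕-inverseʳ (π 𝟎)))
    vsum-additive π π-⊕ f (y ∷ ys) = trans (π-⊕ _ _) (cong (π (f y) ⊕_) (vsum-additive π π-⊕ f ys))

    -- On the affine hyperplane l · x = c, any p terms have a sum in the kernel of l, because p c =
    -- 0. It is therefore enough that the projected sum vanishes.
    hyperplane-block : ∀ {N} → (∀ {A : Set} (f : A → V r) T → N ≤ length T → ZeroSumBlock f T) →
      ∀ l → l ≢ 𝟎 → ∀ c (f : A → V (suc r)) T → N ≤ ∑ T (λ a → ⟦ l ∙ f a ≟ᶠ c ⟧) → ZeroSumBlock f T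
    hyperplane-block block l l≢𝟎 c f T dense =
      let ins , outs , π , all , len = on-hyperplane l c f T
          proj , proj-⊕ , ker = hyperplane-projection l l≢𝟎
          ys , zs , ρ , ys-length , ys-sum = block (proj ∘ f) ins (≤-trans dense (≤-reflexive (sym len)))
          ys-all = ++⁻ˡ ys (All-resp-↭ ρ all)
      in ys , zs ++ outs , ↭-trans π (↭-trans (++⁺ʳ outs ρ) (↭-reflexive (++-assoc ys zs outs))) , ys-length ,
         ker (vsum f ys) (trans (∙-vsum l c f ys-all) (trans (cong (_· c) (trans (cong ι ys-length) (∣⇒ι≡0 n∣n))) (·-zeroˡ c)))
           (trans (vsum-additive proj proj-⊕ f ys) ys-sum)

    first-functional : V (suc r)
    first-functional = 1f ∷ 𝟎

    first-functional≢𝟎 : first-functional {r} ≢ 𝟎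
    first-functional≢𝟎 e = <⇒≱ 1<p (∣⇒≤ (ι≡0⇒∣ (trans ι-1 (∷-injectiveˡ e))))

    -- The p parallel hyperplanes of a single nonzero functional contain all terms.
    spread-length : ∀ {N} {f : A → V (suc r)} {T} → SpreadOut N f T → length T ≤ p * N
    spread-length {N = N} {f} {T} sp = begin
      length T ≡⟨ ∑-1 T ⟨
      ∑ T (λ _ → 1) ≡⟨ ∑-cong T (λ a → scalars-once (l ∙ f a)) ⟨
      ∑ T (λ a → ∑ scalars (λ c → ⟦ c ≟ᶠ l ∙ f a ⟧)) ≡⟨ ∑-swap T scalars _ ⟩
      ∑ scalars (λ c → ∑ T (λ a → ⟦ c ≟ᶠ l ∙ f a ⟧)) ≡⟨ ∑-cong scalars (λ c → ∑-cong T (λ a → ⟦⟧-cong sym sym (c ≟ᶠ l ∙ f a) (l ∙ f a ≟ᶠ c))) ⟩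
      ∑ scalars (λ c → ∑ T (λ a → ⟦ l ∙ f a ≟ᶠ c ⟧)) ≤⟨ ∑-mono scalars (sp l first-functional≢𝟎) ⟩
      ∑ scalars (λ c → N) ≡⟨ ∑-scalars-const N ⟩
      p * N ∎
      where l = first-functional

    -- If all hyperplane counts are at most N, then length T ≤ p N, which forces p to be large.
    egz : ∀ r {A : Set} (f : A → V r) (T : List A) → egzConstant r * p ≤ length T → ZeroSumBlock f T
    egz zero f T enough = take p T , drop p T , ↭-reflexive (sym (take++drop≡id p T)) ,
      trans (length-take p T) (m≤n⇒m⊓n≡m (≤-trans (≤-reflexive (sym (+-identityʳ p))) enough)) , trivial (vsum f (take p T))
      where
      trivial : (x : V 0) → x ≡ 𝟎
      trivial [] = refl
    egz (suc r) {A} f T enough = dispatch (any? (λ l → any? (λ c → ¬? (l ≟ᵛ 𝟎) ×-dec N ≤? count l c) scalars) (vectors (suc r)))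
      where
      C = egzConstant r
      K = spreadOrder (suc r)
      -- The number of terms on one hyperplane from which the induction hypothesis yields a block.
      N = C * p
      count : V (suc r) → F → ℕ
      count l c = ∑ T (λ a → ⟦ l ∙ f a ≟ᶠ c ⟧)
      Dense : V (suc r) → F → Set
      Dense l c = l ≢ 𝟎 × N ≤ count l c
      concentrated : (∃ λ l → ∃ λ c → Dense l c) → ZeroSumBlock f T
      concentrated (l , c , l≢𝟎 , many) = hyperplane-block (egz r) l l≢𝟎 c f T many
      dispatch : Dec (Any (λ l → Any (Dense l) scalars) (vectors (suc r))) → ZeroSumBlock f T
      dispatch (yes dense) = concentrated (proj₁ (satisfied dense) , satisfied (proj₂ (satisfied dense)))
      dispatch (no sparse) = spread-block sp K<p (≤-trans length-bound enough)
        where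
        sp : SpreadOut N f T
        sp l l≢𝟎 c = <⇒≤ (≰⇒> λ many → sparse (lose (Enumeration.complete (vectorEnumeration (suc r)) l) (lose (Enumeration.complete enumeration c) (l≢𝟎 , many))))
        length-bound : suc (suc (reserve K N)) + (p + p) ≤ egzConstant (suc r) * p
        length-bound = ≤-by (2 * P) (≤-refl {0}) (lemma K C P)
          where
          lemma : ∀ K C P → 2 + 2 * (C * (1 + P) + K * (K * K * (C * (1 + P) + C * (1 + P)))) + ((1 + P) + (1 + P)) + 0 + 2 * P
            ≡ (2 * (C + K * (K * K * (C + C))) + 4) * (1 + P) + 0
          lemma = solve-∀
        K<p : K < p
        K<p = *-cancelˡ-< C K p (*-cancelʳ-< (suc P) (C * K) (C * p) (begin-strict
          C * K * p <⟨ *-monoˡ-< p (CK< K C) ⟩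
          egzConstant (suc r) * p ≤⟨ enough ⟩
          length T ≤⟨ spread-length {N = N} {f = f} {T = T} sp ⟩
          p * N ≡⟨ *-comm p N ⟩
          C * p * p ∎))
          where
          CK< : ∀ K C → C * K < 2 * (C + K * (K * K * (C + C))) + 4
          CK< zero C = ≤-<-trans (≤-reflexive (*-zeroʳ C)) (<-≤-trans (z<s {3}) (m≤n+m 4 (2 * (C + 0))))
          CK< (suc K) C = begin-strict
            C * suc K ≡⟨ *-comm C (suc K) ⟩
            suc K * C ≤⟨ *-monoʳ-≤ (suc K) (≤-trans (m≤m+n C C) (m≤n*m (C + C) (suc K * suc K))) ⟩
            suc K * (suc K * suc K * (C + C)) ≤⟨ m≤n+m _ C ⟩
            C + suc K * (suc K * suc K * (C + C)) ≤⟨ m≤n*m _ 2 ⟩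
            2 * (C + suc K * (suc K * suc K * (C + C))) <⟨ m<m+n _ z<s ⟩
            2 * (C + suc K * (suc K * suc K * (C + C))) + 4 ∎

-- Olson's theorem for powers of a prime.

module Olson where
  open Summation
  open import Data.Nat as ℕ using (ℕ; zero; suc; z≤n; s≤s; z<s; _^_; _≤_; _<_)
  import Data.Nat.Properties as ℕ
  import Data.Nat.Divisibility as ℕ
  import Data.Nat.Tactic.RingSolver as ℕ
  open import Data.Nat.Primality using (Prime; euclidsLemma; prime⇒nonZero; prime⇒nonTrivial)
  open import Data.Integer using (ℤ; +_; 0ℤ; 1ℤ; _+_; _*_; _-_; -_)
  import Data.Integer.Properties as ℤ
  open import Data.Integer.Divisibility.Signed using (_∣_; divides; _∣?_; ∣ᵤ⇒∣; ∣⇒∣ᵤ; ∣m∣n⇒∣m+n; ∣m∣n⇒∣m-n; ∣m⇒∣m*n; ∣n⇒∣m*n)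
  open import Data.Integer.Tactic.RingSolver using (solve-∀)
  open import Data.Fin using (Fin)
  open import Data.List using (List; []; _∷_; _++_; length; allFin)
  open import Data.List.Properties using (length-tabulate; ++-identityʳ)
  open import Data.List.Membership.Propositional using (_∈_)
  open import Data.List.Membership.Propositional.Properties using (∈-allFin)
  open import Data.List.Relation.Unary.Any using (here; there)
  open import Data.List.Relation.Binary.Permutation.Propositional using (_↭_; ↭-refl; ↭-sym; ↭-trans; ↭-reflexive; prep)
  open import Data.List.Relation.Binary.Permutation.Propositional.Properties using (shift)
  open import Data.Product using (∃; _×_; _,_)
  open import Data.Sum using (_⊎_; inj₁; inj₂)
  open import Data.Empty using (⊥-elim)
  open import Function using (id)
  open import Relation.Nullary
  open import Relation.Binary.PropositionalEquality

  binomial : ℕ → ℕ → ℕ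
  binomial n zero = 1
  binomial zero (suc k) = 0
  binomial (suc n) (suc k) = binomial n k ℕ.+ binomial n (suc k)

  binomial-diagonal : ∀ n → binomial n n ≡ 1
  binomial-diagonal zero = refl
  binomial-diagonal (suc n) = cong₂ ℕ._+_ (binomial-diagonal n) (above n (suc n) ℕ.≤-refl)
    where
    above : ∀ n k → n < k → binomial n k ≡ 0
    above zero (suc k) _ = refl
    above (suc n) (suc k) (s≤s n<k) = cong₂ ℕ._+_ (above n k n<k) (above n (suc k) (ℕ.m<n⇒m<1+n n<k))

  -- With k = q - 1 the right side has the factor q; this is the source of divisibility below.
  absorption : ∀ n k → suc n ℕ.* binomial n k ≡ suc k ℕ.* binomial (suc n) (suc k)
  absorption zero zero = refl
  absorption zero (suc k) = sym (ℕ.*-zeroʳ (suc (suc k)))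
  absorption (suc n) zero = trans (lemma (suc n)) (cong (λ b → 1 ℕ.* (1 ℕ.+ b)) (trans (absorption n zero) (ℕ.*-identityˡ _)))
    where
    lemma : ∀ n → (1 ℕ.+ n) ℕ.* 1 ≡ 1 ℕ.* (1 ℕ.+ n ℕ.* 1)
    lemma = ℕ.solve-∀
  absorption (suc n) (suc k) = begin
    suc (suc n) ℕ.* (b ℕ.+ c) ≡⟨ lemma₁ n b c ⟩
    b ℕ.+ c ℕ.+ suc n ℕ.* b ℕ.+ suc n ℕ.* c ≡⟨ cong₂ (λ s t → b ℕ.+ c ℕ.+ s ℕ.+ t) (absorption n k) (absorption n (suc k)) ⟩
    b ℕ.+ c ℕ.+ suc k ℕ.* (b ℕ.+ c) ℕ.+ suc (suc k) ℕ.* d ≡⟨ lemma₂ k b c d ⟩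
    suc (suc k) ℕ.* (b ℕ.+ c ℕ.+ d) ∎
    where
    open ≡-Reasoning
    b = binomial n k
    c = binomial n (suc k)
    d = binomial (suc n) (suc (suc k))
    lemma₁ : ∀ n b c → (2 ℕ.+ n) ℕ.* (b ℕ.+ c) ≡ b ℕ.+ c ℕ.+ (1 ℕ.+ n) ℕ.* b ℕ.+ (1 ℕ.+ n) ℕ.* c
    lemma₁ = ℕ.solve-∀
    lemma₂ : ∀ k b c d → b ℕ.+ c ℕ.+ (1 ℕ.+ k) ℕ.* (b ℕ.+ c) ℕ.+ (2 ℕ.+ k) ℕ.* d ≡ (2 ℕ.+ k) ℕ.* (b ℕ.+ c ℕ.+ d)
    lemma₂ = ℕ.solve-∀

  module PrimePowers {p} (pp : Prime p) where
    instance
      p≢0 : ℕ.NonZero p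
      p≢0 = prime⇒nonZero pp

    -- The factors p are removed from a one at a time by Euclid's lemma.
    prime-power-cancel : ∀ k a b → p ^ k ℕ.∣ a ℕ.* b → ¬ p ℕ.∣ b → p ^ k ℕ.∣ a
    prime-power-cancel zero a b _ _ = ℕ.1∣ a
    prime-power-cancel (suc k) a b pk∣ab p∤b with euclidsLemma a b pp (ℕ.∣-trans (ℕ.m∣m*n (p ^ k)) pk∣ab)
    ... | inj₂ p∣b = ⊥-elim (p∤b p∣b)
    ... | inj₁ (ℕ.divides a′ refl) = subst (p ^ suc k ℕ.∣_) (ℕ.*-comm p a′)
          (ℕ.*-monoʳ-∣ p (prime-power-cancel k a′ b (ℕ.*-cancelˡ-∣ p (subst (p ^ suc k ℕ.∣_) (lemma p a′ b) pk∣ab)) p∤b))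
      where
      lemma : ∀ p a b → a ℕ.* p ℕ.* b ≡ p ℕ.* (a ℕ.* b)
      lemma = ℕ.solve-∀

    -- By absorption, q divides (z + q) times the binomial. If p did not divide the binomial, then q
    -- would divide z + q and hence z.
    binomial-vanishes : ∀ k Q → p ^ k ≡ suc Q → ∀ z → ¬ p ^ k ℕ.∣ z → p ℕ.∣ binomial (z ℕ.+ Q) Q
    binomial-vanishes k Q q≡ z q∤z with p ℕ.∣? binomial (z ℕ.+ Q) Q
    ... | yes p∣b = p∣b
    ... | no p∤b = ⊥-elim (q∤z (ℕ.∣m+n∣m⇒∣n (subst (p ^ k ℕ.∣_) (trans (cong suc (ℕ.+-comm z Q)) (cong (ℕ._+ z) (sym q≡))) q∣z+q) ℕ.∣-refl))
      where
      q∣z+q : p ^ k ℕ.∣ suc (z ℕ.+ Q)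
      q∣z+q = prime-power-cancel k (suc (z ℕ.+ Q)) (binomial (z ℕ.+ Q) Q)
        (subst₂ ℕ._∣_ (sym q≡) (sym (absorption (z ℕ.+ Q) Q)) (ℕ.m∣m*n _)) p∤b

  -- Degree< s g says that g, as a function of sums over the list, behaves like a polynomial of degree less than s.
  module Degrees {A : Set} where
    Δ : A → (List A → ℤ) → List A → ℤ
    Δ a g xs = g (a ∷ xs) - g xs

    Degree< : ℕ → (List A → ℤ) → Set
    Degree< zero g = ∀ xs → g xs ≡ 0ℤ
    Degree< (suc s) g = ∀ a → Degree< s (Δ a g)

    degree-cong : ∀ s {g h} → (∀ xs → g xs ≡ h xs) → Degree< s g → Degree< s h
    degree-cong zero e d xs = trans (sym (e xs)) (d xs)
    degree-cong (suc s) e d a = degree-cong s (λ xs → cong₂ _-_ (e (a ∷ xs)) (e xs)) (d a)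

    degree-zero : ∀ s {g} → (∀ xs → g xs ≡ 0ℤ) → Degree< s g
    degree-zero zero e = e
    degree-zero (suc s) e a = degree-zero s (λ xs → cong₂ _-_ (e (a ∷ xs)) (e xs))

    degree-suc : ∀ s {g} → Degree< s g → Degree< (suc s) g
    degree-suc zero d a = degree-zero zero (λ xs → cong₂ _-_ (d (a ∷ xs)) (d xs))
    degree-suc (suc s) d a = degree-suc s (d a)

    degree-≤ : ∀ {s t g} → s ≤ t → Degree< s g → Degree< t g
    degree-≤ {t = t} z≤n d = degree-zero t d
    degree-≤ (s≤s s≤t) d a = degree-≤ s≤t (d a)

    degree-+ : ∀ s {g h} → Degree< s g → Degree< s h → Degree< s (λ xs → g xs + h xs)
    degree-+ zero d e xs = cong₂ _+_ (d xs) (e xs)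
    degree-+ (suc s) {g} {h} d e a = degree-cong s (λ xs → lemma (g (a ∷ xs)) (g xs) (h (a ∷ xs)) (h xs)) (degree-+ s (d a) (e a))
      where
      lemma : ∀ x y z w → (x - y) + (z - w) ≡ (x + z) - (y + w)
      lemma = solve-∀

    degree-* : ∀ s t {g h} → Degree< (suc s) g → Degree< (suc t) h → Degree< (suc (s ℕ.+ t)) (λ xs → g xs * h xs)
    degree-* s t {g} {h} d e a = degree-cong (s ℕ.+ t) (λ xs → lemma (g (a ∷ xs)) (g xs) (h (a ∷ xs)) (h xs))
      (degree-+ (s ℕ.+ t) (degree-+ (s ℕ.+ t) (left s d) (right t e)) (both s d))
      where
      lemma : ∀ x y z w → ((x - y) * w + y * (z - w)) + (x - y) * (z - w) ≡ x * z - y * w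
      lemma = solve-∀
      left : ∀ s → Degree< (suc s) g → Degree< (s ℕ.+ t) (λ xs → Δ a g xs * h xs)
      left zero d = degree-zero t (λ xs → trans (cong (_* h xs) (d a xs)) (ℤ.*-zeroˡ (h xs)))
      left (suc s) d = degree-* s t {Δ a g} {h} (d a) e
      right : ∀ t → Degree< (suc t) h → Degree< (s ℕ.+ t) (λ xs → g xs * Δ a h xs)
      right zero e = degree-zero (s ℕ.+ 0) (λ xs → trans (cong (g xs *_) (e a xs)) (ℤ.*-zeroʳ (g xs)))
      right (suc t) e = subst (λ n → Degree< n (λ xs → g xs * Δ a h xs)) (sym (ℕ.+-suc s t)) (degree-* s t {g} {Δ a h} d (e a))
      both : ∀ s → Degree< (suc s) g → Degree< (s ℕ.+ t) (λ xs → Δ a g xs * Δ a h xs)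
      both zero d = degree-zero t (λ xs → trans (cong (_* Δ a h xs) (d a xs)) (ℤ.*-zeroˡ (Δ a h xs)))
      both (suc s) d = degree-* s t {Δ a g} {Δ a h} (d a) (degree-suc t {Δ a h} (e a))

    -- The argument grows by `f a` in unit steps, and by Pascal's rule each step adds a binomial
    -- with lower index k.
    degree-binomial : ∀ (f : A → ℕ) k m → Degree< (suc k) (λ xs → + binomial (∑ xs f ℕ.+ m) k)
    degree-binomial f zero m a xs = refl
    degree-binomial f (suc k) m a = by-steps (f a)
      where
      b : ℕ → ℕ → List A → ℤ
      b k t xs = + binomial (t ℕ.+ ∑ xs f ℕ.+ m) k
      by-steps : ∀ t → Degree< (suc k) (λ xs → b (suc k) t xs - b (suc k) 0 xs)
      by-steps zero = degree-zero (suc k) (λ xs → ℤ.+-inverseʳ (b (suc k) 0 xs))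
      by-steps (suc t) = degree-cong (suc k) (λ xs → trans (lemma (b k t xs) (b (suc k) t xs) (b (suc k) 0 xs)) (cong (_- b (suc k) 0 xs) (sym (ℤ.pos-+ (binomial (t ℕ.+ ∑ xs f ℕ.+ m) k) _))))
        (degree-+ (suc k) {b k t} {λ xs → b (suc k) t xs - b (suc k) 0 xs} (degree-cong (suc k) (λ xs → cong (λ n → + binomial n k) (rearrange t (∑ xs f) m)) (degree-binomial f k (t ℕ.+ m))) (by-steps t))
        where
        lemma : ∀ x y z → x + (y - z) ≡ (x + y) - z
        lemma = solve-∀
        rearrange : ∀ t s m → s ℕ.+ (t ℕ.+ m) ≡ t ℕ.+ s ℕ.+ m
        rearrange = ℕ.solve-∀

    -- The iterated difference along T: expanded, the alternating sum of g over all subsequences of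
    -- T, each placed before `xs`.
    alternating : (List A → ℤ) → List A → List A → ℤ
    alternating g [] = g
    alternating g (a ∷ T) = Δ a (alternating g T)

    alternating-degree : ∀ {g} s T → Degree< (s ℕ.+ length T) g → Degree< s (alternating g T)
    alternating-degree s [] d = subst (λ n → Degree< n _) (ℕ.+-identityʳ s) d
    alternating-degree {g} s (a ∷ T) d = alternating-degree (suc s) T (subst (λ n → Degree< n g) (ℕ.+-suc s (length T)) d) a

  module _ {A : Set} {p} (pp : Prime p) where
    open PrimePowers pp
    open Degrees {A}

    sign : List A → ℤ
    sign [] = 1ℤ
    sign (_ ∷ T) = - sign T

    sign*sign : ∀ T → sign T * sign T ≡ 1ℤ
    sign*sign [] = refl
    sign*sign (_ ∷ T) = trans (lemma (sign T)) (sign*sign T)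
      where
      lemma : ∀ x → - x * - x ≡ x * x
      lemma = solve-∀

    -- A non-empty subsequence of T at which g does not vanish modulo p. The list `us` allows any
    -- order of its terms, since g is not assumed symmetric.
    Survives : (List A → ℤ) → List A → List A → Set
    Survives g T xs = ∃ λ ys → ∃ λ zs → ∃ λ us → T ↭ ys ++ zs × 0 < length ys × us ↭ ys ++ xs × ¬ + p ∣ g us

    -- If nothing survives, every non-empty subsequence contributes a multiple of p to the
    -- alternating sum, leaving only the term of the empty one, whose sign is `sign T`.
    survivor : ∀ g T xs → Survives g T xs ⊎ + p ∣ alternating g T xs - sign T * g xs
    survivor g [] xs = inj₂ (divides 0ℤ (lemma (g xs)))
      where
      lemma : ∀ x → x - 1ℤ * x ≡ 0ℤ
      lemma = solve-∀
    survivor g (a ∷ T) xs = combine (survivor g T xs) (survivor g T (a ∷ xs)) (+ p ∣? g (a ∷ xs))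
      where
      lemma : ∀ x y z w s → (x - s * w + s * w) - (y - s * z) ≡ (x - y) - - s * z
      lemma = solve-∀
      combine : Survives g T xs ⊎ + p ∣ alternating g T xs - sign T * g xs →
        Survives g T (a ∷ xs) ⊎ + p ∣ alternating g T (a ∷ xs) - sign T * g (a ∷ xs) → Dec (+ p ∣ g (a ∷ xs)) →
        Survives g (a ∷ T) xs ⊎ + p ∣ alternating g (a ∷ T) xs - - sign T * g xs
      combine (inj₁ (ys , zs , us , π , 0< , ρ , ∤)) _ _ = inj₁ (ys , a ∷ zs , us , ↭-trans (prep a π) (↭-sym (shift a ys zs)) , 0< , ρ , ∤)
      combine (inj₂ _) (inj₁ (ys , zs , us , π , 0< , ρ , ∤)) _ = inj₁ (a ∷ ys , zs , us , prep a π , z<s , ↭-trans ρ (shift a ys xs) , ∤)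
      combine (inj₂ _) (inj₂ _) (no ∤) = inj₁ (a ∷ [] , T , a ∷ xs , ↭-refl , z<s , ↭-refl , ∤)
      combine (inj₂ h) (inj₂ h′) (yes ∣) = inj₂ (subst (+ p ∣_) (lemma (alternating g T (a ∷ xs)) (alternating g T xs) (g xs) (g (a ∷ xs)) (sign T))
        (∣m∣n⇒∣m-n (∣m∣n⇒∣m+n h′ (∣n⇒∣m*n (sign T) ∣)) h))

    module _ (Q : ℕ) {I : Set} (f : A → I → ℕ) where
      -- For Q = q - 1 this is 1 on the empty list and vanishes modulo p as soon as one coordinate
      -- sum is not a multiple of q.
      indicator : List I → List A → ℤ
      indicator [] xs = 1ℤ
      indicator (i ∷ is) xs = + binomial (∑ xs (λ a → f a i) ℕ.+ Q) Q * indicator is xs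

      indicator-degree : ∀ is → Degree< (suc (length is ℕ.* Q)) (indicator is)
      indicator-degree [] a xs = refl
      indicator-degree (i ∷ is) = degree-* Q (length is ℕ.* Q) {λ xs → + binomial (∑ xs (λ a → f a i) ℕ.+ Q) Q} {indicator is} (degree-binomial (λ a → f a i) Q Q) (indicator-degree is)

      indicator-[] : ∀ is → indicator is [] ≡ 1ℤ
      indicator-[] [] = refl
      indicator-[] (i ∷ is) = cong₂ (λ b c → + b * c) (binomial-diagonal Q) (indicator-[] is)

      indicator-∣ : ∀ {i is xs} → i ∈ is → p ℕ.∣ binomial (∑ xs (λ a → f a i) ℕ.+ Q) Q → + p ∣ indicator is xs
      indicator-∣ {is = i ∷ is} {xs} (here refl) ∣ = ∣m⇒∣m*n {m = + binomial (∑ xs (λ a → f a i) ℕ.+ Q) Q} (indicator is xs) (∣ᵤ⇒∣ ∣)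
      indicator-∣ {is = j ∷ is} {xs} (there i∈) ∣ = ∣n⇒∣m*n (+ binomial (∑ xs (λ a → f a j) ℕ.+ Q) Q) (indicator-∣ i∈ ∣)

    -- The length exceeds the degree r (q - 1) of the indicator, so its alternating sum is 0.
    -- Without a survivor it would be ±1 modulo p.
    olson : ∀ k {r} (f : A → Fin r → ℕ) (T : List A) → r ℕ.* (p ^ k ℕ.∸ 1) ℕ.+ 1 ≤ length T →
      ∃ λ ys → ∃ λ zs → T ↭ ys ++ zs × 0 < length ys × (∀ i → p ^ k ℕ.∣ ∑ ys (λ a → f a i))
    olson k {r} f T enough = conclude (survivor G T [])
      where
      Q = p ^ k ℕ.∸ 1
      q≡ : p ^ k ≡ suc Q
      q≡ = sym (ℕ.m+[n∸m]≡n (ℕ.m^n>0 p k))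
      G = indicator Q f (allFin r)
      degree : Degree< (length T) G
      degree = degree-≤ (ℕ.≤-trans (ℕ.≤-reflexive (trans (cong (λ l → suc (l ℕ.* Q)) (length-tabulate {n = r} id)) (ℕ.+-comm 1 _))) enough) (indicator-degree Q f (allFin r))
      vanishes : alternating G T [] ≡ 0ℤ
      vanishes = alternating-degree 0 T degree []
      conclude : Survives G T [] ⊎ + p ∣ alternating G T [] - sign T * G [] →
        ∃ λ ys → ∃ λ zs → T ↭ ys ++ zs × 0 < length ys × (∀ i → p ^ k ℕ.∣ ∑ ys (λ a → f a i))
      conclude (inj₁ (ys , zs , us , π , 0< , ρ , ∤)) = ys , zs , π , 0< , zero-sum
        where
        zero-sum : ∀ i → p ^ k ℕ.∣ ∑ ys (λ a → f a i)
        zero-sum i with p ^ k ℕ.∣? ∑ us (λ a → f a i)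
        ... | yes ∣ = subst (p ^ k ℕ.∣_) (∑-↭ (λ a → f a i) (↭-trans ρ (↭-reflexive (++-identityʳ ys)))) ∣
        ... | no q∤ = ⊥-elim (∤ (indicator-∣ Q f (∈-allFin i) (binomial-vanishes k Q q≡ _ q∤)))
      conclude (inj₂ ∣) = ⊥-elim (ℕ.<⇒≱ (ℕ.nonTrivial⇒n>1 p ⦃ prime⇒nonTrivial pp ⦄) (ℕ.∣⇒≤ (∣⇒∣ᵤ (subst (+ p ∣_) unit (∣n⇒∣m*n (- sign T) ∣)))))
        where
        lemma : ∀ s → - s * (0ℤ - s * 1ℤ) ≡ s * s
        lemma = solve-∀
        -- Multiplying by -`sign T` turns the divisibility into p ∣ 1.
        unit : - sign T * (alternating G T [] - sign T * G []) ≡ 1ℤ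
        unit = trans (cong₂ (λ x y → - sign T * (x - sign T * y)) vanishes (indicator-[] Q f (allFin r))) (trans (lemma (sign T)) (sign*sign T))

-- Zero-sum blocks of arbitrary length m.

module Blocks where
  open Summation
  open FiniteField
  open LinearAlgebra
  open SubsetSums
  open PrimeBlocks
  open import Data.Nat
  open import Data.Nat.Properties
  open import Data.Nat.DivMod using (_/_; m/n*n≡m)
  open import Data.Nat.Divisibility using (_∣_; *-monoˡ-∣; 1∣_)
  open import Data.Nat.ListAction using (sum; product)
  open import Data.Nat.Primality using (Prime; prime⇒nonZero; prime⇒nonTrivial)
  open import Data.Nat.Primality.Factorisation using (factorise; PrimeFactorisation)
  open import Data.Nat.Tactic.RingSolver using (solve-∀)
  open import Data.Fin using (Fin)
  open import Data.List using (List; []; _∷_; [_]; _++_; length; concat; map)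
  open import Data.List.Properties using (length-++; ++-assoc; concat-++)
  open import Data.List.Relation.Unary.All as All using (All; []; _∷_)
  open import Data.List.Relation.Unary.All.Properties using (++⁻ˡ)
  open import Data.List.Relation.Binary.Permutation.Propositional as Perm using (_↭_; ↭-refl; ↭-sym; ↭-trans; ↭-reflexive; prep; swap)
  open import Data.List.Relation.Binary.Permutation.Propositional.Properties using (++⁺ˡ; ++⁺ʳ; shifts; ↭-length; All-resp-↭)
  open import Data.List.Relation.Binary.Sublist.Propositional using (_⊆_; []; _∷_; _∷ʳ_)
  import Data.Vec as Vec
  import Data.Vec.Properties as Vec
  open import Data.Product using (∃; _×_; _,_; proj₁; proj₂)
  open import Relation.Binary.PropositionalEquality hiding ([_])

  private variable
    A : Set
    r : ℕ

  ∑-sum : ∀ (xs : List A) f → ∑ xs f ≡ sum (map f xs)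
  ∑-sum [] f = refl
  ∑-sum (x ∷ xs) f = cong (f x +_) (∑-sum xs f)

  concat-↭ : {bs cs : List (List A)} → bs ↭ cs → concat bs ↭ concat cs
  concat-↭ Perm.refl = ↭-refl
  concat-↭ (prep b π) = ++⁺ˡ b (concat-↭ π)
  concat-↭ {cs = _ ∷ _ ∷ cs} (swap b c π) = ↭-trans (shifts b c) (++⁺ˡ c (++⁺ˡ b (concat-↭ π)))
  concat-↭ (Perm.trans π ρ) = ↭-trans (concat-↭ π) (concat-↭ ρ)

  -- Splittings are handled up to permutation; this turns them back into subsequences in the
  -- original order.
  sublist-↭ : {xs ys us : List A} → xs ↭ ys → us ⊆ ys → ∃ λ vs → vs ⊆ xs × vs ↭ us
  sublist-↭ Perm.refl τ = _ , τ , ↭-refl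
  sublist-↭ (prep x π) (.x ∷ʳ τ) = let vs , τ′ , ρ = sublist-↭ π τ in vs , x ∷ʳ τ′ , ρ
  sublist-↭ (prep x π) (refl ∷ τ) = let vs , τ′ , ρ = sublist-↭ π τ in x ∷ vs , refl ∷ τ′ , prep x ρ
  sublist-↭ (swap x y π) (.y ∷ʳ (.x ∷ʳ τ)) = let vs , τ′ , ρ = sublist-↭ π τ in vs , x ∷ʳ (y ∷ʳ τ′) , ρ
  sublist-↭ (swap x y π) (.y ∷ʳ (refl ∷ τ)) = let vs , τ′ , ρ = sublist-↭ π τ in x ∷ vs , refl ∷ (y ∷ʳ τ′) , prep x ρ
  sublist-↭ (swap x y π) (refl ∷ (.x ∷ʳ τ)) = let vs , τ′ , ρ = sublist-↭ π τ in y ∷ vs , x ∷ʳ (refl ∷ τ′) , prep y ρ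
  sublist-↭ (swap x y π) (refl ∷ (refl ∷ τ)) = let vs , τ′ , ρ = sublist-↭ π τ in x ∷ y ∷ vs , refl ∷ (refl ∷ τ′) , swap x y ρ
  sublist-↭ (Perm.trans π₁ π₂) τ =
    let vs , τ₂ , ρ₂ = sublist-↭ π₂ τ
        ws , τ₁ , ρ₁ = sublist-↭ π₁ τ₂
    in ws , τ₁ , ↭-trans ρ₁ ρ₂

  weight : (A → Fin r → ℕ) → List A → Fin r → ℕ
  weight f ys i = ∑ ys (λ a → f a i)

  Block : (A → Fin r → ℕ) → ℕ → List A → Set
  Block f m ys = length ys ≡ m × (∀ i → m ∣ weight f ys i)

  -- All types of terms are allowed, because blocks become the terms of the next level. The shape C
  -- (m - 1) + 1 of the bound is what passes to products with the same C.
  HasBlocks : ℕ → ℕ → ℕ → Set₁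
  HasBlocks r C m = ∀ {A : Set} (f : A → Fin r → ℕ) (T : List A) → C * (m ∸ 1) + 1 ≤ length T → ∃ λ ys → ∃ λ zs → T ↭ ys ++ zs × Block f m ys

  -- The factor 2 comes from p ≤ 2 (p - 1).
  prime-blocks : ∀ {p} → Prime p → ∀ r → HasBlocks r (2 * egzConstant r) p
  prime-blocks {zero} pp with () ← prime⇒nonZero pp
  prime-blocks {suc P} pp r {A} f T enough = convert (egz r vec T long)
    where
    p = suc P
    1<p : 1 < p
    1<p = nonTrivial⇒n>1 p ⦃ prime⇒nonTrivial pp ⦄
    𝔽 = primeField pp
    open PrimeCase 1<p 𝔽
    open Stages 1<p 𝔽
    vec : A → V r
    vec a = Vec.tabulate (λ i → ι (f a i))
    long : egzConstant r * p ≤ length T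
    long = ≤-trans (*-monoʳ-≤ (egzConstant r) (+-monoˡ-≤ P (≤-pred 1<p))) (≤-trans (≤-reflexive (lemma (egzConstant r) P)) (≤-trans (m≤m+n _ 1) enough))
      where
      lemma : ∀ c P → c * (P + P) ≡ 2 * c * P
      lemma = solve-∀
    lookup-vsum : ∀ ys i → Vec.lookup (vsum vec ys) i ≡ ι (weight f ys i)
    lookup-vsum [] i = trans (Vec.lookup-replicate i 0f) (sym ι-0)
    lookup-vsum (y ∷ ys) i = trans (Vec.lookup-zipWith _⊹_ i (vec y) (vsum vec ys))
      (trans (cong₂ _⊹_ (Vec.lookup∘tabulate (λ i → ι (f y i)) i) (lookup-vsum ys i)) (sym (ι-+ (f y i) (weight f ys i))))
    convert : ZeroSumBlock vec T → ∃ λ ys → ∃ λ zs → T ↭ ys ++ zs × Block f p ys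
    convert (ys , zs , π , len , zero-sum) = ys , zs , π , len ,
      λ i → ι≡0⇒∣ (trans (sym (lookup-vsum ys i)) (trans (cong (λ v → Vec.lookup v i) zero-sum) (Vec.lookup-replicate i 0f)))

  one-blocks : ∀ r C → HasBlocks r C 1
  one-blocks r C f [] enough with () ← ≤-trans (m≤n+m 1 (C * 0)) enough
  one-blocks r C f (a ∷ T) enough = [ a ] , T , ↭-refl , refl , λ i → 1∣ weight f [ a ] i

  module _ {r m : ℕ} .⦃ _ : NonZero m ⦄ where

    -- Greedy choice. The last block needs C (m - 1) + 1 remaining terms and each earlier one m
    -- more; the m on the right stands for n - 1 in place of n.
    extract : ∀ {C} → HasBlocks r C m → (f : A → Fin r → ℕ) → ∀ n T → n * m + (C * (m ∸ 1) + 1) ≤ length T + m →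
      ∃ λ bs → ∃ λ zs → T ↭ concat bs ++ zs × length bs ≡ n × All (Block f m) bs
    extract blocks f zero T enough = [] , T , ↭-refl , refl , []
    extract {C = C} blocks f (suc n) T enough =
      let enough′ = +-cancelʳ-≤ m (n * m + (C * (m ∸ 1) + 1)) (length T) (≤-trans (≤-reflexive (rearrange (n * m) m (C * (m ∸ 1) + 1))) enough)
          ys , zs , π , block = blocks f T (≤-trans (m≤n+m _ (n * m)) enough′)
          bs , zs′ , ρ , len , all = extract {C = C} blocks f n zs (≤-trans enough′ (≤-reflexive (trans (↭-length π) (trans (length-++ ys) (trans (cong (_+ length zs) (proj₁ block)) (+-comm m _))))))
      in ys ∷ bs , zs′ , ↭-trans π (↭-trans (++⁺ˡ ys ρ) (↭-reflexive (sym (++-assoc ys (concat bs) zs′)))) , cong suc len , block ∷ all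
      where
      rearrange : ∀ a m c → a + c + m ≡ m + a + c
      rearrange = solve-∀

    quotient : (A → Fin r → ℕ) → List A → Fin r → ℕ
    quotient f b i = weight f b i / m

    weight-concat : {f : A → Fin r → ℕ} {bs : List (List A)} → All (Block f m) bs → ∀ i → weight f (concat bs) i ≡ weight (quotient f) bs i * m
    weight-concat [] i = refl
    weight-concat {f = f} {b ∷ bs} ((_ , m∣) ∷ all) i = trans (∑-++ b (concat bs) (λ a → f a i)) (trans (cong₂ _+_ (sym (m/n*n≡m (m∣ i))) (weight-concat all i))
      (sym (*-distribʳ-+ m (quotient f b i) _)))

    length-concat-blocks : {f : A → Fin r → ℕ} {bs : List (List A)} → All (Block f m) bs → length (concat bs) ≡ length bs * m
    length-concat-blocks [] = refl
    length-concat-blocks {bs = b ∷ bs} ((len , _) ∷ all) = trans (length-++ b) (cong₂ _+_ len (length-concat-blocks all))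

    -- Each weight of a block is m times its quotient, so divisibility of the quotient sums by k
    -- becomes divisibility of the weights by k m after concatenation.
    lift : {f : A → Fin r → ℕ} {T zs : List A} {bs us vs : List (List A)} (k : ℕ) → T ↭ concat bs ++ zs → All (Block f m) bs → bs ↭ us ++ vs →
      (∀ i → k ∣ weight (quotient f) us i) →
      T ↭ concat us ++ (concat vs ++ zs) × length (concat us) ≡ length us * m × (∀ i → k * m ∣ weight f (concat us) i)
    lift {f = f} {zs = zs} {us = us} {vs} k π all ρ k∣ =
      ↭-trans π (↭-trans (++⁺ʳ zs (concat-↭ ρ)) (↭-reflexive (trans (cong (_++ zs) (sym (concat-++ us vs))) (++-assoc (concat us) (concat vs) zs)))) ,
      length-concat-blocks us-blocks ,
      λ i → subst (k * m ∣_) (sym (weight-concat us-blocks i)) (*-monoˡ-∣ m (k∣ i))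
      where
      us-blocks = ++⁻ˡ us (All-resp-↭ ρ all)

    -- Split off C (n - 1) + 1 blocks of length m and choose n of them by the outer property,
    -- applied to their quotients. The count works out with equality.
    *-blocks : ∀ {C n} .⦃ _ : NonZero n ⦄ → HasBlocks r C n → HasBlocks r C m → HasBlocks r C (n * m)
    *-blocks {C} {n} outer inner f T enough =
      let bs , zs , π , len , all = extract {C = C} inner f (C * (n ∸ 1) + 1) T (≤-trans (≤-reflexive (count m n)) (+-monoˡ-≤ m enough))
          us , vs , ρ , us-length , n∣ = outer (quotient f) bs (≤-reflexive (sym len))
          σ , total , nm∣ = lift {f = f} {us = us} {vs = vs} n π all ρ n∣
      in concat us , concat vs ++ zs , σ , trans total (cong (_* m) us-length) , nm∣
      where
      count : ∀ m n .⦃ _ : NonZero m ⦄ .⦃ _ : NonZero n ⦄ → (C * (n ∸ 1) + 1) * m + (C * (m ∸ 1) + 1) ≡ C * (n * m ∸ 1) + 1 + m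
      count (suc m) (suc n) = lemma C m n
        where
        lemma : ∀ C m n → (C * n + 1) * (1 + m) + (C * m + 1) ≡ C * (m + n * (1 + m)) + 1 + (1 + m)
        lemma = solve-∀

  blockConstant : ℕ → ℕ
  blockConstant r = 2 * egzConstant r

  -- Induction over the prime factorisation, with the same constant for all primes.
  has-blocks : ∀ r m .⦃ _ : NonZero m ⦄ → HasBlocks r (blockConstant r) m
  has-blocks r m = subst (HasBlocks r (blockConstant r)) (sym isFactorisation) (proj₂ (go factors factorsPrime))
    where
    open PrimeFactorisation (factorise m)
    go : ∀ ps → All Prime ps → NonZero (product ps) × HasBlocks r (blockConstant r) (product ps)
    go [] [] = _ , one-blocks r (blockConstant r)
    go (p ∷ ps) (pp ∷ pps) =
      let nz , blocks = go ps pps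
      in m*n≢0 p (product ps) ⦃ prime⇒nonZero pp ⦄ ⦃ nz ⦄ , λ {A} → *-blocks {r} {product ps} ⦃ nz ⦄ {blockConstant r} {p} ⦃ prime⇒nonZero pp ⦄ (prime-blocks pp r) blocks {A}

open import Defs
open import Data.Nat using (ℕ; _+_; _*_; _∸_; _≤_)
open import Data.Product using (∃)
open import Relation.Binary.PropositionalEquality using (_≡_)

-- The bound for the Davenport constant.

module Davenport where
  open import Data.Nat hiding (_/_)
  open import Data.Nat.Properties
  open import Data.Nat.Divisibility using (_∣_)
  open import Data.Nat.Primality using (Prime; prime⇒nonZero)
  open import Data.Nat.Tactic.RingSolver using (solve-∀)
  open import Data.Fin using (Fin; toℕ)
  open import Data.List using (List; []; _++_; length; concat)
  open import Data.List.Relation.Binary.Permutation.Propositional using (_↭_)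
  open import Data.List.Relation.Binary.Permutation.Propositional.Properties using (↭-length)
  open import Data.List.Relation.Binary.Sublist.Propositional using (⊆-refl)
  open import Data.List.Relation.Binary.Sublist.Propositional.Properties using (++⁺ʳ)
  open import Data.Product using (∃; _×_; _,_)
  open import Relation.Binary.PropositionalEquality hiding ([_])
  open Summation
  open Olson
  open Blocks

  -- Olson's theorem is applied to the quotients of r (q - 1) + 1 blocks of length m. Splitting
  -- these off requires r (q - 1) m + C (m - 1) + 1 terms, which is r (m - 1) fewer than assumed.
  zero-sum-sublist : ∀ {r p} k m .⦃ _ : NonZero m ⦄ → Prime p → {A : Set} (f : A → Fin r → ℕ) (T : List A) →
    r * (p ^ k * m ∸ 1) + 1 + blockConstant r * (m ∸ 1) ≤ length T →
    ∃ λ ys → ∃ λ zs → T ↭ ys ++ zs × 0 < length ys × (∀ i → p ^ k * m ∣ weight f ys i)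
  zero-sum-sublist {r} {p} k m pp f T enough =
    let bs , zs , π , len , all = extract {C = C} (has-blocks r m) f (r * (p ^ k ∸ 1) + 1) T (≤-trans (count (p ^ k) m) (+-monoˡ-≤ m enough))
        us , vs , ρ , 0<us , pk∣ = olson pp k (quotient f) bs (≤-reflexive (sym len))
        σ , total , n∣ = lift {f = f} {us = us} {vs = vs} (p ^ k) π all ρ pk∣
    in concat us , concat vs ++ zs , σ , ≤-trans (*-mono-≤ 0<us (>-nonZero⁻¹ m)) (≤-reflexive (sym total)) , n∣
    where
    instance
      q≢0 : NonZero (p ^ k)
      q≢0 = m^n≢0 p k ⦃ prime⇒nonZero pp ⦄
    C = blockConstant r
    count : ∀ q m .⦃ _ : NonZero q ⦄ .⦃ _ : NonZero m ⦄ → (r * (q ∸ 1) + 1) * m + (C * (m ∸ 1) + 1) ≤ r * (q * m ∸ 1) + 1 + C * (m ∸ 1) + m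
    count (suc q) (suc m) = ≤-by (r * m) (≤-refl {0}) (lemma r q m (C * m))
      where
      lemma : ∀ r q m c → (r * q + 1) * (1 + m) + (c + 1) + 0 + r * m ≡ r * (m + q * (1 + m)) + 1 + c + (1 + m) + 0
      lemma = solve-∀

  davenport-bound : (r : ℕ) → 1 ≤ r →
    ∃ λ (d : ℕ) → (n : ℕ) → 1 ≤ n → (q m : ℕ) →
      IsGreatestPrimePowerDivisor n q → n ≡ q * m →
      DavenportLE n r (r * (n ∸ 1) + 1 + d * (m ∸ 1))
  davenport-bound r _ = blockConstant r , bound
    where
    bound : ∀ n → 1 ≤ n → ∀ q m → IsGreatestPrimePowerDivisor n q → n ≡ q * m → DavenportLE n r (r * (n ∸ 1) + 1 + blockConstant r * (m ∸ 1))
    bound n 1≤n q m ((p , k , pp , refl) , _) refl xs enough = conclude (zero-sum-sublist k m ⦃ m≢0 ⦄ pp (λ x i → toℕ (x i)) xs enough)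
      where
      m≢0 : NonZero m
      m≢0 = m*n≢0⇒n≢0 (p ^ k) ⦃ >-nonZero 1≤n ⦄
      nonempty : ∀ {ys vs : List (Cnr n r)} → 0 < length ys → vs ↭ ys → vs ≢ []
      nonempty 0<ys ρ refl = <⇒≢ 0<ys (↭-length ρ)
      conclude : (∃ λ ys → ∃ λ zs → xs ↭ ys ++ zs × 0 < length ys × (∀ i → n ∣ weight (λ x i → toℕ (x i)) ys i)) → HasNonemptyZeroSumSubseq xs
      conclude (ys , zs , π , 0<ys , n∣) =
        let vs , vs⊆xs , ρ = sublist-↭ π (++⁺ʳ zs ⊆-refl)
        in vs , vs⊆xs , nonempty 0<ys ρ , λ i → subst (n ∣_) (trans (sym (∑-↭ (λ x → toℕ (x i)) ρ)) (∑-sum vs (λ x → toℕ (x i)))) (n∣ i)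

theorem2 : (r : ℕ) → 1 ≤ r →
    ∃ λ (d : ℕ) → (n : ℕ) → 1 ≤ n → (q m : ℕ) →
      IsGreatestPrimePowerDivisor n q → n ≡ q * m →
      DavenportLE n r (r * (n ∸ 1) + 1 + d * (m ∸ 1))
theorem2 = Davenport.davenport-bound
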